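{- Let $\mathcal{A}$ be a linear, essential hyperplane arrangement in $\mathbb{R}^n$, let $0\le k<n$, and let $\mathcal{A}^{(k)}$ be the $k$-adjoint of $\mathcal{A}$. Assume that $P_1,P_2\in L(\mathcal{A}^{(k)})$ with $P_1\le P_2$. If $U_j\in\mathcal{S}_{P_j}$ for $j=1,2$, then for every $i=0,1,\ldots,k$: (1) $I_i(\mathcal{A}|_{U_1})\ge I_i(\mathcal{A}|_{U_2})$; (2) $|w_i(\mathcal{A}|_{U_1})|\ge|w_i(\mathcal{A}|_{U_2})|$.
   Context: **Arrangements.** A hyperplane arrangement $\mathcal{A}$ in $\mathbb{R}^n$ is a finite set of hyperplanes; linear means all hyperplanes pass through $0$, essential means $\bigcap_{H\in\mathcal{A}}H=\{0\}$. For any linear arrangement $\mathcal{A}$ in a vector space $V$, $L(\mathcal{A})$ is the set of all subspaces $\bigcap_{H\in\mathcal{B}}H$, $\mathcal{B}\subseteq\mathcal{A}$ (the empty intersection being $V$), ordered by reverse inclusion: $X\le Y$ iff $Y\subseteq X$. For $X\in L(\mathcal{A})$, $\mathcal{A}$ in $\mathbb{R}^n$, $\mathrm{rank}(X)=n-\dim X$, and $L_k(\mathcal{A})=\{X\in L(\mathcal{A})\mid\mathrm{rank}(X)=k\}$. For $X\in L(\mathcal{A})$ put $X^\circ=X\setminus\bigcup_{Y\in L(\mathcal{A}),\,Y>X}Y$. For a subspace $U$ of $\mathbb{R}^n$, the restriction is the arrangement $\mathcal{A}|_U=\{H\cap U\mid H\in\mathcal{A},\ U\not\subseteq H\}$ in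 $U$ (a set of hyperplanes of $U$). **Plücker coordinates.** $[n]=\{1,\ldots,n\}$; $\binom{[n]}{k}$ is the set of $k$-subsets of $[n]$; $\mathrm{Gr}(k,n)$ is the set of $k$-dimensional subspaces of $\mathbb{R}^n$. For a $d$-dimensional subspace $U$ of $\mathbb{R}^n$, choose a $d\times n$ matrix $A$ whose row space is $U$; for $I\in\binom{[n]}{d}$, $\Delta_I(U)$ is the $d\times d$ minor of $A$ with column set $I$ (equal to $1$ if $d=0$), and $\Delta(U)=(\Delta_I(U))_I$, well defined up to a common nonzero scalar. **$k$-adjoint and strata.** For $X\in L_k(\mathcal{A})$, $I\in\binom{[n]}{k}$, let $a_I(X)=(-1)^{\frac12k(k+1)+\sum_{i\in I}i}\Delta_{[n]\setminus I}(X)$ and $H(X)=\{(x_I)_I\in\mathbb{R}^{\binom{[n]}{k}}\mid\sum_I a_I(X)x_I=0\}$. The $k$-adjoint is the arrangement $\mathcal{A}^{(k)}=\{H(X)\mid X\in L_k(\mathcal{A})\}$ in $\mathbb{R}^{\binom{[n]}{k}}$. For $P\in L(\mathcal{A}^{(k)})$, $\mathcal{S}_P=\{U\in\mathrm{Gr}(k,n)\mid\Delta(U)\in P^\circ\}$. **Invariants.** For a linear arrangement $\mathcal{B}$, $\mathfrak{M}(\mathcal{B})$ is the matroid on (an index set of) $\mathcal{B}$ given by linear independence of the normal vectors of the hyperplanes of $\mathcal{B}$; $I_i(\mathcal{B})$ is the number of independent sets of size $i$ of $\mathfrak{M}(\mathcal{B})$; $w_i(\mathcal{B})$ is the $i$-th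 Whitney number of the first kind of $\mathfrak{M}(\mathcal{B})$, i.e. the coefficient in the characteristic polynomial $\chi_{\mathfrak{M}}(t)=\sum_{x\in L(\mathfrak{M})}\mu(\hat0,x)t^{r-\mathrm{rank}(x)}=\sum_{i=0}^{r}w_it^{r-i}$, where $\mathfrak M=\mathfrak M(\mathcal B)$, $r$ is the rank of $\mathfrak{M}$, $L(\mathfrak{M})$ its lattice of flats with minimum $\hat0$, and $\mu$ the Möbius function of $L(\mathfrak{M})$. -}

module Defs where

open import Algebra.Bundles using (CommutativeRing)
open import Data.Bool.Base using (if_then_else_)
import Data.Bool.Properties as Bool
open import Data.Fin.Base using (Fin; zero; suc; toℕ; punchIn; cast)
open import Data.Fin.Properties as Fin using (any?; all?)
open import Data.Fin.Subset as Subset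
  using (Subset; inside; outside; ∁; ∣_∣; ⁅_⁆)
open import Data.Fin.Subset.Induction using (⊂-wellFounded)
open import Data.Fin.Subset.Properties using (_∈?_; _⊆?_; _⊂?_; ∣∁p∣≡n∸∣p∣)
open import Data.Integer.Base as ℤ using (ℤ; 0ℤ; 1ℤ)
open import Data.List.Base as List
  using (List; []; _∷_; _++_; length; filter; deduplicate; allFin; lookup)
open import Data.List.Extrema.Nat using (max)
open import Data.List.Membership.Propositional.Properties using (∈-lookup)
open import Data.List.Relation.Unary.All as All using (All)
import Data.List.Relation.Unary.All.Properties as All
open import Data.List.Relation.Unary.AllPairs using (AllPairs; []; _∷_)
open import Data.List.Relation.Unary.Unique.DecSetoid.Properties using (deduplicate-!)
open import Data.Nat.Base as ℕ using (ℕ; zero; suc; _∸_)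
open import Data.Nat.DivMod using (_/_)
import Data.Nat.ListAction as ListAction
import Data.Nat.Properties as ℕ
open import Data.Product.Base using (Σ-syntax; ∃; _×_; _,_; proj₂)
open import Data.Vec.Base using ([]; _∷_; tabulate)
open import Data.Vec.Functional as Vector using (Vector)
import Data.Vec.Functional.Relation.Binary.Equality.Setoid as VecEq
import Data.Vec.Properties as Vec
open import Function.Base using (_∘_)
open import Induction.WellFounded using (Acc; acc)
open import Level using (Level; _⊔_)
open import Relation.Binary.Bundles using (DecSetoid)
open import Relation.Binary.Core using (Rel)
open import Relation.Binary.PropositionalEquality as ≡ using (_≡_; _≢_)
open import Relation.Binary.Structures using (IsDecTotalOrder)
open import Relation.Nullary using (¬_; Dec; yes; no; does; ¬?; contradiction)
import Relation.Nullary.Decidable as Dec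
open import Relation.Nullary.Decidable using (_×-dec_)
open import Relation.Unary using (Pred; Decidable; _∈_; _∉_; _⊆_; _⊇_; _⊃_; _≐_; _∩_)

------------------------------------------------------------------------
-- Subsets of Fin n

subsets : ∀ n → List (Subset n)
subsets zero    = [] ∷ []
subsets (suc n) = List.map (outside ∷_) (subsets n) ++ List.map (inside ∷_) (subsets n)

KSubset : ℕ → ℕ → Set
KSubset n k = Σ[ S ∈ Subset n ] ∣ S ∣ ≡ k

kSubsets : ∀ n k → List (KSubset n k)
kSubsets zero    zero    = ([] , ≡.refl) ∷ []
kSubsets zero    (suc k) = []
kSubsets (suc n) zero    =
  List.map (λ (S , eq) → outside ∷ S , eq) (kSubsets n zero)
kSubsets (suc n) (suc k) =
  List.map (λ (S , eq) → inside ∷ S , ≡.cong suc eq) (kSubsets n k) ++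
  List.map (λ (S , eq) → outside ∷ S , eq) (kSubsets n (suc k))

complement : ∀ {n k} → KSubset n k → KSubset n (n ∸ k)
complement {n} (S , eq) = ∁ S , ≡.trans (∣∁p∣≡n∸∣p∣ S) (≡.cong (n ∸_) eq)

-- The elements of S in increasing order.
elements : ∀ {n} (S : Subset n) → Vector (Fin n) ∣ S ∣
elements (inside  ∷ S) zero    = zero
elements (inside  ∷ S) (suc i) = suc (elements S i)
elements (outside ∷ S) i       = suc (elements S i)

-- The sum of the elements of S, numbered from 1 to n.
elementSum : ∀ {n} → Subset n → ℕ
elementSum S = ListAction.sum (List.tabulate (suc ∘ toℕ ∘ elements S))

------------------------------------------------------------------------
-- Invariants of the matroid on Fin m whose independent sets are the
-- subsets satisfying Indep.  The matroid axioms play no role in the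
-- definitions of these invariants.

module Matroid {ℓ m} {Indep : Pred (Subset m) ℓ} (indep? : Decidable Indep) where

  independentCount : ℕ → ℕ
  independentCount i =
    length (filter (λ S → indep? S ×-dec (∣ S ∣ ℕ.≟ i)) (subsets m))

  rank : Subset m → ℕ
  rank S = max 0 (List.map ∣_∣ (filter (λ T → indep? T ×-dec (T ⊆? S)) (subsets m)))

  IsFlat : Subset m → Set
  IsFlat F = ∀ e → ¬ (e Subset.∈ F) → rank F ℕ.< rank (F Subset.∪ ⁅ e ⁆)

  isFlat? : Decidable IsFlat
  isFlat? F = all? λ e → Dec._→-dec_ (¬? (e ∈? F)) (rank F ℕ.<? rank (F Subset.∪ ⁅ e ⁆))

  flats : List (Subset m)
  flats = filter isFlat? (subsets m)

  closure : Subset m → Subset m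
  closure S = tabulate λ e → does (rank (S Subset.∪ ⁅ e ⁆) ℕ.≟ rank S)

  0̂ : Subset m
  0̂ = closure Subset.⊥

  sumℤ : List ℤ → ℤ
  sumℤ = List.foldr ℤ._+_ 0ℤ

  -- μ(F,F) = 1, and μ(F,G) = - ∑ μ(F,E) over the flats E with F ⊆ E ⊂ G.
  μ-acc : ∀ F G → Acc Subset._⊂_ G → ℤ
  μ-acc F G (acc rec) =
    if does (Vec.≡-dec Bool._≟_ F G) then 1ℤ else ℤ.- sumℤ (List.map term flats)
    where
    term : Subset m → ℤ
    term E with (F ⊆? E) ×-dec (E ⊂? G)
    ... | yes (_ , E⊂G) = μ-acc F E (rec E⊂G)
    ... | no  _         = 0ℤ

  μ : Subset m → Subset m → ℤ
  μ F G = μ-acc F G (⊂-wellFounded G)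

  -- With r the rank of the matroid, the exponent r - rank(F) of the term
  -- of F in the characteristic polynomial is r - i exactly if rank(F) = i.
  whitney : ℕ → ℤ
  whitney i = sumℤ (List.map (μ 0̂) (filter (λ F → rank F ℕ.≟ i) flats))

------------------------------------------------------------------------
-- The real numbers, axiomatised as a Dedekind-complete ordered field.
-- As in classical mathematics the order, hence equality, is decidable.

record CompleteOrderedField (a : Level) : Set (Level.suc a) where
  infix 4 _≤_
  field
    commutativeRing : CommutativeRing a a
  open CommutativeRing commutativeRing public
  field
    1≉0             : 1# ≉ 0#
    inverse         : ∀ x → x ≉ 0# → ∃ λ y → x * y ≈ 1#
    _≤_             : Rel Carrier a
    isDecTotalOrder : IsDecTotalOrder _≈_ _≤_
    +-monoˡ-≤       : ∀ {x y} z → x ≤ y → x + z ≤ y + z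
    *-nonneg        : ∀ {x y} → 0# ≤ x → 0# ≤ y → 0# ≤ x * y

  UpperBound : Pred Carrier a → Pred Carrier a
  UpperBound S b = ∀ {x} → x ∈ S → x ≤ b

  field
    supremum : ∀ (S : Pred Carrier a) → ∃ S → ∃ (UpperBound S) →
               ∃ λ s → s ∈ UpperBound S × (∀ {b} → b ∈ UpperBound S → s ≤ b)

  open IsDecTotalOrder isDecTotalOrder public using (_≟_; _≤?_)

module Arrangements {a} (ℝ : CompleteOrderedField a) where

  open CompleteOrderedField ℝ hiding (zero)
  open import Algebra.Properties.Ring ring
    using (-‿distribˡ-*; -‿distribʳ-*)
  open import Algebra.Properties.Semiring.Exp semiring using (_^_)
  open import Algebra.Properties.Semiring.Sum semiring
  open import Relation.Binary.Reasoning.Setoid setoid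
  open VecEq setoid using (_≋_)

  ----------------------------------------------------------------------
  -- Linear algebra in ℝⁿ

  infix 7 _·_

  _·_ : ∀ {n} → Vector Carrier n → Vector Carrier n → Carrier
  _·_ {n} u v = ∑[ j < n ] (u j * v j)

  0ᵛ : ∀ {n} → Vector Carrier n
  0ᵛ _ = 0#

  combination : ∀ {d n} → Vector Carrier d → Vector (Vector Carrier n) d → Vector Carrier n
  combination {d} c v j = ∑[ i < d ] (c i * v i j)

  LinearlyIndependent : ∀ {d n} → Vector (Vector Carrier n) d → Set a
  LinearlyIndependent v = ∀ c → combination c v ≋ 0ᵛ → c ≋ 0ᵛ

  -- A d-dimensional subspace of ℝⁿ, given as the row space of a d × n matrix.
  -- Matrices with the same row space represent the same subspace.
  record Subspace (d n : ℕ) : Set a where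
    field
      basis       : Vector (Vector Carrier n) d
      independent : LinearlyIndependent basis

  open Subspace public

  ⟦_⟧ : ∀ {d n} → Subspace d n → Pred (Vector Carrier n) a
  ⟦ U ⟧ x = ∃ λ c → x ≋ combination c (basis U)

  det : ∀ {d} → Vector (Vector Carrier d) d → Carrier
  det {zero}  M = 1#
  det {suc d} M =
    ∑[ j < suc d ] ((- 1#) ^ toℕ j * M zero j * det (λ r c → M (suc r) (punchIn j c)))

  Δ : ∀ {d n} → Subspace d n → KSubset n d → Carrier
  Δ U (I , eq) = det λ r c → basis U r (elements I (cast (≡.sym eq) c))

  kernel : ∀ {n} → Vector Carrier n → Pred (Vector Carrier n) a
  kernel v x = v · x ≈ 0#

  unit : ∀ {n} → Vector (Vector Carrier n) n
  unit zero    zero    = 1#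
  unit zero    (suc j) = 0#
  unit (suc i) zero    = 0#
  unit (suc i) (suc j) = unit i j

  0· : ∀ {n} {u : Vector Carrier n} x → u ≋ 0ᵛ → u · x ≈ 0#
  0· {n} x u≋0 = trans (sum-cong-≋ λ j → trans (*-congʳ (u≋0 j)) (zeroˡ _)) (sum-replicate-zero n)

  ·0 : ∀ {n} (u : Vector Carrier n) {x} → x ≋ 0ᵛ → u · x ≈ 0#
  ·0 {n} u x≋0 = trans (sum-cong-≋ λ j → trans (*-congˡ (x≋0 j)) (zeroʳ _)) (sum-replicate-zero n)

  ·-comm : ∀ {n} (u x : Vector Carrier n) → u · x ≈ x · u
  ·-comm u x = sum-cong-≋ λ j → *-comm (u j) (x j)

  ·-congʳ : ∀ {n} (u : Vector Carrier n) {x y} → x ≋ y → u · x ≈ u · y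
  ·-congʳ u x≋y = sum-cong-≋ λ j → *-congˡ (x≋y j)

  ·-unit : ∀ {n} (c : Vector Carrier n) j → combination c unit j ≈ c j
  ·-unit c zero    = trans (+-cong (*-identityʳ _) (·0 (c ∘ suc) λ _ → refl)) (+-identityʳ _)
  ·-unit c (suc j) = trans (+-cong (zeroʳ _) (·-unit (c ∘ suc) j)) (+-identityˡ _)

  ·-linearˡ : ∀ {n} p q (u v x : Vector Carrier n) →
              (λ j → p * u j + q * v j) · x ≈ p * (u · x) + q * (v · x)
  ·-linearˡ {n} p q u v x = begin
    (λ j → p * u j + q * v j) · x
      ≈⟨ sum-cong-≋ {n} (λ j → trans (distribʳ (x j) (p * u j) (q * v j))
                                 (+-cong (*-assoc p (u j) (x j)) (*-assoc q (v j) (x j)))) ⟩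
    sum (λ j → p * (u j * x j) + q * (v j * x j))
      ≈⟨ ∑-distrib-+ (λ j → p * (u j * x j)) (λ j → q * (v j * x j)) ⟩
    sum (λ j → p * (u j * x j)) + sum (λ j → q * (v j * x j))
      ≈⟨ +-cong (*-distribˡ-sum p (λ j → u j * x j)) (*-distribˡ-sum q (λ j → v j * x j)) ⟨
    p * (u · x) + q * (v · x) ∎

  ·-scaleʳ : ∀ {n} p (u x : Vector Carrier n) → u · (λ j → p * x j) ≈ p * (u · x)
  ·-scaleʳ {n} p u x = begin
    u · (λ j → p * x j)
      ≈⟨ sum-cong-≋ {n} (λ j → trans (sym (*-assoc (u j) p (x j)))
                                 (trans (*-congʳ (*-comm (u j) p)) (*-assoc p (u j) (x j)))) ⟩
    sum (λ j → p * (u j * x j))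
      ≈⟨ *-distribˡ-sum p (λ j → u j * x j) ⟨
    p * (u · x) ∎

  ·-combination : ∀ {d n} (u : Vector Carrier n) c (v : Vector (Vector Carrier n) d) →
                  u · combination c v ≈ (λ i → u · v i) · c
  ·-combination u c v = begin
    u · combination c v
      ≈⟨ (sum-cong-≋ λ j → *-distribˡ-sum (u j) (λ i → c i * v i j)) ⟩
    sum (λ j → sum (λ i → u j * (c i * v i j)))
      ≈⟨ ∑-comm (λ j i → u j * (c i * v i j)) ⟩
    sum (λ i → sum (λ j → u j * (c i * v i j)))
      ≈⟨ (sum-cong-≋ λ i → trans (·-scaleʳ (c i) u (v i)) (*-comm _ _)) ⟩
    (λ i → u · v i) · c ∎

  cancel : ∀ {p x} → p ≉ 0# → p * x ≈ 0# → x ≈ 0#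
  cancel {p} {x} p≉0 px≈0 with inverse p p≉0
  ... | q , pq≈1 = begin
    x           ≈⟨ *-identityˡ x ⟨
    1# * x      ≈⟨ *-congʳ (trans (*-comm q p) pq≈1) ⟨
    q * p * x   ≈⟨ *-assoc q p x ⟩
    q * (p * x) ≈⟨ *-congˡ px≈0 ⟩
    q * 0#      ≈⟨ zeroʳ q ⟩
    0#          ∎

  -- Elimination of the first variable by means of the row r.
  eliminate : ∀ {n} → Vector Carrier (suc n) → Vector Carrier (suc n) → Vector Carrier n
  eliminate r u j = r zero * u (suc j) + - u zero * r (suc j)

  eliminate-restrict : ∀ {n} (r u x : Vector Carrier (suc n)) →
    eliminate r u · (x ∘ suc) ≈ r zero * (u · x) + - u zero * (r · x)
  eliminate-restrict r u x = begin
    eliminate r u · xₜ                    ≈⟨ ·-linearˡ r₀ (- u₀) uₜ rₜ xₜ ⟩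
    A + B                                 ≈⟨ +-congˡ (+-identityˡ B) ⟨
    A + (0# + B)                          ≈⟨ +-congˡ (+-congʳ (-‿inverseʳ D)) ⟨
    A + (D + - D + B)                     ≈⟨ +-congˡ (+-assoc _ _ _) ⟩
    A + (D + (- D + B))                   ≈⟨ +-assoc _ _ _ ⟨
    A + D + (- D + B)                     ≈⟨ +-cong (+-comm A D) (+-congʳ -D) ⟩
    D + A + (- u₀ * (r₀ * x₀) + B)        ≈⟨ +-cong (distribˡ _ _ _) (distribˡ _ _ _) ⟨
    r₀ * (u · x) + - u₀ * (r · x)         ∎
    where
    r₀ = r zero
    u₀ = u zero
    x₀ = x zero
    rₜ = r ∘ suc
    uₜ = u ∘ suc
    xₜ = x ∘ suc
    A = r₀ * (uₜ · xₜ)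
    B = - u₀ * (rₜ · xₜ)
    D = r₀ * (u₀ * x₀)
    -D : - D ≈ - u₀ * (r₀ * x₀)
    -D = begin
      - (r₀ * (u₀ * x₀))  ≈⟨ -‿cong (trans (sym (*-assoc _ _ _))
                               (trans (*-congʳ (*-comm _ _)) (*-assoc _ _ _))) ⟩
      - (u₀ * (r₀ * x₀))  ≈⟨ -‿distribˡ-* _ _ ⟩
      - u₀ * (r₀ * x₀)    ∎

  extend : ∀ {n} → Vector Carrier (suc n) → Vector Carrier n → Vector Carrier (suc n)
  extend r y = - ((r ∘ suc) · y) Vector.∷ (λ j → r zero * y j)

  eliminate-extend : ∀ {n} (r u : Vector Carrier (suc n)) y →
                     u · extend r y ≈ eliminate r u · y
  eliminate-extend r u y = begin
    u zero * - (rₜ · y) + uₜ · (λ j → r zero * y j)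
      ≈⟨ +-cong (trans (sym (-‿distribʳ-* _ _)) (-‿distribˡ-* _ _)) (·-scaleʳ _ uₜ y) ⟩
    - u zero * (rₜ · y) + r zero * (uₜ · y)
      ≈⟨ +-comm _ _ ⟩
    r zero * (uₜ · y) + - u zero * (rₜ · y)
      ≈⟨ ·-linearˡ _ _ uₜ rₜ y ⟨
    eliminate r u · y ∎
    where
    rₜ = r ∘ suc
    uₜ = u ∘ suc

  kernels⊆kernel? : ∀ {r n} (M : Vector (Vector Carrier n) r) v →
                    Dec (∀ x → (∀ i → x ∈ kernel (M i)) → x ∈ kernel v)
  kernels⊆kernel? {n = zero}  M v = yes λ _ _ → refl
  kernels⊆kernel? {n = suc n} M v with any? (λ i → ¬? (M i zero ≟ 0#))
  ... | yes (i , p≉0) =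
    Dec.map′
      (λ imp x Mx≈0 → cancel p≉0 (begin
        M i zero * (v · x)
          ≈⟨ +-identityʳ _ ⟨
        M i zero * (v · x) + 0#
          ≈⟨ +-congˡ (trans (*-congˡ (Mx≈0 i)) (zeroʳ _)) ⟨
        M i zero * (v · x) + - v zero * (M i · x)
          ≈⟨ eliminate-restrict (M i) v x ⟨
        eliminate (M i) v · (x ∘ suc)
          ≈⟨ imp (x ∘ suc) (λ j → trans (eliminate-restrict (M i) (M j) x)
               (trans (+-cong (trans (*-congˡ (Mx≈0 j)) (zeroʳ _))
                              (trans (*-congˡ (Mx≈0 i)) (zeroʳ _)))
                      (+-identityʳ _))) ⟩
        0# ∎))
      (λ imp y My≈0 → trans (sym (eliminate-extend (M i) v y))
        (imp (extend (M i) y) (λ j → trans (eliminate-extend (M i) (M j) y) (My≈0 j))))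
      (kernels⊆kernel? (λ j → eliminate (M i) (M j)) (eliminate (M i) v))
  ... | no none =
    Dec.map′
      (λ (v₀≈0 , imp) x Mx≈0 →
        trans (drop v v₀≈0 x)
          (imp (x ∘ suc) (λ j → trans (sym (drop (M j) (M₀≈0 j) x)) (Mx≈0 j))))
      (λ imp →
        trans (sym (first v))
              (imp (1# Vector.∷ 0ᵛ) (λ j → trans (first (M j)) (M₀≈0 j))) ,
        λ y My≈0 → trans (sym (rest v y))
              (imp (0# Vector.∷ y) (λ j → trans (rest (M j) y) (My≈0 j))))
      ((v zero ≟ 0#) ×-dec kernels⊆kernel? (λ j → M j ∘ suc) (v ∘ suc))
    where
    M₀≈0 : ∀ j → M j zero ≈ 0#
    M₀≈0 j = Dec.decidable-stable (M j zero ≟ 0#) λ ≉0 → none (j , ≉0)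
    drop : ∀ (u : Vector Carrier (suc n)) → u zero ≈ 0# → ∀ x → u · x ≈ (u ∘ suc) · (x ∘ suc)
    drop u u₀≈0 x = trans (+-congʳ (trans (*-congʳ u₀≈0) (zeroˡ _))) (+-identityˡ _)
    first : ∀ (u : Vector Carrier (suc n)) → u · (1# Vector.∷ 0ᵛ) ≈ u zero
    first u = trans (+-cong (*-identityʳ _) (·0 (u ∘ suc) λ _ → refl)) (+-identityʳ _)
    rest : ∀ (u : Vector Carrier (suc n)) y → u · (0# Vector.∷ y) ≈ (u ∘ suc) · y
    rest u y = trans (+-congʳ (zeroʳ _)) (+-identityˡ _)

  full : ∀ n → Subspace n n
  full n .basis           = unit
  full n .independent c 0≋ j = trans (sym (·-unit c j)) (0≋ j)

  ----------------------------------------------------------------------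
  -- The set of intersections of finitely many members of a family of
  -- subsets of a space W, ordered by reverse inclusion.  The family may
  -- list the same subset several times.

  module _ {ι w} {I : Set ι} {W : Set w} (H : I → Pred W a) where

    L : Pred (Pred W a) (ι ⊔ w ⊔ a)
    L X = Σ[ B ∈ List I ] X ≐ λ x → All (λ i → x ∈ H i) B

    stratum : Pred W a → Pred W (ι ⊔ w ⊔ Level.suc a)
    stratum X x = x ∈ X × (∀ Y → Y ∈ L → X ⊃ Y → x ∉ Y)

  infix 4 _≤ᴸ_

  _≤ᴸ_ : ∀ {w} {W : Set w} → Rel (Pred W a) (w ⊔ a)
  X ≤ᴸ Y = X ⊇ Y

  ----------------------------------------------------------------------
  -- Arrangements

  -- A finite set of hyperplanes of the subspace U of ℝⁿ, where the i-th
  -- hyperplane is { x ∈ U | normal i · x = 0 }.  For proper U the vector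
  -- normal i need not lie in U: it stands for the linear form that it
  -- induces on U, i.e. for its orthogonal projection to U.
  record Arrangement {d n} (U : Subspace d n) : Set a where
    field
      size     : ℕ
      normal   : Vector (Vector Carrier n) size
      nonzero  : ∀ i → ¬ (⟦ U ⟧ ⊆ kernel (normal i))
      distinct : ∀ {i j} → (⟦ U ⟧ ∩ kernel (normal i)) ≐ (⟦ U ⟧ ∩ kernel (normal j)) → i ≡ j

    hyperplane : Fin size → Pred (Vector Carrier n) a
    hyperplane i = ⟦ U ⟧ ∩ kernel (normal i)

  open Arrangement public

  Essential : ∀ {n} → Arrangement (full n) → Set a
  Essential 𝒜 = ∀ x → (∀ i → x ∈ hyperplane 𝒜 i) → x ≋ 0ᵛ

  -- Decision procedures for conditions on the restrictions of linear forms
  -- to a subspace.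
  module _ {d n} (U : Subspace d n) where

    coordinates : Vector Carrier n → Vector Carrier d
    coordinates v i = v · basis U i

    evaluate : ∀ v {x} c → x ≋ combination c (basis U) → v · x ≈ coordinates v · c
    evaluate v c x≋ = trans (·-congʳ v x≋) (·-combination v c (basis U))

    point : ∀ c → combination c (basis U) ∈ ⟦ U ⟧
    point c = c , λ _ → refl

    inclusion? : ∀ v w → Dec (⟦ U ⟧ ∩ kernel v ⊆ ⟦ U ⟧ ∩ kernel w)
    inclusion? v w =
      Dec.map′
        (λ imp ((c , x≋) , vx≈0) → (c , x≋) ,
          trans (evaluate w c x≋) (imp c λ _ → trans (sym (evaluate v c x≋)) vx≈0))
        (λ inc c vc≈0 → trans (sym (evaluate w c λ _ → refl))
          (proj₂ (inc (point c , trans (evaluate v c λ _ → refl) (vc≈0 zero)))))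
        (kernels⊆kernel? {1} (λ _ → coordinates v) (coordinates w))

    contained? : ∀ v → Dec (⟦ U ⟧ ⊆ kernel v)
    contained? v =
      Dec.map′
        (λ imp (c , x≋) → trans (evaluate v c x≋) (imp c λ ()))
        (λ inc c _ → trans (sym (evaluate v c λ _ → refl)) (inc (point c)))
        (kernels⊆kernel? {0} (λ ()) (coordinates v))

    sameHyperplane : ∀ {m} → Vector (Vector Carrier n) m → DecSetoid Level.zero a
    sameHyperplane {m} v = record
      { Carrier = Fin m
      ; _≈_     = λ i j → (⟦ U ⟧ ∩ kernel (v i)) ≐ (⟦ U ⟧ ∩ kernel (v j))
      ; isDecEquivalence = record
        { isEquivalence = record
          { refl  = (λ p → p) , (λ p → p)
          ; sym   = λ (f , g) → g , f
          ; trans = λ (f , g) (f′ , g′) → f′ ∘ f , g ∘ g′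
          }
        ; _≟_ = λ i j → inclusion? (v i) (v j) ×-dec inclusion? (v j) (v i)
        }
      }

    -- Linear independence of the forms induced on U by the vectors v.
    IndependentOn : ∀ {p} → Vector (Vector Carrier n) p → Set a
    IndependentOn v = ∀ c → ⟦ U ⟧ ⊆ kernel (combination c v) → c ≋ 0ᵛ

    independentOn? : ∀ {p} (v : Vector (Vector Carrier n) p) → Dec (IndependentOn v)
    independentOn? {p} v =
      Dec.map′
        (λ imp c inc j → trans (sym (unit· j c))
          (imp j c λ i → trans (sym (value c i)) (inc (inBasis i))))
        (λ ind j c rows → trans (unit· j c) (ind c
          (λ {x} (e , x≋) → trans (evaluate (combination c v) e x≋)
            (0· e λ i → trans (value c i) (rows i))) j))
        (all? λ j → kernels⊆kernel? (λ i k → v k · basis U i) (unit j))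
      where
      unit· : ∀ {q} (j : Fin q) c → unit j · c ≈ c j
      unit· zero    c = trans (+-cong (*-identityˡ _) (0· (c ∘ suc) λ _ → refl)) (+-identityʳ _)
      unit· (suc j) c = trans (+-cong (zeroˡ _) (unit· j (c ∘ suc))) (+-identityˡ _)

      inBasis : ∀ i → basis U i ∈ ⟦ U ⟧
      inBasis i = unit i , λ k → sym (unit· i (λ i → basis U i k))

      value : ∀ c i → combination c v · basis U i ≈ (λ k → v k · basis U i) · c
      value c i = trans (·-comm _ (basis U i)) (trans (·-combination (basis U i) c v)
        (sum-cong-≋ λ k → *-congʳ (·-comm (basis U i) (v k))))

  module _ {d n} {U : Subspace d n} (ℬ : Arrangement U) where

    independent? : Decidable (λ S → IndependentOn U (normal ℬ ∘ elements S))
    independent? S = independentOn? U (normal ℬ ∘ elements S)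

    I : ℕ → ℕ
    I = Matroid.independentCount independent?

    w : ℕ → ℤ
    w = Matroid.whitney independent?

  AllPairs-lookup : ∀ {A : Set} {R : Rel A a} → (∀ {x y} → R x y → R y x) →
                    ∀ {xs} → AllPairs R xs → ∀ i j → i ≢ j → R (lookup xs i) (lookup xs j)
  AllPairs-lookup s (_  ∷ _)   zero    zero    i≢j = contradiction ≡.refl i≢j
  AllPairs-lookup s (px ∷ _)   zero    (suc j) _   = All.lookup px (∈-lookup j)
  AllPairs-lookup s (px ∷ _)   (suc i) zero    _   = s (All.lookup px (∈-lookup i))
  AllPairs-lookup s (_  ∷ pxs) (suc i) (suc j) i≢j = AllPairs-lookup s pxs i j (i≢j ∘ ≡.cong suc)

  module Restriction {k n} (𝒜 : Arrangement (full n)) (U : Subspace k n) where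

    same : DecSetoid Level.zero a
    same = sameHyperplane U (normal 𝒜)

    open DecSetoid same using () renaming (_≟_ to _same?_; sym to same-sym)

    NotContaining : Pred (Fin (size 𝒜)) a
    NotContaining i = ¬ (⟦ U ⟧ ⊆ kernel (normal 𝒜 i))

    notContaining? : Decidable NotContaining
    notContaining? i = ¬? (contained? U (normal 𝒜 i))

    notContaining : List (Fin (size 𝒜))
    notContaining = filter notContaining? (allFin (size 𝒜))

    -- One index for each set of the form H ∩ U.
    indices : List (Fin (size 𝒜))
    indices = deduplicate _same?_ notContaining

    restriction : Arrangement U
    restriction = record
      { size     = length indices
      ; normal   = normal 𝒜 ∘ lookup indices
      ; nonzero  = λ i → All.lookup proper (∈-lookup i)
      ; distinct = λ {i} {j} i~j → Dec.decidable-stable (i Fin.≟ j)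
          λ i≢j → AllPairs-lookup (_∘ same-sym) (deduplicate-! same notContaining) i j i≢j i~j
      }
      where
      proper : All NotContaining indices
      proper = All.deduplicate⁺ _same?_ (All.all-filter notContaining? (allFin (size 𝒜)))

  infix 8 _∣_

  _∣_ : ∀ {k n} → Arrangement (full n) → (U : Subspace k n) → Arrangement U
  𝒜 ∣ U = Restriction.restriction 𝒜 U

  ----------------------------------------------------------------------
  -- The k-adjoint

  module _ {n} (𝒜 : Arrangement (full n)) (k : ℕ) where

    -- For k ≤ n, rank k means dimension n ∸ k.  An intersection X occurs here
    -- once for each basis of X, but another basis multiplies Δ X by a nonzero
    -- factor and so gives the same hyperplane in the k-adjoint.
    L[rank-k] : Set a
    L[rank-k] = Σ[ X ∈ Subspace (n ∸ k) n ] ⟦ X ⟧ ∈ L (hyperplane 𝒜)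

    coefficient : L[rank-k] → KSubset n k → Carrier
    coefficient (X , _) (S , eq) =
      (- 1#) ^ (k ℕ.* suc k / 2 ℕ.+ elementSum S) * Δ X (complement (S , eq))

    adjoint : L[rank-k] → Pred (KSubset n k → Carrier) a
    adjoint X x = sum (λ j → coefficient X (J j) * x (J j)) ≈ 0#
      where J = Vector.fromList (kSubsets n k)

    𝒮 : Pred (KSubset n k → Carrier) a → Pred (Subspace k n) (Level.suc a)
    𝒮 P U = Δ U ∈ stratum adjoint P

module Submission where

-- By Laplace expansion, the form of H(X) evaluated at Δ(U) is ± the determinant of a basis of U
-- followed by a basis of X, so Δ(U) ∈ H(X) exactly if U ∩ X ≠ 0; the determinant is treated as a
-- top-degree product in the exterior algebra of ℝⁿ.  Hence P₁ ≤ P₂ gives: U₂ ∩ X = 0 implies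
-- U₁ ∩ X = 0 for every X of rank k.  A family of k hyperplanes of 𝒜 with intersection X is
-- independent on U exactly if U ∩ X = 0, and since 𝒜 is essential every independent family on U₂
-- extends to one with k members; so families independent on U₂ are independent on U₁.  Choosing
-- for each hyperplane of 𝒜 ∣ U₂ the hyperplane of 𝒜 ∣ U₁ with the same origin in 𝒜 gives an
-- injection φ that preserves independent sets, which proves (1).
--
-- For (2), Whitney's theorem identifies |wᵢ| with the number of i-subsets without broken circuits.
-- A set S contains no broken circuit exactly if { e } ∪ { f ∈ S | f > e } is independent for every
-- e, a condition that φ preserves as soon as the image of φ comes first in the order.

open import Defs
import Algebra.Solver.Ring.NaturalCoefficients.Default as SemiringSolver
import Data.Bool.Properties as Bool
open import Data.Bool.Base using (if_then_else_; not)
open import Data.Empty using (⊥-elim)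
open import Data.Fin.Base using (Fin; zero; suc; toℕ; punchIn; punchOut; splitAt; _↑ˡ_; _↑ʳ_; cast)
open import Data.Fin.Properties as Fin using (any?; all?)
open import Data.Fin.Subset as Subset using (Subset; inside; outside; ∁; ∣_∣; ⁅_⁆; _∪_)
open import Data.Fin.Subset.Induction using (⊂-wellFounded)
open import Data.Fin.Subset.Properties
open import Data.Integer.Base as ℤ using (ℤ; 0ℤ; 1ℤ; +_) renaming (∣_∣ to abs)
import Data.Integer.Properties as ℤ
open import Data.List.Base as List using (List; []; _∷_; filter; length)
import Data.List.Extrema.Nat as Extrema
import Data.List.Membership.Propositional as List
open import Data.List.Membership.Propositional.Properties
  using (∈-lookup; ∈-allFin; ∈-map⁺; ∈-map⁻; ∈-++⁺ˡ; ∈-++⁺ʳ; ∈-filter⁺; ∈-filter⁻)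
import Data.List.Relation.Unary.All as All
import Data.List.Relation.Unary.All.Properties as All
open import Data.List.Relation.Unary.Any as Any using (Any; here; there)
import Data.List.Relation.Unary.Any.Properties as Any
open import Data.List.Relation.Unary.Unique.Propositional using (Unique; []; _∷_)
import Data.List.Relation.Unary.Unique.Propositional.Properties as Unique
open import Data.Nat.Base as ℕ using (ℕ; zero; suc; z≤n; s≤s; _∸_; _<_; _≤_; _≥_)
open import Data.Nat.Divisibility using (divides)
open import Data.Nat.DivMod using (_/_; +-distrib-/-∣ʳ; m*n/n≡m)
open import Data.Nat.Induction using (<-wellFounded)
import Data.Nat.ListAction as ListAction
import Data.Nat.Properties as ℕ
import Data.Nat.Solver as ℕSolver
open import Data.Product.Base using (Σ-syntax; ∃; _×_; _,_; proj₁; proj₂)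
open import Data.Sum.Base using (_⊎_; inj₁; inj₂; [_,_]; [_,_]′)
open import Data.Vec.Base as Vec using ([]; _∷_; tabulate; updateAt)
open import Data.Vec.Functional as Vector using (Vector)
import Data.Vec.Functional.Relation.Binary.Equality.Setoid as VecEq
import Data.Vec.Properties as Vec
open import Function.Base using (_∘_; id; const)
open import Function.Definitions using (Injective)
open import Induction.WellFounded using (Acc; acc)
open import Relation.Binary.PropositionalEquality as ≡ using (_≡_; _≢_)
open import Relation.Nullary using (¬_; Dec; yes; no; does; ¬?; contradiction)
import Relation.Nullary.Decidable as Dec
open import Relation.Nullary.Decidable using (_×-dec_; _⊎-dec_)

-- The adjoint sees only intersections of rank k, so what passes directly from U₂ to U₁ is the
-- independence of families of exactly k hyperplanes. Smaller families have to be enlarged first and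
-- cut down afterwards. Moreover the two restrictions have different ground sets: hyperplanes that
-- contain U₂ or coincide on U₂ may be proper or distinct on U₁. So the matroids are compared along
-- an injection that preserves independence, while dependent sets may become independent. Such a map
-- need not carry flats to flats, but it transports a count of sets that are defined by independence
-- alone; hence the detour of (2) through broken circuits. Since |wᵢ| does not depend on the order,
-- each side may use an order of its own. Determinants are never multiplied out: the minors in `Δ`
-- are the coefficients of a product of vectors, and products are handled by recursion on the first
-- basis vector. There the sign in `coefficient` arises from moving basis vectors past each other.

module Combinatorics where

  open import Data.Fin.Subset using (_⊆_; _⊂_)
  open import Data.List.Membership.Propositional using (_∈_)
  open import Relation.Unary using (Pred; Decidable)

  -- Subsets of a finite set.

  subsets-complete : ∀ {m} (S : Subset m) → S ∈ subsets m
  subsets-complete []            = here ≡.refl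
  subsets-complete (outside ∷ S) = ∈-++⁺ˡ (∈-map⁺ (outside ∷_) (subsets-complete S))
  subsets-complete {suc m} (inside ∷ S) =
    ∈-++⁺ʳ (List.map (outside ∷_) (subsets m)) (∈-map⁺ (inside ∷_) (subsets-complete S))

  subsets-unique : ∀ m → Unique (subsets m)
  subsets-unique zero    = All.[] ∷ []
  subsets-unique (suc m) = Unique.++⁺
    (Unique.map⁺ Vec.∷-injectiveʳ (subsets-unique m))
    (Unique.map⁺ Vec.∷-injectiveʳ (subsets-unique m))
    λ (p , q) → case (∈-map⁻ (outside ∷_) p) (∈-map⁻ (inside ∷_) q)
    where
    case : ∀ {S : Subset (suc m)} → ∃ (λ T → T ∈ subsets m × S ≡ outside ∷ T) →
           ¬ ∃ (λ T → T ∈ subsets m × S ≡ inside ∷ T)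
    case (_ , _ , ≡.refl) (_ , _ , ())

  comprehension : ∀ {m p} {P : Pred (Fin m) p} → Decidable P → Subset m
  comprehension P? = tabulate λ e → does (P? e)

  ∈-comprehension⁺ : ∀ {m p} {P : Pred (Fin m) p} (P? : Decidable P) {e} → P e → e Subset.∈ comprehension P?
  ∈-comprehension⁺ P? {e} pe = Vec.lookup⇒[]= e _
    (≡.trans (Vec.lookup∘tabulate _ e) (Dec.dec-true (P? e) pe))

  ∈-comprehension⁻ : ∀ {m p} {P : Pred (Fin m) p} (P? : Decidable P) {e} → e Subset.∈ comprehension P? → P e
  ∈-comprehension⁻ P? {e} e∈ with P? e | ≡.trans (≡.sym (Vec.lookup∘tabulate (λ e → does (P? e)) e)) (Vec.[]=⇒lookup e∈)
  ... | yes pe | _  = pe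
  ... | no _   | ()

  module _ {m : ℕ} where

    ⊆∪ˡ : ∀ {S : Subset m} T → S ⊆ S ∪ T
    ⊆∪ˡ T = p⊆p∪q T

    ∪-least : ∀ {S T U : Subset m} → S ⊆ U → T ⊆ U → S ∪ T ⊆ U
    ∪-least {S} {T} S⊆U T⊆U x∈ = [ S⊆U , T⊆U ] (x∈p∪q⁻ S T x∈)

    ⁅⁆⊆ : ∀ {S : Subset m} {e} → e Subset.∈ S → ⁅ e ⁆ ⊆ S
    ⁅⁆⊆ {S} {e} e∈S x∈ = ≡.subst (Subset._∈ S) (≡.sym (x∈⁅y⁆⇒x≡y e x∈)) e∈S

    ∈-∪⁅⁆ : ∀ (S : Subset m) e → e Subset.∈ S ∪ ⁅ e ⁆
    ∈-∪⁅⁆ S e = q⊆p∪q S ⁅ e ⁆ (x∈⁅x⁆ e)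

    ∪⁅⁆-mono : ∀ {S T : Subset m} e → S ⊆ T → S ∪ ⁅ e ⁆ ⊆ T ∪ ⁅ e ⁆
    ∪⁅⁆-mono {S} {T} e S⊆T = ∪-least (λ x∈ → p⊆p∪q ⁅ e ⁆ (S⊆T x∈)) (q⊆p∪q T ⁅ e ⁆)

  toggle : ∀ {m} → Fin m → Subset m → Subset m
  toggle e S = updateAt S e not

  toggle-∉ : ∀ {m} {e : Fin m} {S} → ¬ e Subset.∈ S → toggle e S ≡ S ∪ ⁅ e ⁆
  toggle-∉ {e = zero}  {outside ∷ S} e∉S = ≡.cong (inside ∷_) (≡.sym (∪-identityʳ S))
  toggle-∉ {e = zero}  {inside  ∷ S} e∉S = contradiction Vec.here e∉S
  toggle-∉ {e = suc e} {s ∷ S} e∉S = ≡.cong₂ _∷_ (≡.sym (Bool.∨-identityʳ s)) (toggle-∉ (e∉S ∘ Vec.there))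

  toggle-involutive : ∀ {m} (e : Fin m) S → toggle e (toggle e S) ≡ S
  toggle-involutive zero    (s ∷ S) = ≡.cong (_∷ S) (Bool.not-involutive s)
  toggle-involutive (suc e) (s ∷ S) = ≡.cong (s ∷_) (toggle-involutive e S)

  ∣toggle∣ : ∀ {m} {e : Fin m} {S} → ¬ e Subset.∈ S → ∣ toggle e S ∣ ≡ suc ∣ S ∣
  ∣toggle∣ {e = zero}  {outside ∷ S} e∉S = ≡.refl
  ∣toggle∣ {e = zero}  {inside  ∷ S} e∉S = contradiction Vec.here e∉S
  ∣toggle∣ {e = suc e} {outside ∷ S} e∉S = ∣toggle∣ (e∉S ∘ Vec.there)
  ∣toggle∣ {e = suc e} {inside  ∷ S} e∉S = ≡.cong suc (∣toggle∣ (e∉S ∘ Vec.there))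

  ∈-toggle : ∀ {m} {e : Fin m} {S} → e Subset.∈ S → ¬ e Subset.∈ toggle e S
  ∈-toggle {e = zero}  {inside ∷ S} _ ()
  ∈-toggle {e = suc e} {s ∷ S} (Vec.there e∈S) (Vec.there e∈) = ∈-toggle e∈S e∈

  ∣∪⁅⁆∣ : ∀ {m} {S : Subset m} {e} → ¬ e Subset.∈ S → ∣ S ∪ ⁅ e ⁆ ∣ ≡ suc ∣ S ∣
  ∣∪⁅⁆∣ {S = S} {e} e∉S = ≡.trans (≡.cong ∣_∣ (≡.sym (toggle-∉ e∉S))) (∣toggle∣ e∉S)

  minimizer : ∀ {m} (ρ : Fin m → ℕ) (S : Subset m) {e} → e Subset.∈ S →
              ∃ λ e → e Subset.∈ S × (∀ {f} → f Subset.∈ S → ρ e ℕ.≤ ρ f)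
  minimizer {m} ρ S {e} e∈S = go e e∈S (<-wellFounded (ρ e))
    where
    go : ∀ e → e Subset.∈ S → Acc ℕ._<_ (ρ e) → ∃ λ e → e Subset.∈ S × (∀ {f} → f Subset.∈ S → ρ e ℕ.≤ ρ f)
    go e e∈S (acc rec) with any? (λ f → (f ∈? S) ×-dec (ρ f ℕ.<? ρ e))
    ... | yes (f , f∈S , f<e) = go f f∈S (rec f<e)
    ... | no  none            = e , e∈S , λ {f} f∈S → ℕ.≮⇒≥ λ f<e → none (f , f∈S , f<e)

  -- Iverson brackets and sums over lists.

  infixr 8 ⟨_⟩_
  ⟨_⟩_ : ∀ {p} {P : Set p} → Dec P → ℤ → ℤ
  ⟨ yes _ ⟩ x = x
  ⟨ no _  ⟩ x = 0ℤ

  bracket-true : ∀ {p} {P : Set p} (P? : Dec P) {x} → P → ⟨ P? ⟩ x ≡ x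
  bracket-true (yes _) p = ≡.refl
  bracket-true (no ¬p) p = contradiction p ¬p

  bracket-false : ∀ {p} {P : Set p} (P? : Dec P) {x} → ¬ P → ⟨ P? ⟩ x ≡ 0ℤ
  bracket-false (yes p) ¬p = contradiction p ¬p
  bracket-false (no _)  ¬p = ≡.refl

  bracket-× : ∀ {p q} {P : Set p} {Q : Set q} (P? : Dec P) (Q? : Dec Q) x → ⟨ P? ×-dec Q? ⟩ x ≡ ⟨ P? ⟩ ⟨ Q? ⟩ x
  bracket-× (yes _) (yes _) x = ≡.refl
  bracket-× (yes _) (no _)  x = ≡.refl
  bracket-× (no _)  Q?      x = ≡.refl

  ∑ : ∀ {b} {A : Set b} → List A → (A → ℤ) → ℤ
  ∑ xs f = List.foldr ℤ._+_ 0ℤ (List.map f xs)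

  infixr 7 ∑
  syntax ∑ xs (λ x → e) = ∑[ x ∈ xs ] e

  module _ {b} {A : Set b} where

    ∑-cong-∈ : ∀ (xs : List A) {f g : A → ℤ} → (∀ {x} → x ∈ xs → f x ≡ g x) → ∑ xs f ≡ ∑ xs g
    ∑-cong-∈ []       f≡g = ≡.refl
    ∑-cong-∈ (x ∷ xs) f≡g = ≡.cong₂ ℤ._+_ (f≡g (here ≡.refl)) (∑-cong-∈ xs (f≡g ∘ there))

    ∑-cong : ∀ (xs : List A) {f g : A → ℤ} → (∀ x → f x ≡ g x) → ∑ xs f ≡ ∑ xs g
    ∑-cong xs f≡g = ∑-cong-∈ xs λ {x} _ → f≡g x

    ∑-0 : ∀ (xs : List A) {f : A → ℤ} → (∀ x → f x ≡ 0ℤ) → ∑ xs f ≡ 0ℤ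
    ∑-0 []       f≡0 = ≡.refl
    ∑-0 (x ∷ xs) f≡0 = ≡.cong₂ ℤ._+_ (f≡0 x) (∑-0 xs f≡0)

    ∑-+ : ∀ (xs : List A) (f g : A → ℤ) → ∑[ x ∈ xs ] (f x ℤ.+ g x) ≡ ∑ xs f ℤ.+ ∑ xs g
    ∑-+ []       f g = ≡.refl
    ∑-+ (x ∷ xs) f g = ≡.trans (≡.cong (ℤ._+_ (f x ℤ.+ g x)) (∑-+ xs f g)) (interchange (f x) (g x) (∑ xs f) (∑ xs g))
      where open import Algebra.Properties.CommutativeSemigroup ℤ.+-commutativeSemigroup using (interchange)

    ∑-neg : ∀ (xs : List A) (f : A → ℤ) → ∑[ x ∈ xs ] (ℤ.- f x) ≡ ℤ.- ∑ xs f
    ∑-neg []       f = ≡.refl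
    ∑-neg (x ∷ xs) f = ≡.trans (≡.cong (ℤ._+_ (ℤ.- f x)) (∑-neg xs f)) (≡.sym (ℤ.neg-distrib-+ (f x) (∑ xs f)))

    ∑-bracket : ∀ {p} {P : Set p} (P? : Dec P) (xs : List A) (f : A → ℤ) → ∑[ x ∈ xs ] (⟨ P? ⟩ f x) ≡ ⟨ P? ⟩ ∑ xs f
    ∑-bracket (yes _) xs f = ≡.refl
    ∑-bracket (no _)  xs f = ∑-0 xs λ _ → ≡.refl

    ∑-++ : ∀ (xs ys : List A) (f : A → ℤ) → ∑ (xs List.++ ys) f ≡ ∑ xs f ℤ.+ ∑ ys f
    ∑-++ []       ys f = ≡.sym (ℤ.+-identityˡ _)
    ∑-++ (x ∷ xs) ys f = ≡.trans (≡.cong (ℤ._+_ (f x)) (∑-++ xs ys f)) (≡.sym (ℤ.+-assoc (f x) _ _))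

    ∑-swap : ∀ {c} {B : Set c} (xs : List A) (ys : List B) (f : A → B → ℤ) →
             ∑[ x ∈ xs ] ∑[ y ∈ ys ] f x y ≡ ∑[ y ∈ ys ] ∑[ x ∈ xs ] f x y
    ∑-swap {B = B} []       ys f = ≡.sym (zeros ys)
      where
      zeros : ∀ ys → ∑ ys (λ (_ : B) → 0ℤ) ≡ 0ℤ
      zeros []       = ≡.refl
      zeros (y ∷ ys) = ≡.trans (ℤ.+-identityˡ _) (zeros ys)
    ∑-swap {B = B} (x ∷ xs) ys f = ≡.trans (≡.cong (ℤ._+_ (∑ ys (f x))) (∑-swap xs ys f)) (plus ys)
      where
      open import Algebra.Properties.CommutativeSemigroup ℤ.+-commutativeSemigroup using (interchange)
      plus : ∀ ys → ∑ ys (f x) ℤ.+ (∑[ y ∈ ys ] ∑[ x ∈ xs ] f x y) ≡ ∑[ y ∈ ys ] (f x y ℤ.+ ∑[ x ∈ xs ] f x y)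
      plus []       = ≡.refl
      plus (y ∷ ys) = ≡.trans
        (interchange (f x y) (∑ ys (f x)) (∑[ x ∈ xs ] f x y) (∑[ y ∈ ys ] ∑[ x ∈ xs ] f x y))
        (≡.cong (ℤ._+_ (f x y ℤ.+ ∑[ x ∈ xs ] f x y)) (plus ys))

    module _ {p} {P : Pred A p} (P? : Decidable P) where

      ∑-none : ∀ (xs : List A) (f : A → ℤ) → (∀ {x} → x ∈ xs → ¬ P x) → ∑[ x ∈ xs ] (⟨ P? x ⟩ f x) ≡ 0ℤ
      ∑-none []       f none = ≡.refl
      ∑-none (x ∷ xs) f none = ≡.cong₂ ℤ._+_ (bracket-false (P? x) {f x} (none (here ≡.refl))) (∑-none xs f (none ∘ there))

      ∑-unique : ∀ {xs} → Unique xs → ∀ {x} → x ∈ xs → P x → (∀ {y} → y ∈ xs → P y → y ≡ x) → ∀ (f : A → ℤ) →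
                 ∑[ x ∈ xs ] (⟨ P? x ⟩ f x) ≡ f x
      ∑-unique {z ∷ xs} (z∉xs ∷ _) (here ≡.refl) pz only f = ≡.trans
        (≡.cong₂ ℤ._+_ (bracket-true (P? z) {f z} pz) (∑-none xs f λ y∈xs py → All.lookup z∉xs y∈xs (≡.sym (only (there y∈xs) py))))
        (ℤ.+-identityʳ _)
      ∑-unique {z ∷ xs} (z∉xs ∷ xs!) (there x∈xs) px only f = ≡.trans
        (≡.cong₂ ℤ._+_ (bracket-false (P? z) {f z} λ pz → All.lookup z∉xs x∈xs (only (here ≡.refl) pz))
                       (∑-unique xs! x∈xs px (only ∘ there) f))
        (ℤ.+-identityˡ _)

      ∑-filter : ∀ (xs : List A) (f : A → ℤ) → ∑ (filter P? xs) f ≡ ∑[ x ∈ xs ] (⟨ P? x ⟩ f x)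
      ∑-filter []       f = ≡.refl
      ∑-filter (x ∷ xs) f with P? x
      ... | yes _ = ≡.cong (ℤ._+_ (f x)) (∑-filter xs f)
      ... | no _  = ≡.trans (∑-filter xs f) (≡.sym (ℤ.+-identityˡ _))

      ∑-count : ∀ (xs : List A) c → ∑[ x ∈ xs ] (⟨ P? x ⟩ c) ≡ + length (filter P? xs) ℤ.* c
      ∑-count []       c = ≡.sym (ℤ.*-zeroˡ c)
      ∑-count (x ∷ xs) c with P? x
      ... | yes _ = ≡.trans (≡.cong (ℤ._+_ c) (∑-count xs c)) (≡.sym (ℤ.suc-* (+ length (filter P? xs)) c))
      ... | no _  = ≡.trans (ℤ.+-identityˡ _) (∑-count xs c)

  ∑-map : ∀ {b c} {A : Set b} {B : Set c} (xs : List A) (g : A → B) f → ∑ (List.map g xs) f ≡ ∑ xs (f ∘ g)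
  ∑-map []       g f = ≡.refl
  ∑-map (x ∷ xs) g f = ≡.cong (ℤ._+_ (f (g x))) (∑-map xs g f)

  ∑-subsets : ∀ {m} (g : Subset (suc m) → ℤ) →
              ∑ (subsets (suc m)) g ≡ ∑ (subsets m) (g ∘ (outside ∷_)) ℤ.+ ∑ (subsets m) (g ∘ (inside ∷_))
  ∑-subsets {m} g = ≡.trans (∑-++ (List.map (outside ∷_) (subsets m)) _ g)
    (≡.cong₂ ℤ._+_ (∑-map (subsets m) (outside ∷_) g) (∑-map (subsets m) (inside ∷_) g))

  -- `toggle e` permutes the list `subsets m`: for the first element it exchanges the two halves,
  -- otherwise it acts inside each half.
  ∑-toggle : ∀ {m} (e : Fin m) (g : Subset m → ℤ) → ∑ (subsets m) (g ∘ toggle e) ≡ ∑ (subsets m) g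
  ∑-toggle {suc m} zero g = ≡.trans (∑-subsets (g ∘ toggle zero))
    (≡.trans (ℤ.+-comm (∑ (subsets m) (g ∘ (inside ∷_))) _) (≡.sym (∑-subsets g)))
  ∑-toggle {suc m} (suc e) g = ≡.trans (∑-subsets (g ∘ toggle (suc e)))
    (≡.trans (≡.cong₂ ℤ._+_ (∑-toggle e (g ∘ (outside ∷_))) (∑-toggle e (g ∘ (inside ∷_)))) (≡.sym (∑-subsets g)))

  ≡-neg⇒≡0 : ∀ x → x ≡ ℤ.- x → x ≡ 0ℤ
  ≡-neg⇒≡0 (+ zero)     _ = ≡.refl
  ≡-neg⇒≡0 (+ suc n)    ()
  ≡-neg⇒≡0 (ℤ.-[1+ n ]) ()

  sign : ℕ → ℤ
  sign zero    = 1ℤ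
  sign (suc n) = ℤ.- sign n

  abs-sign : ∀ n → abs (sign n) ≡ 1
  abs-sign zero    = ≡.refl
  abs-sign (suc n) = ≡.trans (ℤ.∣-i∣≡∣i∣ (sign n)) (abs-sign n)

  -- Matroids and Whitney's broken circuit theorem.

  record IsMatroid {ℓ m} (Indep : Pred (Subset m) ℓ) : Set ℓ where
    field
      ⊥-indep    : Indep Subset.⊥
      hereditary : ∀ {S T} → S ⊆ T → Indep T → Indep S
      augment    : ∀ {S T} → Indep S → Indep T → ∣ S ∣ ℕ.< ∣ T ∣ →
                   ∃ λ e → e Subset.∈ T × ¬ e Subset.∈ S × Indep (S ∪ ⁅ e ⁆)

  module BrokenCircuits {ℓ m} {Indep : Pred (Subset m) ℓ} (indep? : Decidable Indep)
                        (isMatroid : IsMatroid Indep) (loopless : ∀ e → Indep ⁅ e ⁆)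
                        (ρ : Fin m → ℕ) (ρ-injective : Injective _≡_ _≡_ ρ) where

    open Matroid indep?
    open IsMatroid isMatroid

    private
      independentIn? : ∀ S → Decidable (λ T → Indep T × T ⊆ S)
      independentIn? S T = indep? T ×-dec (T ⊆? S)

    ∣S∣≤rank : ∀ {T} S → Indep T → T ⊆ S → ∣ T ∣ ℕ.≤ rank S
    ∣S∣≤rank {T} S T-ind T⊆S = All.lookup (Extrema.xs≤max 0 _)
      (∈-map⁺ ∣_∣ (∈-filter⁺ (independentIn? S) (subsets-complete T) (T-ind , λ {_} → T⊆S)))

    rank-attained : ∀ S → ∃ λ T → Indep T × (T ⊆ S) × ∣ T ∣ ≡ rank S
    rank-attained S with Extrema.argmax-sel id 0 (List.map ∣_∣ (filter (independentIn? S) (subsets m)))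
    ... | inj₁ ≡0 = Subset.⊥ , ⊥-indep , ⊥⊆ , ≡.trans (∣⊥∣≡0 m) (≡.sym ≡0)
    ... | inj₂ ∈max with ∈-map⁻ ∣_∣ ∈max
    ...   | T , T∈ , eq with ∈-filter⁻ (independentIn? S) {xs = subsets m} T∈
    ...     | _ , T-ind , T⊆S = T , T-ind , T⊆S , ≡.sym eq

    rank≤ : ∀ S {r} → (∀ {T} → Indep T → T ⊆ S → ∣ T ∣ ℕ.≤ r) → rank S ℕ.≤ r
    rank≤ S bound with rank-attained S
    ... | T , T-ind , T⊆S , eq = ℕ.≤-trans (ℕ.≤-reflexive (≡.sym eq)) (bound T-ind T⊆S)

    -- As F is flat, a largest independent subset T of `F ∪ ⁅ e ⁆` has more than `rank F` elements
    -- and can therefore enlarge S. If it supplies an element of F, that element is kept and the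
    -- exchange repeated; S cannot outgrow `rank F`, so e is supplied in the end, and heredity
    -- discards the elements kept on the way. The fuel bounds the number of elements of F that S can
    -- still absorb.
    flat-augment : ∀ {F e S} → IsFlat F → ¬ e Subset.∈ F → Indep S → S ⊆ F → Indep (S ∪ ⁅ e ⁆)
    flat-augment {F} {e} {S} F-flat e∉F S-ind S⊆F =
      go (rank F) S S-ind S⊆F (ℕ.m≤n+m (rank F) ∣ S ∣)
      where
      go : ∀ fuel S → Indep S → S ⊆ F → rank F ℕ.≤ ∣ S ∣ ℕ.+ fuel → Indep (S ∪ ⁅ e ⁆)
      go fuel S S-ind S⊆F bound with rank-attained (F ∪ ⁅ e ⁆)
      ... | T , T-ind , T⊆ , ∣T∣≡
        with augment S-ind T-ind (ℕ.≤-<-trans (∣S∣≤rank F S-ind S⊆F)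
               (ℕ.<-≤-trans (F-flat e e∉F) (ℕ.≤-reflexive (≡.sym ∣T∣≡))))
      ... | t , t∈T , t∉S , S∪t-ind with x∈p∪q⁻ F ⁅ e ⁆ (T⊆ t∈T)
      ...   | inj₂ t∈⁅e⁆ = ≡.subst (λ t → Indep (S ∪ ⁅ t ⁆)) (x∈⁅y⁆⇒x≡y e t∈⁅e⁆) S∪t-ind
      ...   | inj₁ t∈F with fuel
      ...     | zero  = contradiction
                (ℕ.≤-trans (ℕ.≤-reflexive (≡.sym (∣∪⁅⁆∣ t∉S)))
                  (ℕ.≤-trans (∣S∣≤rank F S∪t-ind (∪-least S⊆F (⁅⁆⊆ t∈F))) (ℕ.≤-trans bound (ℕ.≤-reflexive (ℕ.+-identityʳ ∣ S ∣)))))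
                ℕ.1+n≰n
      ...     | suc fuel = hereditary (∪⁅⁆-mono e (⊆∪ˡ ⁅ t ⁆))
                (go fuel (S ∪ ⁅ t ⁆) S∪t-ind (∪-least S⊆F (⁅⁆⊆ t∈F))
                  (ℕ.≤-trans bound (ℕ.≤-reflexive (≡.trans (ℕ.+-suc ∣ S ∣ fuel)
                    (≡.cong (ℕ._+ fuel) (≡.sym (∣∪⁅⁆∣ t∉S)))))))

    spanned? : ∀ S → Decidable (λ e → e Subset.∈ S ⊎ ¬ Indep (S ∪ ⁅ e ⁆))
    spanned? S e = (e ∈? S) ⊎-dec ¬? (indep? (S ∪ ⁅ e ⁆))

    -- A closure without ranks, meant for independent S only: a dependent S would span everything.
    cl : Subset m → Subset m
    cl S = comprehension (spanned? S)

    S⊆cl : ∀ S → S ⊆ cl S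
    S⊆cl S e∈S = ∈-comprehension⁺ (spanned? S) (inj₁ e∈S)

    rank-cl : ∀ {S} → Indep S → rank (cl S) ≡ ∣ S ∣
    rank-cl {S} S-ind = ℕ.≤-antisym (rank≤ (cl S) bound) (∣S∣≤rank (cl S) S-ind (S⊆cl S))
      where
      bound : ∀ {T} → Indep T → T ⊆ cl S → ∣ T ∣ ℕ.≤ ∣ S ∣
      bound {T} T-ind T⊆ = ℕ.≮⇒≥ λ ∣S∣<∣T∣ → absurd (augment S-ind T-ind ∣S∣<∣T∣)
        where
        absurd : ¬ ∃ λ e → e Subset.∈ T × ¬ e Subset.∈ S × Indep (S ∪ ⁅ e ⁆)
        absurd (e , e∈T , e∉S , ind) = [ e∉S , (λ dep → dep ind) ] (∈-comprehension⁻ (spanned? S) (T⊆ e∈T))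

    cl-flat : ∀ {S} → Indep S → IsFlat (cl S)
    cl-flat {S} S-ind e e∉cl = ≡.subst (ℕ._< rank (cl S ∪ ⁅ e ⁆)) (≡.sym (rank-cl S-ind))
      (ℕ.≤-trans (ℕ.≤-reflexive (≡.sym (∣∪⁅⁆∣ (e∉cl ∘ S⊆cl S))))
        (∣S∣≤rank (cl S ∪ ⁅ e ⁆) S∪e-ind (∪⁅⁆-mono e (S⊆cl S))))
      where
      S∪e-ind : Indep (S ∪ ⁅ e ⁆)
      S∪e-ind = Dec.decidable-stable (indep? (S ∪ ⁅ e ⁆)) (e∉cl ∘ ∈-comprehension⁺ (spanned? S) ∘ inj₂)

    cl⊆flat : ∀ {S F} → IsFlat F → Indep S → S ⊆ F → cl S ⊆ F
    cl⊆flat {S} {F} F-flat S-ind S⊆F {e} e∈cl = Dec.decidable-stable (e ∈? F) λ e∉F →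
      [ e∉F ∘ S⊆F , (λ dep → dep (flat-augment F-flat e∉F S-ind S⊆F)) ] (∈-comprehension⁻ (spanned? S) e∈cl)

    -- A basis determines its flat: an element of E outside `cl S` would extend S to an independent
    -- subset of E with more than `rank E` elements.
    flat≡cl : ∀ {S E} → IsFlat E → Indep S → S ⊆ E → ∣ S ∣ ≡ rank E → E ≡ cl S
    flat≡cl {S} {E} E-flat S-ind S⊆E ∣S∣≡ = ⊆-antisym E⊆cl (cl⊆flat E-flat S-ind S⊆E)
      where
      E⊆cl : E ⊆ cl S
      E⊆cl {e} e∈E = Dec.decidable-stable (e ∈? cl S) λ e∉cl →
        let S∪e-ind = Dec.decidable-stable (indep? (S ∪ ⁅ e ⁆)) (e∉cl ∘ ∈-comprehension⁺ (spanned? S) ∘ inj₂)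
        in ℕ.1+n≰n (ℕ.≤-trans (ℕ.≤-reflexive (≡.sym (∣∪⁅⁆∣ (e∉cl ∘ S⊆cl S))))
             (ℕ.≤-trans (∣S∣≤rank E S∪e-ind (∪-least S⊆E (⁅⁆⊆ e∈E))) (ℕ.≤-reflexive (≡.sym ∣S∣≡))))

    cl∈flats : ∀ {S} → Indep S → cl S ∈ flats
    cl∈flats {S} S-ind = ∈-filter⁺ isFlat? (subsets-complete (cl S)) (cl-flat S-ind)

    flats⇒isFlat : ∀ {F} → F ∈ flats → IsFlat F
    flats⇒isFlat F∈ = proj₂ (∈-filter⁻ isFlat? {xs = subsets m} F∈)

    flats-unique : Unique flats
    flats-unique = Unique.filter⁺ isFlat? (subsets-unique m)

    -- Without loops the Möbius recursion starts at the empty set.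
    0̂≡⊥ : 0̂ ≡ Subset.⊥
    0̂≡⊥ = Empty-unique λ (e , e∈0̂) → absurd e (∈-comprehension⁻ (λ e → rank (Subset.⊥ ∪ ⁅ e ⁆) ℕ.≟ rank Subset.⊥) e∈0̂)
      where
      absurd : ∀ e → rank (Subset.⊥ ∪ ⁅ e ⁆) ≢ rank Subset.⊥
      absurd e eq = ℕ.1+n≰n (begin
        1                          ≡⟨ ∣⁅x⁆∣≡1 e ⟨
        ∣ ⁅ e ⁆ ∣                  ≤⟨ ∣S∣≤rank (Subset.⊥ ∪ ⁅ e ⁆) (loopless e) (q⊆p∪q Subset.⊥ ⁅ e ⁆) ⟩
        rank (Subset.⊥ ∪ ⁅ e ⁆)    ≡⟨ eq ⟩
        rank Subset.⊥              ≤⟨ rank≤ Subset.⊥ (λ _ → p⊆q⇒∣p∣≤∣q∣) ⟩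
        ∣ Subset.⊥ {m} ∣           ≡⟨ ∣⊥∣≡0 m ⟩
        0                          ∎)
        where open ℕ.≤-Reasoning

    above? : ∀ e S → Decidable (λ f → f Subset.∈ S × ρ e ℕ.< ρ f)
    above? e S f = (f ∈? S) ×-dec (ρ e ℕ.<? ρ f)

    above : Fin m → Subset m → Subset m
    above e S = comprehension (above? e S)

    -- With respect to the order of the values of ρ: S contains a broken circuit exactly if some e
    -- depends on the elements of S above e.
    NBC : Pred (Subset m) ℓ
    NBC S = ∀ e → Indep (above e S ∪ ⁅ e ⁆)

    nbc? : Decidable NBC
    nbc? S = all? λ e → indep? (above e S ∪ ⁅ e ⁆)

    above⊆ : ∀ e S → above e S ⊆ S
    above⊆ e S = proj₁ ∘ ∈-comprehension⁻ (above? e S)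

    above-mono : ∀ e {S T} → S ⊆ T → above e S ⊆ above e T
    above-mono e {S} {T} S⊆T f∈ with ∈-comprehension⁻ (above? e S) f∈
    ... | f∈S , e<f = ∈-comprehension⁺ (above? e T) (S⊆T f∈S , e<f)

    minimum-below : ∀ {e S} → (∀ {f} → f Subset.∈ S → ρ e ℕ.≤ ρ f) → S ⊆ above e S ∪ ⁅ e ⁆
    minimum-below {e} {S} minimal {f} f∈S with f Fin.≟ e
    ... | yes ≡.refl = ∈-∪⁅⁆ (above e S) e
    ... | no f≢e     = p⊆p∪q ⁅ e ⁆ (∈-comprehension⁺ (above? e S)
          (f∈S , ℕ.≤∧≢⇒< (minimal f∈S) (f≢e ∘ ≡.sym ∘ ρ-injective)))

    -- Everything in S except its ρ-minimum f lies above f, so the condition at f alone already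
    -- covers S.
    nbc⇒indep : ∀ {S} → NBC S → Indep S
    nbc⇒indep {S} S-nbc with nonempty? S
    ... | no empty = ≡.subst Indep (≡.sym (Empty-unique empty)) ⊥-indep
    ... | yes (e , e∈S) with minimizer ρ S e∈S
    ...   | f , f∈S , minimal = hereditary (minimum-below minimal) (S-nbc f)

    nbc-⊥ : NBC Subset.⊥
    nbc-⊥ e = hereditary (∪-least ((λ f∈⊥ → contradiction f∈⊥ ∉⊥) ∘ above⊆ e Subset.⊥) id) (loopless e)

    -- h F is the signed number of NBC bases of the flat F; Whitney's theorem is μ 0̂ F = h F.
    base? : ∀ F → Decidable (λ S → NBC S × S ⊆ F × ∣ S ∣ ≡ rank F)
    base? F S = nbc? S ×-dec ((S ⊆? F) ×-dec (∣ S ∣ ℕ.≟ rank F))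

    h : Subset m → ℤ
    h F = ∑[ S ∈ subsets m ] ⟨ base? F S ⟩ sign ∣ S ∣

    -- Double counting: an NBC set S is a base of exactly one flat, namely `cl S`, so summing `h`
    -- over flats amounts to summing signs over NBC sets. Q is the condition P on flats, transported
    -- to sets along `cl`. It is used for containment in a flat and for a fixed rank.
    ∑-h : ∀ {p} {P : Pred (Subset m) p} (P? : Decidable P) {q} {Q : Pred (Subset m) q} (Q? : Decidable Q) →
          (∀ {S E} → IsFlat E → NBC S → S ⊆ E → ∣ S ∣ ≡ rank E → P E → Q S) →
          (∀ {S} → NBC S → Q S → P (cl S)) →
          ∑[ E ∈ flats ] ⟨ P? E ⟩ h E ≡ ∑[ S ∈ subsets m ] ⟨ nbc? S ×-dec Q? S ⟩ sign ∣ S ∣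
    ∑-h P? Q? P⇒Q Q⇒P = begin
      ∑[ E ∈ flats ] ⟨ P? E ⟩ h E
        ≡⟨ ∑-cong flats (λ E → ≡.sym (∑-bracket (P? E) (subsets m) _)) ⟩
      ∑[ E ∈ flats ] ∑[ S ∈ subsets m ] ⟨ P? E ⟩ ⟨ base? E S ⟩ sign ∣ S ∣
        ≡⟨ ∑-swap flats (subsets m) _ ⟩
      ∑[ S ∈ subsets m ] ∑[ E ∈ flats ] ⟨ P? E ⟩ ⟨ base? E S ⟩ sign ∣ S ∣
        ≡⟨ ∑-cong (subsets m) (λ S → ≡.trans (∑-cong flats λ E → ≡.sym (bracket-× (P? E) (base? E S) _)) (inner S)) ⟩
      ∑[ S ∈ subsets m ] ⟨ nbc? S ×-dec Q? S ⟩ sign ∣ S ∣ ∎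
      where
      open ≡.≡-Reasoning
      inner : ∀ S → ∑[ E ∈ flats ] ⟨ P? E ×-dec base? E S ⟩ sign ∣ S ∣ ≡ ⟨ nbc? S ×-dec Q? S ⟩ sign ∣ S ∣
      inner S with nbc? S ×-dec Q? S
      ... | yes (S-nbc , qS) = ∑-unique (λ E → P? E ×-dec base? E S) flats-unique
            (cl∈flats S-ind)
            (Q⇒P S-nbc qS , S-nbc , S⊆cl S , ≡.sym (rank-cl S-ind))
            (λ E∈ (_ , _ , S⊆E , eq) → flat≡cl (flats⇒isFlat E∈) S-ind S⊆E eq)
            (λ _ → sign ∣ S ∣)
        where S-ind = nbc⇒indep S-nbc
      ... | no ¬q = ∑-none (λ E → P? E ×-dec base? E S) flats (λ _ → sign ∣ S ∣)
            λ E∈ (pE , S-nbc , S⊆E , eq) → ¬q (S-nbc , P⇒Q (flats⇒isFlat E∈) S-nbc S⊆E eq pE)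

    -- Toggling the minimum e of F is a sign-reversing involution on the NBC subsets of F.
    module _ {F e} (F-flat : IsFlat F) (e∈F : e Subset.∈ F) (minimal : ∀ {f} → f Subset.∈ F → ρ e ℕ.≤ ρ f) where

      private
        InF : Pred (Subset m) ℓ
        InF S = NBC S × S ⊆ F

        inF? : Decidable InF
        inF? S = nbc? S ×-dec (S ⊆? F)

        weight : Subset m → ℤ
        weight S = ⟨ inF? S ⟩ sign ∣ S ∣

      -- For c in F, the minimum e is not above c, so inserting it does not change what lies above
      -- c. For c outside F, the set `S ∪ ⁅ e ⁆` is independent by the condition at e, because all
      -- of S other than e is above e; as it lies in the flat F, c can be adjoined.
      insert-minimum : ∀ {S} → NBC S → S ⊆ F → NBC (S ∪ ⁅ e ⁆)
      insert-minimum {S} S-nbc S⊆F c with c ∈? F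
      ... | yes c∈F = hereditary (∪⁅⁆-mono c above⊆above) (S-nbc c)
        where
        above⊆above : above c (S ∪ ⁅ e ⁆) ⊆ above c S
        above⊆above f∈ with ∈-comprehension⁻ (above? c (S ∪ ⁅ e ⁆)) f∈
        ... | f∈S∪e , c<f with x∈p∪q⁻ S ⁅ e ⁆ f∈S∪e
        ...   | inj₁ f∈S  = ∈-comprehension⁺ (above? c S) (f∈S , c<f)
        ...   | inj₂ f∈⁅e⁆ = contradiction (≡.subst (λ f → ρ c ℕ.< ρ f) (x∈⁅y⁆⇒x≡y e f∈⁅e⁆) c<f) (ℕ.≤⇒≯ (minimal c∈F))
      ... | no c∉F = hereditary (∪⁅⁆-mono c (above⊆ c (S ∪ ⁅ e ⁆)))
            (flat-augment F-flat c∉F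
              (hereditary (∪-least (minimum-below (minimal ∘ S⊆F)) (q⊆p∪q (above e S) ⁅ e ⁆)) (S-nbc e))
              (∪-least S⊆F (⁅⁆⊆ e∈F)))

      toggle-weight-∉ : ∀ {S} → ¬ e Subset.∈ S → weight (toggle e S) ≡ ℤ.- weight S
      toggle-weight-∉ {S} e∉S with inF? S
      ... | yes (S-nbc , S⊆F) = ≡.trans
            (bracket-true (inF? (toggle e S)) (≡.subst InF (≡.sym (toggle-∉ e∉S))
              (insert-minimum S-nbc S⊆F , ∪-least S⊆F (⁅⁆⊆ e∈F))))
            (≡.cong sign (∣toggle∣ e∉S))
      ... | no ¬in = bracket-false (inF? (toggle e S)) λ in′ →
            let S∪e-nbc , S∪e⊆F = ≡.subst InF (toggle-∉ e∉S) in′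
            in ¬in ((λ c → hereditary (∪⁅⁆-mono c (above-mono c (⊆∪ˡ ⁅ e ⁆))) (S∪e-nbc c)) , S∪e⊆F ∘ ⊆∪ˡ ⁅ e ⁆)

      toggle-weight : ∀ S → weight (toggle e S) ≡ ℤ.- weight S
      toggle-weight S with e ∈? S
      ... | no e∉S  = toggle-weight-∉ e∉S
      ... | yes e∈S = ≡.trans (≡.sym (ℤ.neg-involutive (weight (toggle e S))))
            (≡.cong ℤ.-_ (≡.trans (≡.sym (toggle-weight-∉ (∈-toggle e∈S))) (≡.cong weight (toggle-involutive e S))))

      ∑-nbc-cancel : ∑[ S ∈ subsets m ] ⟨ nbc? S ×-dec (S ⊆? F) ⟩ sign ∣ S ∣ ≡ 0ℤ
      ∑-nbc-cancel = ≡-neg⇒≡0 _ (≡.trans (≡.sym (∑-toggle e weight))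
        (≡.trans (∑-cong (subsets m) toggle-weight) (∑-neg (subsets m) weight)))

    -- The summand in the recursion for μ is local to μ-acc; the unification in μ-unfold names it.
    mutual
      μ-term : ∀ F G → (∀ {E} → E ⊂ G → Acc _⊂_ E) → Subset m → ℤ
      μ-term = _

      μ-unfold : ∀ F G (rs : ∀ {E} → E ⊂ G → Acc _⊂_ E) →
                 μ-acc F G (acc rs) ≡
                 (if does (Vec.≡-dec Bool._≟_ F G) then 1ℤ else ℤ.- ∑ flats (μ-term F G rs))
      μ-unfold F G rs = ≡.refl

    μ-term-bracket : ∀ {F G} (rs : ∀ {E} → E ⊂ G → Acc _⊂_ E) {E x} → F ⊆ E →
                     ((E⊂G : E ⊂ G) → μ-acc F E (rs E⊂G) ≡ x) → μ-term F G rs E ≡ ⟨ E ⊂? G ⟩ x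
    μ-term-bracket {F} {G} rs {E} F⊆E value with (F ⊆? E) ×-dec (E ⊂? G)
    ... | yes (_ , E⊂G) = ≡.trans (value E⊂G) (≡.sym (bracket-true (E ⊂? G) E⊂G))
    ... | no  ¬both     = ≡.sym (bracket-false (E ⊂? G) λ E⊂G → ¬both ((λ {_} → F⊆E) , E⊂G))

    h-⊥ : ∀ {F} → F ≡ Subset.⊥ → h F ≡ 1ℤ
    h-⊥ ≡.refl = ≡.trans
      (∑-unique (base? Subset.⊥) (subsets-unique m) (subsets-complete Subset.⊥)
        (nbc-⊥ , (λ {_} → id) , ≡.sym rank-⊥)
        (λ _ (_ , S⊆⊥ , _) → ⊆-antisym S⊆⊥ ⊥⊆) (sign ∘ ∣_∣))
      (≡.cong sign (∣⊥∣≡0 m))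
      where
      rank-⊥ : rank Subset.⊥ ≡ ∣ Subset.⊥ {m} ∣
      rank-⊥ = ℕ.≤-antisym (rank≤ Subset.⊥ λ _ → p⊆q⇒∣p∣≤∣q∣) (∣S∣≤rank Subset.⊥ ⊥-indep id)

    -- This is the recursion that characterizes `μ 0̂`; together with `h-⊥` it forces `h` and `μ 0̂`
    -- to agree on flats. It holds because the NBC sets with closure in F are the NBC subsets of F,
    -- and these cancel in pairs.
    ∑-h-flat : ∀ {F e} → IsFlat F → e Subset.∈ F → ∑[ E ∈ flats ] ⟨ E ⊆? F ⟩ h E ≡ 0ℤ
    ∑-h-flat {F} F-flat e∈F with minimizer ρ F e∈F
    ... | f , f∈F , minimal = ≡.trans
      (∑-h (_⊆? F) (_⊆? F) (λ _ _ S⊆E _ E⊆F → E⊆F ∘ S⊆E) (λ S-nbc S⊆F → cl⊆flat F-flat (nbc⇒indep S-nbc) S⊆F))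
      (∑-nbc-cancel F-flat f∈F minimal)

    bracket-⊆ : ∀ (E F : Subset m) x → ⟨ E ⊆? F ⟩ x ≡ ⟨ E ⊂? F ⟩ x ℤ.+ ⟨ Vec.≡-dec Bool._≟_ E F ⟩ x
    bracket-⊆ E F x with Vec.≡-dec Bool._≟_ E F
    ... | yes ≡.refl = ≡.trans (bracket-true (E ⊆? E) id)
          (≡.sym (≡.trans (≡.cong (ℤ._+ x) (bracket-false (E ⊂? E) (⊂-irref ≡.refl))) (ℤ.+-identityˡ x)))
    ... | no E≢F with E ⊂? F
    ...   | yes E⊂F = ≡.trans (bracket-true (E ⊆? F) (proj₁ E⊂F)) (≡.sym (ℤ.+-identityʳ x))
    ...   | no  E⊄F = bracket-false (E ⊆? F) λ E⊆F → E⊄F (⊆∧≢⇒⊂ E⊆F E≢F)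
      where
      ⊆∧≢⇒⊂ : ∀ {E F} → E ⊆ F → E ≢ F → E ⊂ F
      ⊆∧≢⇒⊂ {E} {F} E⊆F E≢F with any? (λ e → (e ∈? F) ×-dec ¬? (e ∈? E))
      ... | yes (e , e∈F , e∉E) = (λ {_} → E⊆F) , e , e∈F , e∉E
      ... | no  none = contradiction
            (⊆-antisym E⊆F λ {e} e∈F → Dec.decidable-stable (e ∈? E) λ e∉E → none (e , e∈F , e∉E)) E≢F

    ∑-h-proper : ∀ {F e} → F ∈ flats → e Subset.∈ F → ℤ.- (∑[ E ∈ flats ] ⟨ E ⊂? F ⟩ h E) ≡ h F
    ∑-h-proper {F} F∈ e∈F = ≡.sym (inverseʳ-unique (∑[ E ∈ flats ] ⟨ E ⊂? F ⟩ h E) (h F) (begin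
      (∑[ E ∈ flats ] ⟨ E ⊂? F ⟩ h E) ℤ.+ h F
        ≡⟨ ≡.cong (ℤ._+_ (∑[ E ∈ flats ] ⟨ E ⊂? F ⟩ h E))
             (∑-unique (λ E → Vec.≡-dec Bool._≟_ E F) flats-unique F∈ ≡.refl (λ _ eq → eq) h) ⟨
      (∑[ E ∈ flats ] ⟨ E ⊂? F ⟩ h E) ℤ.+ (∑[ E ∈ flats ] ⟨ Vec.≡-dec Bool._≟_ E F ⟩ h E)
        ≡⟨ ∑-+ flats (λ E → ⟨ E ⊂? F ⟩ h E) (λ E → ⟨ Vec.≡-dec Bool._≟_ E F ⟩ h E) ⟨
      ∑[ E ∈ flats ] (⟨ E ⊂? F ⟩ h E ℤ.+ ⟨ Vec.≡-dec Bool._≟_ E F ⟩ h E)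
        ≡⟨ ∑-cong flats (λ E → bracket-⊆ E F (h E)) ⟨
      ∑[ E ∈ flats ] ⟨ E ⊆? F ⟩ h E
        ≡⟨ ∑-h-flat (flats⇒isFlat F∈) e∈F ⟩
      0ℤ ∎))
      where
      open ≡.≡-Reasoning
      open import Algebra.Properties.AbelianGroup ℤ.+-0-abelianGroup using (inverseʳ-unique)

    μ-acc≡h : ∀ {F} (wf : Acc _⊂_ F) → F ∈ flats → μ-acc 0̂ F wf ≡ h F
    μ-acc≡h {F} (acc rs) F∈ = ≡.trans (μ-unfold 0̂ F rs) cases
      where
      cases : (if does (Vec.≡-dec Bool._≟_ 0̂ F) then 1ℤ else ℤ.- ∑ flats (μ-term 0̂ F rs)) ≡ h F
      cases with Vec.≡-dec Bool._≟_ 0̂ F | nonempty? F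
      ... | yes 0̂≡F | _             = ≡.sym (h-⊥ (≡.trans (≡.sym 0̂≡F) 0̂≡⊥))
      ... | no 0̂≢F  | no empty      = contradiction (≡.trans 0̂≡⊥ (≡.sym (Empty-unique empty))) 0̂≢F
      ... | no _    | yes (e , e∈F) = ≡.trans
            (≡.cong ℤ.-_ (∑-cong-∈ flats λ {E} E∈ →
              μ-term-bracket rs (⊆-trans (⊆-reflexive 0̂≡⊥) ⊥⊆) λ E⊂F → μ-acc≡h (rs E⊂F) E∈))
            (∑-h-proper F∈ e∈F)

    nbcCount : ℕ → ℕ
    nbcCount i = length (filter (λ S → nbc? S ×-dec (∣ S ∣ ℕ.≟ i)) (subsets m))

    -- NBC bases of flats of rank i all have size i and hence the same sign, so nothing cancels. The
    -- left side does not mention ρ, so the count is the same for every order.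
    abs-whitney : ∀ i → abs (whitney i) ≡ nbcCount i
    abs-whitney i = begin
      abs (∑[ F ∈ filter rank≟i flats ] μ 0̂ F)
        ≡⟨ ≡.cong abs (∑-cong-∈ (filter rank≟i flats) λ {F} F∈ →
             μ-acc≡h (⊂-wellFounded F) (proj₁ (∈-filter⁻ rank≟i {xs = flats} F∈))) ⟩
      abs (∑[ F ∈ filter rank≟i flats ] h F)
        ≡⟨ ≡.cong abs (∑-filter rank≟i flats h) ⟩
      abs (∑[ F ∈ flats ] ⟨ rank≟i F ⟩ h F)
        ≡⟨ ≡.cong abs (∑-h rank≟i (λ S → ∣ S ∣ ℕ.≟ i) (λ _ _ _ eq eq′ → ≡.trans eq eq′)
             (λ S-nbc eq → ≡.trans (rank-cl (nbc⇒indep S-nbc)) eq)) ⟩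
      abs (∑[ S ∈ subsets m ] ⟨ nbc? S ×-dec (∣ S ∣ ℕ.≟ i) ⟩ sign ∣ S ∣)
        ≡⟨ ≡.cong abs (∑-cong (subsets m) same-sign) ⟩
      abs (∑[ S ∈ subsets m ] ⟨ nbc? S ×-dec (∣ S ∣ ℕ.≟ i) ⟩ sign i)
        ≡⟨ ≡.cong abs (∑-count (λ S → nbc? S ×-dec (∣ S ∣ ℕ.≟ i)) (subsets m) (sign i)) ⟩
      abs (+ nbcCount i ℤ.* sign i)
        ≡⟨ ℤ.abs-* (+ nbcCount i) (sign i) ⟩
      nbcCount i ℕ.* abs (sign i)
        ≡⟨ ≡.trans (≡.cong (nbcCount i ℕ.*_) (abs-sign i)) (ℕ.*-identityʳ (nbcCount i)) ⟩
      nbcCount i ∎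
      where
      open ≡.≡-Reasoning
      rank≟i : Decidable (λ F → rank F ≡ i)
      rank≟i F = rank F ℕ.≟ i
      same-sign : ∀ S → ⟨ nbc? S ×-dec (∣ S ∣ ℕ.≟ i) ⟩ sign ∣ S ∣ ≡ ⟨ nbc? S ×-dec (∣ S ∣ ℕ.≟ i) ⟩ sign i
      same-sign S with nbc? S ×-dec (∣ S ∣ ℕ.≟ i)
      ... | yes (_ , eq) = ≡.cong sign eq
      ... | no _         = ≡.refl

  -- Enumerations and images of subsets.

  elements∈ : ∀ {n} (S : Subset n) r → elements S r Subset.∈ S
  elements∈ (inside  ∷ S) zero    = Vec.here
  elements∈ (inside  ∷ S) (suc r) = Vec.there (elements∈ S r)
  elements∈ (outside ∷ S) r       = Vec.there (elements∈ S r)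

  elements-injective : ∀ {n} (S : Subset n) → Injective _≡_ _≡_ (elements S)
  elements-injective (inside  ∷ S) {zero}  {zero}  eq = ≡.refl
  elements-injective (inside  ∷ S) {suc r} {suc t} eq = ≡.cong suc (elements-injective S (Fin.suc-injective eq))
  elements-injective (outside ∷ S) eq = elements-injective S (Fin.suc-injective eq)

  position : ∀ {n} {S : Subset n} {e} → e Subset.∈ S → ∃ λ r → elements S r ≡ e
  position {S = inside  ∷ S} Vec.here        = zero , ≡.refl
  position {S = inside  ∷ S} (Vec.there e∈S) with position e∈S
  ... | r , eq = suc r , ≡.cong suc eq
  position {S = outside ∷ S} (Vec.there e∈S) with position e∈S
  ... | r , eq = r , ≡.cong suc eq

  -- A relation instead of a function, so that both inequalities of `∣image∣` are instances: one
  -- along φ and one against it.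
  ∣⊆∣ : ∀ {m n} {S : Subset m} {T : Subset n} (R : Fin m → Fin n → Set) →
        (∀ {e e′ f} → R e f → R e′ f → e ≡ e′) →
        (∀ {e} → e Subset.∈ S → ∃ λ f → f Subset.∈ T × R e f) → ∣ S ∣ ℕ.≤ ∣ T ∣
  ∣⊆∣ {S = S} {T} R R-injective total = Fin.injective⇒≤ {f = target} λ {r} {t} eq →
    elements-injective S (R-injective (related r) (≡.subst (λ u → R (elements S t) (elements T u)) (≡.sym eq) (related t)))
    where
    target : Fin ∣ S ∣ → Fin ∣ T ∣
    target r = proj₁ (position (proj₁ (proj₂ (total (elements∈ S r)))))
    related : ∀ r → R (elements S r) (elements T (target r))
    related r with total (elements∈ S r)
    ... | f , f∈T , ref = ≡.subst (R (elements S r)) (≡.sym (proj₂ (position f∈T))) ref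

  module _ {m n} (φ : Fin m → Fin n) where

    inImage? : ∀ S → Decidable (λ e → ∃ λ f → f Subset.∈ S × φ f ≡ e)
    inImage? S e = any? λ f → (f ∈? S) ×-dec (φ f Fin.≟ e)

    image : Subset m → Subset n
    image S = comprehension (inImage? S)

    ∈-image⁺ : ∀ {S f} → f Subset.∈ S → φ f Subset.∈ image S
    ∈-image⁺ {S} {f} f∈S = ∈-comprehension⁺ (inImage? S) (f , f∈S , ≡.refl)

    ∈-image⁻ : ∀ {S e} → e Subset.∈ image S → ∃ λ f → f Subset.∈ S × φ f ≡ e
    ∈-image⁻ {S} = ∈-comprehension⁻ (inImage? S)

    image-elements : ∀ S r → ∃ λ t → φ (elements S t) ≡ elements (image S) r
    image-elements S r with ∈-image⁻ {S} (elements∈ (image S) r)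
    ... | f , f∈S , φf≡e = proj₁ (position f∈S) , ≡.trans (≡.cong φ (proj₂ (position f∈S))) φf≡e

    module _ (φ-injective : Injective _≡_ _≡_ φ) where

      image-reflects-⊆ : ∀ {S T} → image S ⊆ image T → S ⊆ T
      image-reflects-⊆ {S} {T} S⊆T f∈S with ∈-image⁻ {T} (S⊆T (∈-image⁺ f∈S))
      ... | g , g∈T , eq = ≡.subst (Subset._∈ T) (φ-injective eq) g∈T

      image-injective : Injective _≡_ _≡_ image
      image-injective eq = ⊆-antisym (image-reflects-⊆ (⊆-reflexive eq)) (image-reflects-⊆ (⊆-reflexive (≡.sym eq)))

      ∣image∣ : ∀ S → ∣ image S ∣ ≡ ∣ S ∣
      ∣image∣ S = ℕ.≤-antisym
        (∣⊆∣ (λ e f → φ f ≡ e) (λ eq eq′ → ≡.trans (≡.sym eq) eq′) (∈-image⁻ {S}))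
        (∣⊆∣ (λ f e → φ f ≡ e) (λ eq eq′ → φ-injective (≡.trans eq (≡.sym eq′))) λ {f} f∈S → φ f , ∈-image⁺ f∈S , ≡.refl)

  lookup-injective : ∀ {A : Set} {xs : List A} → Unique xs → Injective _≡_ _≡_ (List.lookup xs)
  lookup-injective (x∉ ∷ xs!) {zero}  {zero}  eq = ≡.refl
  lookup-injective (x∉ ∷ xs!) {zero}  {suc j} eq = contradiction eq (All.lookup x∉ (∈-lookup j))
  lookup-injective (x∉ ∷ xs!) {suc i} {zero}  eq = contradiction (≡.sym eq) (All.lookup x∉ (∈-lookup i))
  lookup-injective (x∉ ∷ xs!) {suc i} {suc j} eq = ≡.cong suc (lookup-injective xs! eq)

  length-≤ : ∀ {A B : Set} {xs : List A} {ys : List B} → Unique xs → (f : A → B) → Injective _≡_ _≡_ f →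
             (∀ {x} → x ∈ xs → f x ∈ ys) → length xs ℕ.≤ length ys
  length-≤ {xs = xs} {ys} xs! f f-injective f∈ = Fin.injective⇒≤ {f = λ i → Any.index (f∈ (∈-lookup i))} λ {i} {j} eq →
    lookup-injective xs! (f-injective (≡.trans (Any.lookup-index (f∈ (∈-lookup i)))
      (≡.trans (≡.cong (List.lookup ys) eq) (≡.sym (Any.lookup-index (f∈ (∈-lookup j)))))))

  -- Comparison of two matroids along an injection that preserves independence.

  module Comparison
    {ℓ₁ ℓ₂ m₁ m₂} {Indep₁ : Pred (Subset m₁) ℓ₁} {Indep₂ : Pred (Subset m₂) ℓ₂}
    (indep₁? : Decidable Indep₁) (indep₂? : Decidable Indep₂)
    (isMatroid₁ : IsMatroid Indep₁) (isMatroid₂ : IsMatroid Indep₂)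
    (loopless₁ : ∀ e → Indep₁ ⁅ e ⁆) (loopless₂ : ∀ e → Indep₂ ⁅ e ⁆)
    (φ : Fin m₂ → Fin m₁) (φ-injective : Injective _≡_ _≡_ φ)
    (image-indep : ∀ {S} → Indep₂ S → Indep₁ (image φ S)) where

    count-≤ : ∀ {p q} {P : Pred (Subset m₂) p} {Q : Pred (Subset m₁) q} (P? : Decidable P) (Q? : Decidable Q) →
              (∀ {S} → P S → Q (image φ S)) →
              length (filter P? (subsets m₂)) ℕ.≤ length (filter Q? (subsets m₁))
    count-≤ P? Q? P⇒Q = length-≤ (Unique.filter⁺ P? (subsets-unique m₂)) (image φ) (image-injective φ φ-injective)
      λ {S} S∈ → ∈-filter⁺ Q? (subsets-complete (image φ S)) (P⇒Q (proj₂ (∈-filter⁻ P? {xs = subsets m₂} S∈)))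

    independentCount-≤ : ∀ i → Matroid.independentCount indep₂? i ℕ.≤ Matroid.independentCount indep₁? i
    independentCount-≤ i = count-≤ (λ S → indep₂? S ×-dec (∣ S ∣ ℕ.≟ i)) (λ S → indep₁? S ×-dec (∣ S ∣ ℕ.≟ i))
      λ {S} (S-ind , eq) → image-indep S-ind , ≡.trans (∣image∣ φ φ-injective S) eq

    hit? : Decidable (λ e → ∃ λ f → φ f ≡ e)
    hit? e = any? λ f → φ f Fin.≟ e

    -- The elements outside the image of φ come last, so that broken circuits inside the image
    -- come from circuits inside the image.
    order : Fin m₁ → ℕ
    order e with hit? e
    ... | yes (f , _) = toℕ f
    ... | no _        = m₂ ℕ.+ toℕ e

    order-hit : ∀ f → order (φ f) ≡ toℕ f
    order-hit f with hit? (φ f)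
    ... | yes (g , eq) = ≡.cong toℕ (φ-injective eq)
    ... | no ¬hit      = contradiction (f , ≡.refl) ¬hit

    order-miss : ∀ {e} → ¬ (∃ λ f → φ f ≡ e) → ∀ f → ¬ (order e ℕ.< order (φ f))
    order-miss {e} ¬hit f rewrite order-hit f with hit? e
    ... | yes hit = contradiction hit ¬hit
    ... | no _    = ℕ.≤⇒≯ (ℕ.≤-trans (ℕ.<⇒≤ (Fin.toℕ<n f)) (ℕ.m≤m+n m₂ (toℕ e)))

    order-injective : Injective _≡_ _≡_ order
    order-injective {e} {e′} eq with hit? e | hit? e′
    ... | yes (f , ≡.refl) | yes (g , ≡.refl) = ≡.cong φ (Fin.toℕ-injective eq)
    ... | yes (f , _) | no _        = contradiction (ℕ.≤-trans (Fin.toℕ<n f) (ℕ.m≤m+n m₂ (toℕ e′))) (ℕ.<-irrefl eq)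
    ... | no _        | yes (g , _) = contradiction (ℕ.≤-trans (Fin.toℕ<n g) (ℕ.m≤m+n m₂ (toℕ e))) (ℕ.<-irrefl (≡.sym eq))
    ... | no _        | no _        = Fin.toℕ-injective (ℕ.+-cancelˡ-≡ m₂ (toℕ e) (toℕ e′) eq)

    private
      module B₁ = BrokenCircuits indep₁? isMatroid₁ loopless₁ order order-injective
      module B₂ = BrokenCircuits indep₂? isMatroid₂ loopless₂ toℕ Fin.toℕ-injective
      open IsMatroid isMatroid₁ using (hereditary)

    -- On the image, `order` is the order of the preimages, so for e = φ f the elements above e come
    -- from elements above f, and independence is carried over by φ. For e outside the image, no
    -- element of `image φ S` is above e, and only the singleton of e remains.
    image-nbc : ∀ {S} → B₂.NBC S → B₁.NBC (image φ S)
    image-nbc {S} S-nbc e = [ hit , miss ]′ (Dec.toSum (hit? e))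
      where
      hit : (∃ λ f → φ f ≡ e) → Indep₁ (B₁.above e (image φ S) ∪ ⁅ e ⁆)
      hit (f , ≡.refl) =
        hereditary (∪-least above⊆ (⁅⁆⊆ (∈-image⁺ φ (∈-∪⁅⁆ (B₂.above f S) f)))) (image-indep (S-nbc f))
        where
        above⊆ : B₁.above (φ f) (image φ S) ⊆ image φ (B₂.above f S ∪ ⁅ f ⁆)
        above⊆ g∈ with ∈-comprehension⁻ (B₁.above? (φ f) (image φ S)) g∈
        ... | g∈image , f<g with ∈-image⁻ φ {S} g∈image
        ...   | g , g∈S , ≡.refl = ∈-image⁺ φ (p⊆p∪q ⁅ f ⁆ (∈-comprehension⁺ (B₂.above? f S)
                (g∈S , ≡.subst₂ ℕ._<_ (order-hit f) (order-hit g) f<g)))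
      miss : ¬ (∃ λ f → φ f ≡ e) → Indep₁ (B₁.above e (image φ S) ∪ ⁅ e ⁆)
      miss ¬hit = hereditary (∪-least nothing-above id) (loopless₁ e)
        where
        nothing-above : B₁.above e (image φ S) ⊆ ⁅ e ⁆
        nothing-above g∈ with ∈-comprehension⁻ (B₁.above? e (image φ S)) g∈
        ... | g∈image , e<g with ∈-image⁻ φ {S} g∈image
        ...   | g , g∈S , ≡.refl = contradiction e<g (order-miss ¬hit g)

    -- `abs-whitney` holds for every injective order, so the source may be ordered by `toℕ` and the
    -- target by `order`.
    whitney-≤ : ∀ i → abs (Matroid.whitney indep₂? i) ℕ.≤ abs (Matroid.whitney indep₁? i)
    whitney-≤ i = ≡.subst₂ ℕ._≤_ (≡.sym (B₂.abs-whitney i)) (≡.sym (B₁.abs-whitney i))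
      (count-≤ (λ S → B₂.nbc? S ×-dec (∣ S ∣ ℕ.≟ i)) (λ S → B₁.nbc? S ×-dec (∣ S ∣ ℕ.≟ i))
        λ {S} (S-nbc , eq) → image-nbc S-nbc , ≡.trans (∣image∣ φ φ-injective S) eq)

open Combinatorics
open import Relation.Unary using (Pred; Decidable; _∈_; _∉_; _⊆_; _∩_; _≐_)

-- Kernels, spans and linear independence.

module LinearAlgebra {a} (ℝ : CompleteOrderedField a) where

  open CompleteOrderedField ℝ hiding (zero)
  open Arrangements ℝ
  open import Algebra.Properties.Ring ring
    using (-‿distribˡ-*)
  open import Algebra.Properties.Semiring.Sum semiring
  open import Relation.Binary.Reasoning.Setoid setoid
  open VecEq setoid using (_≋_)
  open SemiringSolver commutativeSemiring using (solve; _:=_; _:+_; _:*_)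

  *-≉0 : ∀ {x y} → x ≉ 0# → y ≉ 0# → x * y ≉ 0#
  *-≉0 x≉0 y≉0 xy≈0 = y≉0 (cancel x≉0 xy≈0)

  *-cancel-+ : ∀ x y → x * y + - x * y ≈ 0#
  *-cancel-+ x y = trans (+-congˡ (sym (-‿distribˡ-* x y))) (-‿inverseʳ (x * y))

  ·-congˡ : ∀ {n} {u v : Vector Carrier n} x → u ≋ v → u · x ≈ v · x
  ·-congˡ x u≋v = sum-cong-≋ λ j → *-congʳ (u≋v j)

  unit-· : ∀ {q} (j : Fin q) c → unit j · c ≈ c j
  unit-· zero    c = trans (+-cong (*-identityˡ _) (0· (c ∘ suc) λ _ → refl)) (+-identityʳ _)
  unit-· (suc j) c = trans (+-cong (zeroˡ _) (unit-· j (c ∘ suc))) (+-identityˡ _)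

  unit-diagonal : ∀ {q} (j : Fin q) → unit j j ≈ 1#
  unit-diagonal zero    = refl
  unit-diagonal (suc j) = unit-diagonal j

  unit-off : ∀ {q} {i j : Fin q} → i ≢ j → unit j i ≈ 0#
  unit-off {i = zero}  {zero}  i≢j = contradiction ≡.refl i≢j
  unit-off {i = zero}  {suc j} i≢j = refl
  unit-off {i = suc i} {zero}  i≢j = refl
  unit-off {i = suc i} {suc j} i≢j = unit-off (i≢j ∘ ≡.cong suc)

  combination-cong : ∀ {d n} {c c′ : Vector Carrier d} (v : Vector (Vector Carrier n) d) →
                     c ≋ c′ → combination c v ≋ combination c′ v
  combination-cong v c≋c′ j = ·-congˡ _ c≋c′

  combination-congʳ : ∀ {d n} (c : Vector Carrier d) {v v′ : Vector (Vector Carrier n) d} →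
                      (∀ i → v i ≋ v′ i) → combination c v ≋ combination c v′
  combination-congʳ c v≋v′ j = ·-congʳ c λ i → v≋v′ i j

  combination-unit : ∀ {d n} i (v : Vector (Vector Carrier n) d) → combination (unit i) v ≋ v i
  combination-unit i v j = unit-· i λ l → v l j

  combination-linear : ∀ {d n} p q (b c : Vector Carrier d) (v : Vector (Vector Carrier n) d) j →
    combination (λ i → p * b i + q * c i) v j ≈ p * combination b v j + q * combination c v j
  combination-linear p q b c v j = ·-linearˡ p q b c λ i → v i j

  combination-assoc : ∀ {d e n} (c : Vector Carrier d) (B : Vector (Vector Carrier e) d)
                      (v : Vector (Vector Carrier n) e) →
                      combination c (λ i → combination (B i) v) ≋ combination (combination c B) v
  combination-assoc c B v j = trans
    (·-congʳ c λ i → ·-comm (B i) (λ l → v l j))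
    (·-combination c (λ l → v l j) (λ l i → B i l))

  ++-suc : ∀ {A : Set a} {m n} (u : Vector A (suc m)) (v : Vector A n) i →
           (u Vector.++ v) (suc i) ≡ ((u ∘ suc) Vector.++ v) i
  ++-suc {m = m} u v i with splitAt m i
  ... | inj₁ _ = ≡.refl
  ... | inj₂ _ = ≡.refl

  sum-++ : ∀ {m n} (u : Vector Carrier m) (v : Vector Carrier n) →
           sum (u Vector.++ v) ≈ sum u + sum v
  sum-++ {zero}  u v = sym (+-identityˡ _)
  sum-++ {suc m} u v = begin
    u zero + sum (λ i → (u Vector.++ v) (suc i))   ≈⟨ +-congˡ (sum-cong-≋ λ i → reflexive (++-suc u v i)) ⟩
    u zero + sum ((u ∘ suc) Vector.++ v)           ≈⟨ +-congˡ (sum-++ (u ∘ suc) v) ⟩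
    u zero + (sum (u ∘ suc) + sum v)               ≈⟨ +-assoc _ _ _ ⟨
    sum u + sum v                                  ∎

  combination-++ : ∀ {d e n} (b : Vector Carrier d) (c : Vector Carrier e)
                   (u : Vector (Vector Carrier n) d) (v : Vector (Vector Carrier n) e) j →
                   combination (b Vector.++ c) (u Vector.++ v) j ≈
                   combination b u j + combination c v j
  combination-++ {d} b c u v j = trans (sum-cong-≋ λ i → reflexive (pointwise i))
    (sum-++ (λ i → b i * u i j) (λ i → c i * v i j))
    where
    pointwise : ∀ i → (b Vector.++ c) i * (u Vector.++ v) i j ≡
                      ((λ i → b i * u i j) Vector.++ (λ i → c i * v i j)) i
    pointwise i with splitAt d i
    ... | inj₁ _ = ≡.refl
    ... | inj₂ _ = ≡.refl

  combination-split : ∀ {d e n} (c : Vector Carrier (d ℕ.+ e))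
                      (u : Vector (Vector Carrier n) d) (v : Vector (Vector Carrier n) e) j →
                      combination c (u Vector.++ v) j ≈
                      combination (c ∘ (_↑ˡ e)) u j + combination (c ∘ (d ↑ʳ_)) v j
  combination-split {d} {e} c u v j =
    trans (combination-cong (u Vector.++ v) pointwise j)
          (combination-++ (c ∘ (_↑ˡ e)) (c ∘ (d ↑ʳ_)) u v j)
    where
    pointwise : ∀ i → c i ≈ ((c ∘ (_↑ˡ e)) Vector.++ (c ∘ (d ↑ʳ_))) i
    pointwise i with splitAt d i in eq
    ... | inj₁ l = reflexive (≡.cong c (≡.sym (Fin.splitAt⁻¹-↑ˡ eq)))
    ... | inj₂ l = reflexive (≡.cong c (≡.sym (Fin.splitAt⁻¹-↑ʳ eq)))

  -- Gaussian elimination on the first column: a pivot row removes itself and one variable, and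
  -- without a pivot the first unit vector lies in the kernel. A trivial kernel has used one row per
  -- variable, hence the bound, which is the source of the dimension counts in `independent⇒≤` and
  -- `nontrivialKernel`.
  kernelAlternative : ∀ {r n} (M : Vector (Vector Carrier n) r) →
    (n ℕ.≤ r × (∀ x → (∀ i → x ∈ kernel (M i)) → x ≋ 0ᵛ)) ⊎
    (∃ λ x → (∃ λ j → x j ≉ 0#) × (∀ i → x ∈ kernel (M i)))
  kernelAlternative {n = zero}  M = inj₁ (z≤n , λ _ _ ())
  kernelAlternative {n = suc n} M with any? (λ i → ¬? (M i zero ≟ 0#))
  ... | no none = inj₂ (unit zero , (zero , 1≉0) , λ i → begin
    M i · unit zero  ≈⟨ ·-comm (M i) (unit zero) ⟩
    unit zero · M i  ≈⟨ unit-· zero (M i) ⟩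
    M i zero         ≈⟨ Dec.decidable-stable (M i zero ≟ 0#) (λ ≉0 → none (i , ≉0)) ⟩
    0#               ∎)
  kernelAlternative {suc r} {suc n} M | yes (i , p≉0)
    with kernelAlternative (λ l → eliminate (M i) (M (punchIn i l)))
  ... | inj₁ (n≤r , trivial) = inj₁ (s≤s n≤r , λ x Mx≈0 →
    let tail≈0 = trivial (x ∘ suc) λ l → trans (eliminate-restrict (M i) (M (punchIn i l)) x)
          (trans (+-cong (trans (*-congˡ (Mx≈0 (punchIn i l))) (zeroʳ _))
                         (trans (*-congˡ (Mx≈0 i)) (zeroʳ _)))
                 (+-identityʳ _))
    in λ { zero    → cancel p≉0 (begin
             M i zero * x zero                                  ≈⟨ +-identityʳ _ ⟨
             M i zero * x zero + 0#                             ≈⟨ +-congˡ (·0 (M i ∘ suc) tail≈0) ⟨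
             M i · x                                            ≈⟨ Mx≈0 i ⟩
             0#                                                 ∎)
         ; (suc j) → tail≈0 j })
  ... | inj₂ (y , (j , yⱼ≉0) , My≈0) =
    inj₂ (extend (M i) y , (suc j , *-≉0 p≉0 yⱼ≉0) , λ l → trans (eliminate-extend (M i) (M l) y) (row l))
    where
    -- The recursive solution y solves the eliminated rows other than the pivot; eliminating the
    -- pivot row from itself leaves the zero form.
    row : ∀ l → eliminate (M i) (M l) · y ≈ 0#
    row l with i Fin.≟ l
    ... | yes ≡.refl = 0· y λ j → *-cancel-+ (M i zero) (M i (suc j))
    ... | no  i≢l    = ≡.subst (λ l → eliminate (M i) (M l) · y ≈ 0#) (Fin.punchIn-punchOut i≢l) (My≈0 (punchOut i≢l))

  nontrivialKernel : ∀ {r n} → r ℕ.< n → (M : Vector (Vector Carrier n) r) →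
                     ∃ λ x → (∃ λ j → x j ≉ 0#) × (∀ i → x ∈ kernel (M i))
  nontrivialKernel r<n M with kernelAlternative M
  ... | inj₁ (n≤r , _) = contradiction n≤r (ℕ.<⇒≱ r<n)
  ... | inj₂ solution  = solution

  transpose : ∀ {A : Set a} {m n} → Vector (Vector A n) m → Vector (Vector A m) n
  transpose v j i = v i j

  combination-transpose : ∀ {d n} (c : Vector Carrier d) (v : Vector (Vector Carrier n) d) j →
                          combination c v j ≈ transpose v j · c
  combination-transpose c v j = ·-comm c (transpose v j)

  -- The coefficients of a linear relation among the v form a kernel vector of the transposed
  -- matrix.
  independenceAlternative : ∀ {d n} (v : Vector (Vector Carrier n) d) →
    (d ℕ.≤ n × LinearlyIndependent v) ⊎
    (∃ λ c → (∃ λ i → c i ≉ 0#) × combination c v ≋ 0ᵛ)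
  independenceAlternative v with kernelAlternative (transpose v)
  ... | inj₁ (d≤n , trivial)   = inj₁ (d≤n , λ c cv≋0 → trivial c λ j →
    trans (sym (combination-transpose c v j)) (cv≋0 j))
  ... | inj₂ (c , c≉0 , vc≈0) = inj₂ (c , c≉0 , λ j →
    trans (combination-transpose c v j) (vc≈0 j))

  independent⇒≤ : ∀ {d n} {v : Vector (Vector Carrier n) d} → LinearlyIndependent v → d ℕ.≤ n
  independent⇒≤ {v = v} ind with independenceAlternative v
  ... | inj₁ (d≤n , _)             = d≤n
  ... | inj₂ (c , (i , cᵢ≉0) , cv≋0) = contradiction (ind c cv≋0 i) cᵢ≉0

  linearlyIndependent? : ∀ {d n} (v : Vector (Vector Carrier n) d) → Dec (LinearlyIndependent v)
  linearlyIndependent? v with independenceAlternative v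
  ... | inj₁ (_ , ind)             = yes ind
  ... | inj₂ (c , (i , cᵢ≉0) , cv≋0) = no λ ind → cᵢ≉0 (ind c cv≋0 i)

  Span : ∀ {d n} → Vector (Vector Carrier n) d → Pred (Vector Carrier n) a
  Span v x = ∃ λ c → x ≋ combination c v

  independent-cong : ∀ {d n} {v w : Vector (Vector Carrier n) d} → (∀ i → v i ≋ w i) →
                     LinearlyIndependent v → LinearlyIndependent w
  independent-cong v≋w ind c cw≋0 = ind c λ j → trans (combination-congʳ c v≋w j) (cw≋0 j)

  independent-tail : ∀ {d n} {v : Vector (Vector Carrier n) (suc d)} →
                     LinearlyIndependent v → LinearlyIndependent (v ∘ suc)
  independent-tail ind c cv≋0 i =
    ind (0# Vector.∷ c) (λ j → trans (+-cong (zeroˡ _) (cv≋0 j)) (+-identityʳ _)) (suc i)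

  module _ {d n} {v : Vector (Vector Carrier n) d} (ind : LinearlyIndependent v) where

    -- A relation whose coefficient at x vanishes would be a relation among the v. Otherwise it can
    -- be solved for x by means of the inverse q of that coefficient.
    span⊎independent : ∀ x → x ∈ Span v ⊎ LinearlyIndependent (x Vector.∷ v)
    span⊎independent x with independenceAlternative (x Vector.∷ v)
    ... | inj₁ (_ , ind′)         = inj₂ ind′
    ... | inj₂ (c , (i , cᵢ≉0) , c≋0) with c zero ≟ 0#
    ...   | yes c₀≈0 = contradiction (tail i) λ c≈0 → cᵢ≉0 (c≈0 c₀≈0)
      where
      tail≋0 : c ∘ suc ≋ 0ᵛ
      tail≋0 = ind (c ∘ suc) λ j → begin
        combination (c ∘ suc) v j                  ≈⟨ +-identityˡ _ ⟨
        0# + combination (c ∘ suc) v j             ≈⟨ +-congʳ (trans (*-congʳ c₀≈0) (zeroˡ _)) ⟨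
        combination c (x Vector.∷ v) j             ≈⟨ c≋0 j ⟩
        0#                                         ∎
      tail : ∀ i → c zero ≈ 0# → c i ≈ 0#
      tail zero    c₀≈0 = c₀≈0
      tail (suc i) _    = tail≋0 i
    ...   | no c₀≉0 with inverse (c zero) c₀≉0
    ...     | q , c₀q≈1 = inj₁ ((λ i → - q * c (suc i)) , λ j → begin
      x j
        ≈⟨ *-identityˡ _ ⟨
      1# * x j
        ≈⟨ *-congʳ c₀q≈1 ⟨
      c zero * q * x j
        ≈⟨ trans (+-congˡ (*-cancel-+ q _)) (+-identityʳ _) ⟨
      c zero * q * x j + (q * combination (c ∘ suc) v j + - q * combination (c ∘ suc) v j)
        ≈⟨ solve 5 (λ c₀ q x t m → c₀ :* q :* x :+ (q :* t :+ m :* t) := q :* (c₀ :* x :+ t) :+ m :* t)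
             refl (c zero) q (x j) (combination (c ∘ suc) v j) (- q) ⟩
      q * combination c (x Vector.∷ v) j + - q * combination (c ∘ suc) v j
        ≈⟨ +-congʳ (trans (*-congˡ (c≋0 j)) (zeroʳ _)) ⟩
      0# + - q * combination (c ∘ suc) v j
        ≈⟨ +-identityˡ _ ⟩
      - q * combination (c ∘ suc) v j
        ≈⟨ *-distribˡ-sum (- q) (λ i → c (suc i) * v i j) ⟩
      sum (λ i → - q * (c (suc i) * v i j))
        ≈⟨ sum-cong-≋ (λ i → sym (*-assoc (- q) (c (suc i)) (v i j))) ⟩
      combination (λ i → - q * c (suc i)) v j
        ∎)

    basis-spans : n ℕ.≤ d → ∀ x → x ∈ Span v
    basis-spans n≤d x with span⊎independent x
    ... | inj₁ x∈  = x∈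
    ... | inj₂ ind′ = contradiction (ℕ.≤-trans (independent⇒≤ {v = x Vector.∷ v} ind′) n≤d) ℕ.1+n≰n

    -- A relation among the chosen members becomes one among all v by placing the coefficients at
    -- the positions h i; since h is injective, no two of them are merged.
    subfamily : ∀ {e} (h : Fin e → Fin d) → Injective _≡_ _≡_ h → LinearlyIndependent (v ∘ h)
    subfamily h h-inj c cvh≋0 i =
      trans (sym (value i)) (ind (combination c (unit ∘ h)) (λ j → begin
        combination (combination c (unit ∘ h)) v j
          ≈⟨ combination-assoc c (unit ∘ h) v j ⟨
        combination c (λ i → combination (unit (h i)) v) j
          ≈⟨ combination-congʳ c (λ i → combination-unit (h i) v) j ⟩
        combination c (v ∘ h) j
          ≈⟨ cvh≋0 j ⟩
        0#                                            ∎) (h i))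
      where
      unit-injective : ∀ {e m} (h : Fin e → Fin m) → Injective _≡_ _≡_ h → ∀ i l → unit (h l) (h i) ≈ unit l i
      unit-injective h h-inj i l with i Fin.≟ l
      ... | yes ≡.refl = trans (unit-diagonal (h i)) (sym (unit-diagonal i))
      ... | no i≢l     = trans (unit-off (i≢l ∘ h-inj)) (sym (unit-off i≢l))
      value : ∀ i → combination c (unit ∘ h) (h i) ≈ c i
      value i = trans (sum-cong-≋ λ l → *-congˡ (unit-injective h h-inj i l)) (·-unit c i)

  orthogonal-spanning : ∀ {d n} {v : Vector (Vector Carrier n) d} → (∀ x → x ∈ Span v) →
                        ∀ y → (∀ i → v i · y ≈ 0#) → y ≋ 0ᵛ
  orthogonal-spanning {v = v} spans y vy≈0 j with spans (unit j)
  ... | c , unit≋ = begin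
    y j                    ≈⟨ unit-· j y ⟨
    unit j · y             ≈⟨ ·-congˡ y unit≋ ⟩
    combination c v · y    ≈⟨ ·-comm _ y ⟩
    y · combination c v    ≈⟨ ·-combination y c v ⟩
    (λ i → y · v i) · c    ≈⟨ 0· c (λ i → trans (·-comm y (v i)) (vy≈0 i)) ⟩
    0#                     ∎

  -- Coefficients that annihilate the columns form a vector orthogonal to all rows; d independent
  -- rows span, so this vector is zero.
  independent-transpose : ∀ {d} {v : Vector (Vector Carrier d) d} →
                          LinearlyIndependent v → LinearlyIndependent (transpose v)
  independent-transpose {v = v} ind c cvᵗ≋0 =
    orthogonal-spanning (basis-spans ind ℕ.≤-refl) c λ i →
      trans (·-comm (v i) c) (cvᵗ≋0 i)

-- The exterior algebra and its relation to minors.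

remove : ∀ {n} (S : Subset n) → Fin ∣ S ∣ → Subset n
remove (inside  ∷ S) zero    = outside ∷ S
remove (inside  ∷ S) (suc j) = inside ∷ remove S j
remove (outside ∷ S) j       = outside ∷ remove S j

∣remove∣ : ∀ {n} (S : Subset n) j → suc ∣ remove S j ∣ ≡ ∣ S ∣
∣remove∣ (inside  ∷ S) zero    = ≡.refl
∣remove∣ (inside  ∷ S) (suc j) = ≡.cong suc (∣remove∣ S j)
∣remove∣ (outside ∷ S) j       = ∣remove∣ S j

-- Deleting the j-th element acts on the enumeration as `punchIn`, as deleting a column does in
-- `det`. The index j′ is kept apart from j because their types `Fin (suc d)` and `Fin ∣ S ∣` agree
-- only up to a proof.
elements-remove : ∀ {n d} (S : Subset n) j (eq : d ≡ ∣ remove S j ∣) (eq′ : suc d ≡ ∣ S ∣) j′ →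
                  cast eq′ j′ ≡ j → ∀ c →
                  elements (remove S j) (cast eq c) ≡ elements S (cast eq′ (punchIn j′ c))
elements-remove (inside  ∷ S) zero    eq eq′ zero ≡.refl c = ≡.refl
elements-remove (inside  ∷ S) (suc j) eq eq′ (suc j′) p zero    = ≡.refl
elements-remove {d = suc d} (inside  ∷ S) (suc j) eq eq′ (suc j′) p (suc c) =
  ≡.cong suc (elements-remove S j (ℕ.suc-injective eq) (ℕ.suc-injective eq′) j′ (Fin.suc-injective p) c)
elements-remove (outside ∷ S) j eq eq′ j′ p c = ≡.cong suc (elements-remove S j eq eq′ j′ p c)

module Exterior {a} (ℝ : CompleteOrderedField a) where

  open CompleteOrderedField ℝ hiding (zero)
  open Arrangements ℝ hiding (w)
  open LinearAlgebra ℝ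
  open import Algebra.Properties.Ring ring
    using (-1*x≈-x; -‿involutive)
  open import Algebra.Properties.Semiring.Exp semiring using (_^_)
  open import Algebra.Properties.Semiring.Sum semiring
  open import Relation.Binary.Reasoning.Setoid setoid
  open VecEq setoid using (_≋_)
  open SemiringSolver commutativeSemiring using (solve; _:=_; _:+_; _:*_)

  -- The exterior algebra of K^n in coordinates: ω S is the coefficient of the
  -- product of the basis vectors e_j, j ∈ S, in increasing order.
  Λ : ℕ → Set a
  Λ n = Subset n → Carrier

  infix 4 _≈Λ_
  _≈Λ_ : ∀ {n} → Λ n → Λ n → Set a
  ω ≈Λ η = ∀ S → ω S ≈ η S

  0Λ : ∀ {n} → Λ n
  0Λ _ = 0#

  1Λ : ∀ {n} → Λ n
  1Λ []            = 1#
  1Λ (inside  ∷ S) = 0#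
  1Λ (outside ∷ S) = 1Λ S

  -- The main involution: moving a vector from one side of ω to the other turns ω into `grade ω`.
  grade : ∀ {n} → Λ n → Λ n
  grade ω S = (- 1#) ^ ∣ S ∣ * ω S

  -- (a + e b) ∧ (c + e d) = a ∧ c + e (b ∧ c + grade a ∧ d) for the first basis vector e.
  infixr 7 _∧_
  _∧_ : ∀ {n} → Λ n → Λ n → Λ n
  (ω ∧ η) []            = ω [] * η []
  (ω ∧ η) (outside ∷ S) = ((ω ∘ (outside ∷_)) ∧ (η ∘ (outside ∷_))) S
  (ω ∧ η) (inside  ∷ S) = ((ω ∘ (inside ∷_)) ∧ (η ∘ (outside ∷_))) S +
                          (grade (ω ∘ (outside ∷_)) ∧ (η ∘ (inside ∷_))) S

  -- The factor `1Λ S` tests that no further element follows, so only singletons get a coefficient.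
  vec : ∀ {n} → Vector Carrier n → Λ n
  vec u []            = 0#
  vec u (inside  ∷ S) = u zero * 1Λ S
  vec u (outside ∷ S) = vec (u ∘ suc) S

  ⋀ : ∀ {d n} → Vector (Vector Carrier n) d → Λ n
  ⋀ {zero}  v = 1Λ
  ⋀ {suc d} v = vec (v zero) ∧ ⋀ (v ∘ suc)

  ∧-cong : ∀ {n} {ω ω′ η η′ : Λ n} → ω ≈Λ ω′ → η ≈Λ η′ → ω ∧ η ≈Λ ω′ ∧ η′
  ∧-cong p q []            = *-cong (p []) (q [])
  ∧-cong p q (outside ∷ S) = ∧-cong (p ∘ (outside ∷_)) (q ∘ (outside ∷_)) S
  ∧-cong p q (inside  ∷ S) =
    +-cong (∧-cong (p ∘ (inside ∷_)) (q ∘ (outside ∷_)) S)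
           (∧-cong (λ T → *-congˡ (p (outside ∷ T))) (q ∘ (inside ∷_)) S)

  ∧-congˡ : ∀ {n} {ω ω′ : Λ n} η → ω ≈Λ ω′ → ω ∧ η ≈Λ ω′ ∧ η
  ∧-congˡ η p = ∧-cong p λ _ → refl

  ∧-congʳ : ∀ {n} (ω : Λ n) {η η′ : Λ n} → η ≈Λ η′ → ω ∧ η ≈Λ ω ∧ η′
  ∧-congʳ ω = ∧-cong λ _ → refl

  private
    medial : ∀ p q x y z w → (p * x + q * y) + (p * z + q * w) ≈ p * (x + z) + q * (y + w)
    medial = solve 6 (λ p q x y z w → (p :* x :+ q :* y) :+ (p :* z :+ q :* w) :=
                                      p :* (x :+ z) :+ q :* (y :+ w)) refl

    scale-swap : ∀ s p q x y → s * (p * x + q * y) ≈ p * (s * x) + q * (s * y)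
    scale-swap = solve 5 (λ s p q x y → s :* (p :* x :+ q :* y) :=
                                        p :* (s :* x) :+ q :* (s :* y)) refl

  ∧-linearˡ : ∀ {n} p q (ω ω′ η : Λ n) →
              (λ S → p * ω S + q * ω′ S) ∧ η ≈Λ λ S → p * (ω ∧ η) S + q * (ω′ ∧ η) S
  ∧-linearˡ p q ω ω′ η [] =
    solve 5 (λ p q x y z → (p :* x :+ q :* y) :* z := p :* (x :* z) :+ q :* (y :* z))
      refl p q (ω []) (ω′ []) (η [])
  ∧-linearˡ p q ω ω′ η (outside ∷ S) = ∧-linearˡ p q _ _ _ S
  ∧-linearˡ p q ω ω′ η (inside ∷ S) = trans
    (+-cong (∧-linearˡ p q (ω ∘ (inside ∷_)) (ω′ ∘ (inside ∷_)) _ S)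
            (trans (∧-congˡ (η ∘ (inside ∷_)) (λ T → scale-swap _ p q (ω (outside ∷ T)) (ω′ (outside ∷ T))) S)
                   (∧-linearˡ p q (grade (ω ∘ (outside ∷_))) (grade (ω′ ∘ (outside ∷_))) _ S)))
    (medial p q _ _ _ _)

  ∧-linearʳ : ∀ {n} p q (ω η η′ : Λ n) →
              ω ∧ (λ S → p * η S + q * η′ S) ≈Λ λ S → p * (ω ∧ η) S + q * (ω ∧ η′) S
  ∧-linearʳ p q ω η η′ []            = scale-swap (ω []) p q (η []) (η′ [])
  ∧-linearʳ p q ω η η′ (outside ∷ S) = ∧-linearʳ p q _ _ _ S
  ∧-linearʳ p q ω η η′ (inside ∷ S)  = trans
    (+-cong (∧-linearʳ p q (ω ∘ (inside ∷_)) (η ∘ (outside ∷_)) (η′ ∘ (outside ∷_)) S)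
            (∧-linearʳ p q (grade (ω ∘ (outside ∷_))) (η ∘ (inside ∷_)) (η′ ∘ (inside ∷_)) S))
    (medial p q _ _ _ _)

  private
    *1+*0 : ∀ p x y → p * x + 0# * y ≈ p * x
    *1+*0 p x y = trans (+-congˡ (zeroˡ y)) (+-identityʳ _)

    1*+1* : ∀ x y → 1# * x + 1# * y ≈ x + y
    1*+1* x y = +-cong (*-identityˡ x) (*-identityˡ y)

  ∧-scaleˡ : ∀ {n} p (ω η : Λ n) → (λ S → p * ω S) ∧ η ≈Λ λ S → p * (ω ∧ η) S
  ∧-scaleˡ p ω η S = trans (∧-congˡ η (λ T → sym (*1+*0 p (ω T) (ω T))) S)
    (trans (∧-linearˡ p 0# ω ω η S) (*1+*0 p _ _))

  ∧-scaleʳ : ∀ {n} p (ω η : Λ n) → ω ∧ (λ S → p * η S) ≈Λ λ S → p * (ω ∧ η) S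
  ∧-scaleʳ p ω η S = trans (∧-congʳ ω (λ T → sym (*1+*0 p (η T) (η T))) S)
    (trans (∧-linearʳ p 0# ω η η S) (*1+*0 p _ _))

  ∧-distribʳ : ∀ {n} (ω ω′ η : Λ n) → (λ S → ω S + ω′ S) ∧ η ≈Λ λ S → (ω ∧ η) S + (ω′ ∧ η) S
  ∧-distribʳ ω ω′ η S = trans (∧-congˡ η (λ T → sym (1*+1* (ω T) (ω′ T))) S)
    (trans (∧-linearˡ 1# 1# ω ω′ η S) (1*+1* _ _))

  ∧-distribˡ : ∀ {n} (ω η η′ : Λ n) → ω ∧ (λ S → η S + η′ S) ≈Λ λ S → (ω ∧ η) S + (ω ∧ η′) S
  ∧-distribˡ ω η η′ S = trans (∧-congʳ ω (λ T → sym (1*+1* (η T) (η′ T))) S)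
    (trans (∧-linearʳ 1# 1# ω η η′ S) (1*+1* _ _))

  ∧-zeroˡ : ∀ {n} {ω : Λ n} η → ω ≈Λ 0Λ → ω ∧ η ≈Λ 0Λ
  ∧-zeroˡ {ω = ω} η ω≈0 S = trans (∧-congˡ η (λ T → trans (ω≈0 T) (sym (zeroˡ (ω T)))) S)
    (trans (∧-scaleˡ 0# ω η S) (zeroˡ _))

  ∧-zeroʳ : ∀ {n} (ω : Λ n) {η} → η ≈Λ 0Λ → ω ∧ η ≈Λ 0Λ
  ∧-zeroʳ ω {η} η≈0 S = trans (∧-congʳ ω (λ T → trans (η≈0 T) (sym (zeroˡ (η T)))) S)
    (trans (∧-scaleʳ 0# ω η S) (zeroˡ _))

  sign²≈1 : ∀ m → (- 1#) ^ m * (- 1#) ^ m ≈ 1#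
  sign²≈1 zero    = *-identityˡ 1#
  sign²≈1 (suc m) = begin
    - 1# * s * (- 1# * s)     ≈⟨ solve 2 (λ m s → m :* s :* (m :* s) := m :* m :* (s :* s)) refl (- 1#) s ⟩
    - 1# * - 1# * (s * s)     ≈⟨ *-cong (trans (-1*x≈-x (- 1#)) (-‿involutive 1#)) (sign²≈1 m) ⟩
    1# * 1#                   ≈⟨ *-identityˡ 1# ⟩
    1#                        ∎
    where s = (- 1#) ^ m

  grade-involutive : ∀ {n} (ω : Λ n) → grade (grade ω) ≈Λ ω
  grade-involutive ω S = trans (sym (*-assoc _ _ _)) (trans (*-congʳ (sign²≈1 ∣ S ∣)) (*-identityˡ _))

  -- Associativity rests on this: a basis vector passes a product by passing both factors.
  grade-∧ : ∀ {n} (ω η : Λ n) → grade (ω ∧ η) ≈Λ grade ω ∧ grade η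
  grade-∧ ω η [] = trans (*-identityˡ _) (sym (*-cong (*-identityˡ _) (*-identityˡ _)))
  grade-∧ ω η (outside ∷ S) = grade-∧ _ _ S
  grade-∧ {suc n} ω η (inside ∷ S) = begin
    - 1# * s * ((ω₁ ∧ η₀) S + (grade ω₀ ∧ η₁) S)
      ≈⟨ solve 4 (λ m s x y → m :* s :* (x :+ y) := m :* (s :* x) :+ m :* (s :* y))
           refl (- 1#) s ((ω₁ ∧ η₀) S) ((grade ω₀ ∧ η₁) S) ⟩
    - 1# * grade (ω₁ ∧ η₀) S + - 1# * grade (grade ω₀ ∧ η₁) S
      ≈⟨ +-cong (*-congˡ (grade-∧ ω₁ η₀ S)) (*-congˡ (grade-∧ (grade ω₀) η₁ S)) ⟩
    - 1# * (grade ω₁ ∧ grade η₀) S + - 1# * (grade (grade ω₀) ∧ grade η₁) S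
      ≈⟨ +-cong (∧-scaleˡ (- 1#) (grade ω₁) (grade η₀) S) (∧-scaleʳ (- 1#) (grade (grade ω₀)) (grade η₁) S) ⟨
    ((λ T → - 1# * grade ω₁ T) ∧ grade η₀) S + (grade (grade ω₀) ∧ λ T → - 1# * grade η₁ T) S
      ≈⟨ +-cong (∧-congˡ (grade η₀) (λ T → sym (*-assoc _ _ _)) S)
                (∧-congʳ (grade (grade ω₀)) (λ T → sym (*-assoc _ _ _)) S) ⟩
    (grade ω ∧ grade η) (inside ∷ S) ∎
    where
    s = (- 1#) ^ ∣ S ∣
    ω₀ ω₁ η₀ η₁ : Λ n
    ω₀ = ω ∘ (outside ∷_)
    ω₁ = ω ∘ (inside ∷_)
    η₀ = η ∘ (outside ∷_)
    η₁ = η ∘ (inside ∷_)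

  ∧-assoc : ∀ {n} (ω η ζ : Λ n) → (ω ∧ η) ∧ ζ ≈Λ ω ∧ η ∧ ζ
  ∧-assoc ω η ζ []            = *-assoc _ _ _
  ∧-assoc ω η ζ (outside ∷ S) = ∧-assoc _ _ _ S
  ∧-assoc {suc n} ω η ζ (inside ∷ S) = begin
    ((λ T → (ω₁ ∧ η₀) T + (grade ω₀ ∧ η₁) T) ∧ ζ₀) S + (grade (ω₀ ∧ η₀) ∧ ζ₁) S
      ≈⟨ +-cong (∧-distribʳ (ω₁ ∧ η₀) (grade ω₀ ∧ η₁) ζ₀ S) (∧-congˡ ζ₁ (grade-∧ ω₀ η₀) S) ⟩
    (((ω₁ ∧ η₀) ∧ ζ₀) S + ((grade ω₀ ∧ η₁) ∧ ζ₀) S) + ((grade ω₀ ∧ grade η₀) ∧ ζ₁) S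
      ≈⟨ +-cong (+-cong (∧-assoc ω₁ η₀ ζ₀ S) (∧-assoc (grade ω₀) η₁ ζ₀ S)) (∧-assoc (grade ω₀) (grade η₀) ζ₁ S) ⟩
    ((ω₁ ∧ η₀ ∧ ζ₀) S + (grade ω₀ ∧ η₁ ∧ ζ₀) S) + (grade ω₀ ∧ grade η₀ ∧ ζ₁) S
      ≈⟨ +-assoc _ _ _ ⟩
    (ω₁ ∧ η₀ ∧ ζ₀) S + ((grade ω₀ ∧ η₁ ∧ ζ₀) S + (grade ω₀ ∧ grade η₀ ∧ ζ₁) S)
      ≈⟨ +-congˡ (∧-distribˡ (grade ω₀) (η₁ ∧ ζ₀) (grade η₀ ∧ ζ₁) S) ⟨
    (ω ∧ η ∧ ζ) (inside ∷ S) ∎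
    where
    ω₀ ω₁ η₀ η₁ ζ₀ ζ₁ : Λ n
    ω₀ = ω ∘ (outside ∷_)
    ω₁ = ω ∘ (inside ∷_)
    η₀ = η ∘ (outside ∷_)
    η₁ = η ∘ (inside ∷_)
    ζ₀ = ζ ∘ (outside ∷_)
    ζ₁ = ζ ∘ (inside ∷_)

  1Λ-grade : ∀ {n} → grade (1Λ {n}) ≈Λ 1Λ
  1Λ-grade []            = *-identityˡ _
  1Λ-grade (outside ∷ S) = 1Λ-grade S
  1Λ-grade (inside  ∷ S) = zeroʳ _

  ∧-identityˡ : ∀ {n} (ω : Λ n) → 1Λ ∧ ω ≈Λ ω
  ∧-identityˡ ω []            = *-identityˡ _
  ∧-identityˡ ω (outside ∷ S) = ∧-identityˡ _ S
  ∧-identityˡ ω (inside  ∷ S) = trans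
    (+-cong (∧-zeroˡ (ω ∘ (outside ∷_)) (λ _ → refl) S)
            (trans (∧-congˡ (ω ∘ (inside ∷_)) 1Λ-grade S) (∧-identityˡ (ω ∘ (inside ∷_)) S)))
    (+-identityˡ _)

  ∧-identityʳ : ∀ {n} (ω : Λ n) → ω ∧ 1Λ ≈Λ ω
  ∧-identityʳ ω []            = *-identityʳ _
  ∧-identityʳ ω (outside ∷ S) = ∧-identityʳ _ S
  ∧-identityʳ ω (inside  ∷ S) = trans
    (+-cong (∧-identityʳ (ω ∘ (inside ∷_)) S)
            (∧-zeroʳ (grade (ω ∘ (outside ∷_))) (λ _ → refl) S))
    (+-identityʳ _)

  vec-cong : ∀ {n} {u v : Vector Carrier n} → u ≋ v → vec u ≈Λ vec v
  vec-cong u≋v []            = refl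
  vec-cong u≋v (outside ∷ S) = vec-cong (u≋v ∘ suc) S
  vec-cong u≋v (inside  ∷ S) = *-congʳ (u≋v zero)

  vec-linear : ∀ {n} p q (u v : Vector Carrier n) →
               vec (λ j → p * u j + q * v j) ≈Λ λ S → p * vec u S + q * vec v S
  vec-linear p q u v []            = sym (trans (+-cong (zeroʳ p) (zeroʳ q)) (+-identityˡ 0#))
  vec-linear p q u v (outside ∷ S) = vec-linear p q (u ∘ suc) (v ∘ suc) S
  vec-linear p q u v (inside  ∷ S) =
    solve 5 (λ p q x y z → (p :* x :+ q :* y) :* z := p :* (x :* z) :+ q :* (y :* z))
      refl p q (u zero) (v zero) (1Λ S)

  vec-0 : ∀ {n} {u : Vector Carrier n} → u ≋ 0ᵛ → vec u ≈Λ 0Λ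
  vec-0 u≋0 []            = refl
  vec-0 u≋0 (outside ∷ S) = vec-0 (u≋0 ∘ suc) S
  vec-0 u≋0 (inside  ∷ S) = trans (*-congʳ (u≋0 zero)) (zeroˡ _)

  vec-grade : ∀ {n} (u : Vector Carrier n) → grade (vec u) ≈Λ λ S → - 1# * vec u S
  vec-grade u []            = trans (zeroʳ _) (sym (zeroʳ _))
  vec-grade u (outside ∷ S) = vec-grade (u ∘ suc) S
  vec-grade u (inside  ∷ S) = begin
    - 1# * s * (u zero * 1Λ S)   ≈⟨ solve 4 (λ m s x y → m :* s :* (x :* y) := m :* (x :* (s :* y))) refl (- 1#) s (u zero) (1Λ S) ⟩
    - 1# * (u zero * (s * 1Λ S)) ≈⟨ *-congˡ (*-congˡ (1Λ-grade S)) ⟩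
    - 1# * (u zero * 1Λ S)       ∎
    where s = (- 1#) ^ ∣ S ∣

  vec-∧-inside : ∀ {n} (u : Vector Carrier (suc n)) η S →
                 (vec u ∧ η) (inside ∷ S) ≈
                 u zero * η (outside ∷ S) + - 1# * (vec (u ∘ suc) ∧ (η ∘ (inside ∷_))) S
  vec-∧-inside u η S = +-cong
    (trans (∧-scaleˡ (u zero) 1Λ _ S) (*-congˡ (∧-identityˡ (η ∘ (outside ∷_)) S)))
    (trans (∧-congˡ (η ∘ (inside ∷_)) (vec-grade (u ∘ suc)) S) (∧-scaleˡ (- 1#) (vec (u ∘ suc)) _ S))

  private
    x+-1*x≈0 : ∀ x → x + - 1# * x ≈ 0#
    x+-1*x≈0 x = trans (+-congˡ (-1*x≈-x x)) (-‿inverseʳ x)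

  vec-∧-vec : ∀ {n} (u : Vector Carrier n) → vec u ∧ vec u ≈Λ 0Λ
  vec-∧-vec u []            = zeroˡ _
  vec-∧-vec u (outside ∷ S) = vec-∧-vec (u ∘ suc) S
  vec-∧-vec u (inside  ∷ S) = begin
    (vec u ∧ vec u) (inside ∷ S)
      ≈⟨ vec-∧-inside u (vec u) S ⟩
    u zero * vec (u ∘ suc) S + - 1# * (vec (u ∘ suc) ∧ (λ T → u zero * 1Λ T)) S
      ≈⟨ +-congˡ (*-congˡ (trans (∧-scaleʳ (u zero) (vec (u ∘ suc)) 1Λ S) (*-congˡ (∧-identityʳ (vec (u ∘ suc)) S)))) ⟩
    u zero * vec (u ∘ suc) S + - 1# * (u zero * vec (u ∘ suc) S)
      ≈⟨ x+-1*x≈0 _ ⟩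
    0# ∎

  -- The sign is expressed by `grade` and not by a power depending on the degree, so ω may have
  -- components of several degrees.
  vec-∧-comm : ∀ {n} (u : Vector Carrier n) ω → vec u ∧ ω ≈Λ grade ω ∧ vec u
  vec-∧-comm u ω []            = trans (zeroˡ _) (sym (zeroʳ _))
  vec-∧-comm u ω (outside ∷ S) = vec-∧-comm (u ∘ suc) (ω ∘ (outside ∷_)) S
  vec-∧-comm {suc n} u ω (inside ∷ S) = begin
    (vec u ∧ ω) (inside ∷ S)
      ≈⟨ vec-∧-inside u ω S ⟩
    u zero * ω₀ S + - 1# * (vec uₜ ∧ ω₁) S
      ≈⟨ +-cong (*-congˡ (sym (grade-involutive ω₀ S))) (*-congˡ (vec-∧-comm uₜ ω₁ S)) ⟩
    u zero * grade (grade ω₀) S + - 1# * (grade ω₁ ∧ vec uₜ) S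
      ≈⟨ +-comm _ _ ⟩
    - 1# * (grade ω₁ ∧ vec uₜ) S + u zero * grade (grade ω₀) S
      ≈⟨ +-cong (trans (∧-congˡ (vec uₜ) (λ T → *-assoc _ _ _) S) (∧-scaleˡ (- 1#) (grade ω₁) (vec uₜ) S))
                (trans (∧-scaleʳ (u zero) (grade (grade ω₀)) 1Λ S) (*-congˡ (∧-identityʳ (grade (grade ω₀)) S))) ⟨
    (grade ω ∧ vec u) (inside ∷ S) ∎
    where
    uₜ = u ∘ suc
    ω₀ ω₁ : Λ n
    ω₀ = ω ∘ (outside ∷_)
    ω₁ = ω ∘ (inside ∷_)

  vec-combination-∧ : ∀ {d n} (c : Vector Carrier d) (v : Vector (Vector Carrier n) d) η S →
                      (vec (combination c v) ∧ η) S ≈ ∑[ i < d ] (c i * (vec (v i) ∧ η) S)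
  vec-combination-∧ {zero}  c v η S = ∧-zeroˡ η (vec-0 λ _ → refl) S
  vec-combination-∧ {suc d} c v η S = begin
    (vec (combination c v) ∧ η) S
      ≈⟨ ∧-congˡ η (λ T → trans (vec-cong (λ j → +-congˡ (sym (*-identityˡ _))) T)
                     (vec-linear (c zero) 1# (v zero) (combination (c ∘ suc) (v ∘ suc)) T)) S ⟩
    ((λ T → c zero * vec (v zero) T + 1# * vec (combination (c ∘ suc) (v ∘ suc)) T) ∧ η) S
      ≈⟨ ∧-linearˡ (c zero) 1# (vec (v zero)) _ η S ⟩
    c zero * (vec (v zero) ∧ η) S + 1# * (vec (combination (c ∘ suc) (v ∘ suc)) ∧ η) S
      ≈⟨ +-congˡ (trans (*-identityˡ _) (vec-combination-∧ (c ∘ suc) (v ∘ suc) η S)) ⟩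
    ∑[ i < suc d ] (c i * (vec (v i) ∧ η) S) ∎

  ⋀-cong : ∀ {d n} {v w : Vector (Vector Carrier n) d} → (∀ i → v i ≋ w i) → ⋀ v ≈Λ ⋀ w
  ⋀-cong {zero}  v≋w S = refl
  ⋀-cong {suc d} v≋w   = ∧-cong (vec-cong (v≋w zero)) (⋀-cong (v≋w ∘ suc))

  ⋀-++ : ∀ {d e n} (u : Vector (Vector Carrier n) d) (v : Vector (Vector Carrier n) e) →
         ⋀ (u Vector.++ v) ≈Λ ⋀ u ∧ ⋀ v
  ⋀-++ {zero}  u v S = sym (∧-identityˡ (⋀ v) S)
  ⋀-++ {suc d} u v S = begin
    (vec (u zero) ∧ ⋀ ((u Vector.++ v) ∘ suc)) S
      ≈⟨ ∧-congʳ (vec (u zero)) (⋀-cong λ i j → reflexive (≡.cong (λ x → x j) (++-suc u v i))) S ⟩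
    (vec (u zero) ∧ ⋀ ((u ∘ suc) Vector.++ v)) S
      ≈⟨ ∧-congʳ (vec (u zero)) (⋀-++ (u ∘ suc) v) S ⟩
    (vec (u zero) ∧ ⋀ (u ∘ suc) ∧ ⋀ v) S
      ≈⟨ ∧-assoc (vec (u zero)) (⋀ (u ∘ suc)) (⋀ v) S ⟨
    (⋀ u ∧ ⋀ v) S ∎

  -- The vector moves past the factors before the i-th one, up to sign, until it meets its own copy.
  vec-∧-⋀ : ∀ {d n} (v : Vector (Vector Carrier n) d) i → vec (v i) ∧ ⋀ v ≈Λ 0Λ
  vec-∧-⋀ v zero S = trans (sym (∧-assoc (vec (v zero)) (vec (v zero)) (⋀ (v ∘ suc)) S))
    (∧-zeroˡ (⋀ (v ∘ suc)) (vec-∧-vec (v zero)) S)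
  vec-∧-⋀ v (suc i) S = begin
    (vec (v (suc i)) ∧ vec (v zero) ∧ η) S          ≈⟨ ∧-assoc (vec (v (suc i))) (vec (v zero)) η S ⟨
    ((vec (v (suc i)) ∧ vec (v zero)) ∧ η) S        ≈⟨ ∧-congˡ η (vec-∧-comm (v (suc i)) (vec (v zero))) S ⟩
    ((grade (vec (v zero)) ∧ vec (v (suc i))) ∧ η) S ≈⟨ ∧-assoc (grade (vec (v zero))) (vec (v (suc i))) η S ⟩
    (grade (vec (v zero)) ∧ vec (v (suc i)) ∧ η) S  ≈⟨ ∧-zeroʳ (grade (vec (v zero))) (vec-∧-⋀ (v ∘ suc) i) S ⟩
    0#                                              ∎
    where η = ⋀ (v ∘ suc)

  NonZero : ∀ {n} → Λ n → Set a
  NonZero ω = ∃ λ S → ω S ≉ 0#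

  nonZero? : ∀ {n} (ω : Λ n) → Dec (NonZero ω)
  nonZero? ω = anySubset? λ S → ¬? (ω S ≟ 0#)

  ¬nonZero⇒≈0 : ∀ {n} (ω : Λ n) → ¬ NonZero ω → ω ≈Λ 0Λ
  ¬nonZero⇒≈0 ω none S = Dec.decidable-stable (ω S ≟ 0#) λ ω≉0 → none (S , ω≉0)

  nonZero-∧ʳ : ∀ {n} (ω η : Λ n) → NonZero (ω ∧ η) → NonZero η
  nonZero-∧ʳ ω η (S , ≉0) = Dec.decidable-stable (nonZero? η) λ none →
    ≉0 (∧-zeroʳ ω (¬nonZero⇒≈0 η none) S)

  nonZero-cong : ∀ {n} {ω η : Λ n} → ω ≈Λ η → NonZero ω → NonZero η
  nonZero-cong ω≈η (S , ≉0) = S , λ ηS≈0 → ≉0 (trans (ω≈η S) ηS≈0)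

  -- Wedging the combination z with all factors of ⋀ v but the first leaves the first coefficient
  -- times ⋀ v.
  independent-modulo : ∀ {d n} (v : Vector (Vector Carrier n) d) ω → NonZero (⋀ v ∧ ω) →
                       ∀ c → vec (combination c v) ∧ ω ≈Λ 0Λ → c ≋ 0ᵛ
  independent-modulo {suc d} v ω (S , ≉0) c z∧ω≈0 = λ { zero → c₀≈0 ; (suc i) → rest i }
    where
    w = v ∘ suc
    z = combination c v
    z∧⋀w∧ω≈0 : vec z ∧ ⋀ w ∧ ω ≈Λ 0Λ
    z∧⋀w∧ω≈0 T = begin
      (vec z ∧ ⋀ w ∧ ω) T           ≈⟨ ∧-assoc (vec z) (⋀ w) ω T ⟨
      ((vec z ∧ ⋀ w) ∧ ω) T         ≈⟨ ∧-congˡ ω (vec-∧-comm z (⋀ w)) T ⟩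
      ((grade (⋀ w) ∧ vec z) ∧ ω) T ≈⟨ ∧-assoc (grade (⋀ w)) (vec z) ω T ⟩
      (grade (⋀ w) ∧ vec z ∧ ω) T   ≈⟨ ∧-zeroʳ (grade (⋀ w)) z∧ω≈0 T ⟩
      0#                            ∎
    c₀≈0 : c zero ≈ 0#
    c₀≈0 = Dec.decidable-stable (c zero ≟ 0#) λ c₀≉0 → *-≉0 c₀≉0 ≉0 (begin
      c zero * ((vec (v zero) ∧ ⋀ w) ∧ ω) S
        ≈⟨ *-congˡ (∧-assoc (vec (v zero)) (⋀ w) ω S) ⟩
      c zero * (vec (v zero) ∧ ⋀ w ∧ ω) S
        ≈⟨ +-identityʳ _ ⟨
      c zero * (vec (v zero) ∧ ⋀ w ∧ ω) S + 0#
        ≈⟨ +-congˡ (·0 (c ∘ suc) λ i → trans (sym (∧-assoc (vec (w i)) (⋀ w) ω S))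
                                        (∧-zeroˡ ω (vec-∧-⋀ w i) S)) ⟨
      ∑[ i < suc d ] (c i * (vec (v i) ∧ ⋀ w ∧ ω) S)
        ≈⟨ vec-combination-∧ c v (⋀ w ∧ ω) S ⟨
      (vec z ∧ ⋀ w ∧ ω) S
        ≈⟨ z∧⋀w∧ω≈0 S ⟩
      0# ∎)
    rest : c ∘ suc ≋ 0ᵛ
    rest = independent-modulo w ω
      (nonZero-∧ʳ (vec (v zero)) (⋀ w ∧ ω) (nonZero-cong (∧-assoc (vec (v zero)) (⋀ w) ω) (S , ≉0)))
      (c ∘ suc)
      (λ T → trans (∧-congˡ ω (vec-cong λ j → sym (trans (+-congʳ (trans (*-congʳ c₀≈0) (zeroˡ _))) (+-identityˡ _))) T)
                   (z∧ω≈0 T))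

  -- The case ω = `1Λ` of `independent-modulo`. With ω = `⋀ u` that lemma expresses independence
  -- modulo the span of u.
  ⋀-nonZero⇒independent : ∀ {d n} (v : Vector (Vector Carrier n) d) → NonZero (⋀ v) → LinearlyIndependent v
  ⋀-nonZero⇒independent v v≉0 c cv≋0 =
    independent-modulo v 1Λ (nonZero-cong (λ S → sym (∧-identityʳ (⋀ v) S)) v≉0) c
      (∧-zeroˡ 1Λ (vec-0 cv≋0))

  span-∧-⋀ : ∀ {d n} (v : Vector (Vector Carrier n) d) {x} → x ∈ Span v → vec x ∧ ⋀ v ≈Λ 0Λ
  span-∧-⋀ v (c , x≋) S = trans (∧-congˡ (⋀ v) (vec-cong x≋) S)
    (trans (vec-combination-∧ c v (⋀ v) S) (·0 c λ i → vec-∧-⋀ v i S))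

  prepend0 : ∀ {d n} → Vector (Vector Carrier n) d → Vector (Vector Carrier (suc n)) d
  prepend0 v i = 0# Vector.∷ v i

  ⋀-prepend0-inside : ∀ {d n} (v : Vector (Vector Carrier n) d) S → ⋀ (prepend0 v) (inside ∷ S) ≈ 0#
  ⋀-prepend0-inside {zero}  v S = refl
  ⋀-prepend0-inside {suc d} v S = begin
    (vec (prepend0 v zero) ∧ ⋀ (prepend0 (v ∘ suc))) (inside ∷ S)
      ≈⟨ vec-∧-inside (prepend0 v zero) (⋀ (prepend0 (v ∘ suc))) S ⟩
    0# * _ + - 1# * (vec (v zero) ∧ (⋀ (prepend0 (v ∘ suc)) ∘ (inside ∷_))) S
      ≈⟨ +-cong (zeroˡ _) (trans (*-congˡ (∧-zeroʳ (vec (v zero)) (⋀-prepend0-inside (v ∘ suc)) S)) (zeroʳ _)) ⟩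
    0# + 0#
      ≈⟨ +-identityˡ 0# ⟩
    0# ∎

  ⋀-prepend0-outside : ∀ {d n} (v : Vector (Vector Carrier n) d) S → ⋀ (prepend0 v) (outside ∷ S) ≈ ⋀ v S
  ⋀-prepend0-outside {zero}  v S = refl
  ⋀-prepend0-outside {suc d} v S = ∧-congʳ (vec (v zero)) (⋀-prepend0-outside (v ∘ suc)) S

  -- Basis completion for a nonzero ω, by induction on the dimension. If the part of ω that contains
  -- the first basis vector e is nonzero, vectors without e complete this part to top degree.
  -- Otherwise ω does not involve e: vectors without e complete its other part, and e itself is put
  -- in front.
  ⋀-complete : ∀ {n} (ω : Λ n) → NonZero ω →
               ∃ λ l → Σ[ y ∈ Vector (Vector Carrier n) l ] (⋀ y ∧ ω) Subset.⊤ ≉ 0#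
  ⋀-complete {zero}  ω ([] , ≉0) = zero , (λ ()) , λ ≈0 → ≉0 (trans (sym (*-identityˡ _)) ≈0)
  -- In the product with ω the vector e has to pass `⋀ y`, which puts a grade on `⋀ y`. Completing
  -- the graded part instead of the part itself allows that sign to be taken off the whole product.
  ⋀-complete {suc n} ω (T , ωT≉0) with nonZero? (grade (ω ∘ (inside ∷_)))
  ... | yes b≉0 with ⋀-complete (grade (ω ∘ (inside ∷_))) b≉0
  ...   | l , y , ≉0 = l , prepend0 y , λ ≈0 → ≉0 (cancel-sign (⋀ y ∧ grade b) Subset.⊤ (begin
    grade (⋀ y ∧ grade b) Subset.⊤
      ≈⟨ grade-∧ (⋀ y) (grade b) Subset.⊤ ⟩
    (grade (⋀ y) ∧ grade (grade b)) Subset.⊤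
      ≈⟨ ∧-cong (λ S → *-congˡ (sym (⋀-prepend0-outside y S))) (grade-involutive b) Subset.⊤ ⟩
    (grade (⋀ (prepend0 y) ∘ (outside ∷_)) ∧ b) Subset.⊤
      ≈⟨ trans (+-congʳ (∧-zeroˡ (ω ∘ (outside ∷_)) (⋀-prepend0-inside y) Subset.⊤)) (+-identityˡ _) ⟨
    (⋀ (prepend0 y) ∧ ω) Subset.⊤
      ≈⟨ ≈0 ⟩
    0# ∎))
    where
    b : Λ n
    b = ω ∘ (inside ∷_)
    cancel-sign : ∀ (ζ : Λ n) S → grade ζ S ≈ 0# → ζ S ≈ 0#
    cancel-sign ζ S gζ≈0 = trans (sym (grade-involutive ζ S)) (trans (*-congˡ gζ≈0) (zeroʳ _))
  ⋀-complete {suc n} ω (T , ωT≉0) | no none with T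
  ...   | inside  ∷ S = contradiction (S , λ gb≈0 → ωT≉0
          (trans (sym (grade-involutive (ω ∘ (inside ∷_)) S)) (trans (*-congˡ gb≈0) (zeroʳ _)))) none
  ...   | outside ∷ S with ⋀-complete (ω ∘ (outside ∷_)) (S , ωT≉0)
  ...     | l , y , ≉0 = suc l , unit zero Vector.∷ prepend0 y , λ ≈0 → ≉0 (begin
    (⋀ y ∧ ω₀) Subset.⊤
      ≈⟨ ∧-congˡ ω₀ (⋀-prepend0-outside y) Subset.⊤ ⟨
    (⋀ (prepend0 y) ∧ ω) (outside ∷ Subset.⊤)
      ≈⟨ trans (+-cong (*-identityˡ _)
           (trans (*-congˡ (∧-zeroˡ ((⋀ (prepend0 y) ∧ ω) ∘ (inside ∷_)) (vec-0 λ _ → refl) Subset.⊤)) (zeroʳ _))) (+-identityʳ _) ⟨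
    1# * (⋀ (prepend0 y) ∧ ω) (outside ∷ Subset.⊤) +
    - 1# * (vec 0ᵛ ∧ ((⋀ (prepend0 y) ∧ ω) ∘ (inside ∷_))) Subset.⊤
      ≈⟨ vec-∧-inside (unit zero) (⋀ (prepend0 y) ∧ ω) Subset.⊤ ⟨
    (vec (unit zero) ∧ ⋀ (prepend0 y) ∧ ω) Subset.⊤
      ≈⟨ ∧-assoc (vec (unit zero)) (⋀ (prepend0 y)) ω Subset.⊤ ⟨
    (⋀ (unit zero Vector.∷ prepend0 y) ∧ ω) Subset.⊤
      ≈⟨ ≈0 ⟩
    0# ∎)
    where
    ω₀ : Λ n
    ω₀ = ω ∘ (outside ∷_)

  -- The basis vector taken from u is the j-th of S and has to pass the j smaller ones; this gives
  -- the sign.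
  vec-∧-expand : ∀ {n} (u : Vector Carrier n) η S →
                 (vec u ∧ η) S ≈ ∑[ j < ∣ S ∣ ] ((- 1#) ^ toℕ j * u (elements S j) * η (remove S j))
  vec-∧-expand u η []            = zeroˡ _
  vec-∧-expand u η (outside ∷ S) = vec-∧-expand (u ∘ suc) (η ∘ (outside ∷_)) S
  vec-∧-expand u η (inside ∷ S)  = trans (vec-∧-inside u η S)
    (+-cong (*-congʳ (sym (*-identityˡ _)))
      (trans (*-congˡ (vec-∧-expand (u ∘ suc) (η ∘ (inside ∷_)) S))
        (trans (*-distribˡ-sum (- 1#) (λ j → (- 1#) ^ toℕ j * u (suc (elements S j)) * η (inside ∷ remove S j)))
          (sum-cong-≋ λ j → solve 4 (λ m s x y → m :* (s :* x :* y) := m :* s :* x :* y) refl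
            (- 1#) ((- 1#) ^ toℕ j) (u (suc (elements S j))) (η (inside ∷ remove S j))))))

  vec-∧-expand-cast : ∀ {n d} (u : Vector Carrier n) η S (eq : d ≡ ∣ S ∣) →
    (vec u ∧ η) S ≈ ∑[ j < d ] ((- 1#) ^ toℕ j * u (elements S (cast eq j)) * η (remove S (cast eq j)))
  vec-∧-expand-cast u η S ≡.refl = trans (vec-∧-expand u η S) (sum-cong-≋ λ j → reflexive
    (≡.cong (λ i → (- 1#) ^ toℕ j * u (elements S i) * η (remove S i)) (≡.sym (Fin.cast-is-id ≡.refl j))))

  ⋀-degree : ∀ {d n} (v : Vector (Vector Carrier n) d) S → ∣ S ∣ ≢ d → ⋀ v S ≈ 0#
  ⋀-degree {zero} v []            ∣S∣≢d = contradiction ≡.refl ∣S∣≢d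
  ⋀-degree {zero} v (inside  ∷ S) ∣S∣≢d = refl
  ⋀-degree {zero} v (outside ∷ S) ∣S∣≢d = ⋀-degree {zero} (λ ()) S ∣S∣≢d
  ⋀-degree {suc d} v S ∣S∣≢d = trans (vec-∧-expand (v zero) (⋀ (v ∘ suc)) S)
    (·0 (λ j → (- 1#) ^ toℕ j * v zero (elements S j)) λ j →
      ⋀-degree (v ∘ suc) (remove S j) λ eq → ∣S∣≢d (≡.trans (≡.sym (∣remove∣ S j)) (≡.cong suc eq)))

  det-cong : ∀ {d} {M N : Vector (Vector Carrier d) d} → (∀ i → M i ≋ N i) → det M ≈ det N
  det-cong {zero}  M≋N = refl
  det-cong {suc d} M≋N = sum-cong-≋ λ j →
    *-cong (*-congˡ {(- 1#) ^ toℕ j} (M≋N zero j)) (det-cong λ r c → M≋N (suc r) (punchIn j c))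

  1Λ-⊥ : ∀ {n} (S : Subset n) → ∣ S ∣ ≡ 0 → 1# ≈ 1Λ S
  1Λ-⊥ []            eq = refl
  1Λ-⊥ (outside ∷ S) eq = 1Λ-⊥ S eq

  -- `vec-∧-expand-cast` is the expansion along the first row by which `det` is defined, so both
  -- recursions agree term by term.
  ⋀-minor : ∀ {d n} (v : Vector (Vector Carrier n) d) S (eq : d ≡ ∣ S ∣) →
            det (λ r c → v r (elements S (cast eq c))) ≈ ⋀ v S
  ⋀-minor {zero}  v S eq = 1Λ-⊥ S (≡.sym eq)
  ⋀-minor {suc d} v S eq = sym (trans (vec-∧-expand-cast (v zero) (⋀ (v ∘ suc)) S eq)
    (sum-cong-≋ λ j → *-congˡ {(- 1#) ^ toℕ j * v zero (elements S (cast eq j))} (minor (cast eq j) j ≡.refl)))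
    where
    minor : ∀ i j → cast eq j ≡ i → ⋀ (v ∘ suc) (remove S i) ≈ det (λ r c → v (suc r) (elements S (cast eq (punchIn j c))))
    minor i j cj≡i = trans (sym (⋀-minor (v ∘ suc) (remove S i) eq′))
      (det-cong λ r c → reflexive (≡.cong (v (suc r)) (elements-remove S i eq′ eq j cj≡i c)))
      where eq′ = ℕ.suc-injective (≡.trans eq (≡.sym (∣remove∣ S i)))

  ⋀-Δ : ∀ {d n} (U : Subspace d n) J → Δ U J ≈ ⋀ (basis U) (proj₁ J)
  ⋀-Δ U (S , eq) = ⋀-minor (basis U) S (≡.sym eq)

-- The parity of the exponents in the coefficients of the adjoint.

sum-tabulate-suc : ∀ {m} (f : Fin m → ℕ) →
                   ListAction.sum (List.tabulate (suc ∘ f)) ≡ m ℕ.+ ListAction.sum (List.tabulate f)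
sum-tabulate-suc {zero}  f = ≡.refl
sum-tabulate-suc {suc m} f = ≡.cong suc (begin
  f zero ℕ.+ ListAction.sum (List.tabulate (suc ∘ f ∘ suc))     ≡⟨ ≡.cong (f zero ℕ.+_) (sum-tabulate-suc (f ∘ suc)) ⟩
  f zero ℕ.+ (m ℕ.+ ListAction.sum (List.tabulate (f ∘ suc)))   ≡⟨ x∙yz≈y∙xz (f zero) m _ ⟩
  m ℕ.+ ListAction.sum (List.tabulate f)                        ∎)
  where
  open ≡.≡-Reasoning
  open import Algebra.Properties.CommutativeSemigroup ℕ.+-commutativeSemigroup using (x∙yz≈y∙xz)

elementSum-outside : ∀ {n} (S : Subset n) → elementSum (outside ∷ S) ≡ ∣ S ∣ ℕ.+ elementSum S
elementSum-outside S = sum-tabulate-suc (suc ∘ toℕ ∘ elements S)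

elementSum-inside : ∀ {n} (S : Subset n) → elementSum (inside ∷ S) ≡ suc (∣ S ∣ ℕ.+ elementSum S)
elementSum-inside S = ≡.cong suc (sum-tabulate-suc (suc ∘ toℕ ∘ elements S))

triangular : ∀ k → suc k ℕ.* suc (suc k) / 2 ≡ k ℕ.* suc k / 2 ℕ.+ suc k
triangular k = begin
  suc k ℕ.* suc (suc k) / 2          ≡⟨ ≡.cong (_/ 2)
                                          (solve 1 (λ k → (con 1 :+ k) :* (con 2 :+ k) := k :* (con 1 :+ k)
                                               :+ (con 1 :+ k) :* con 2) ≡.refl k) ⟩
  (k ℕ.* suc k ℕ.+ suc k ℕ.* 2) / 2  ≡⟨ +-distrib-/-∣ʳ (k ℕ.* suc k) (divides (suc k) ≡.refl) ⟩
  k ℕ.* suc k / 2 ℕ.+ suc k ℕ.* 2 / 2 ≡⟨ ≡.cong (k ℕ.* suc k / 2 ℕ.+_) (m*n/n≡m (suc k) 2) ⟩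
  k ℕ.* suc k / 2 ℕ.+ suc k          ∎
  where
  open ≡.≡-Reasoning
  open ℕSolver.+-*-Solver using (solve; _:=_; _:+_; _:*_; con)

signExponent : ∀ {n} → ℕ → Subset n → ℕ
signExponent k S = k ℕ.* suc k / 2 ℕ.+ elementSum S

-- Each of the elements of S is shifted by one. The resulting power of the sign is the `grade` in
-- the second summand of the product rule.
signExponent-outside : ∀ {n} k (S : Subset n) → signExponent k (outside ∷ S) ≡ ∣ S ∣ ℕ.+ signExponent k S
signExponent-outside k S = ≡.trans (≡.cong (k ℕ.* suc k / 2 ℕ.+_) (elementSum-outside S))
  (solve 3 (λ t s e → t :+ (s :+ e) := s :+ (t :+ e)) ≡.refl (k ℕ.* suc k / 2) ∣ S ∣ (elementSum S))
  where open ℕSolver.+-*-Solver using (solve; _:=_; _:+_)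

-- The triangular number in the sign is there for this: it grows by `suc k`, as does the sum of the
-- elements, so the total change is even and the sign stays. Accordingly the first summand of the
-- product rule has none.
signExponent-inside : ∀ {n k} (S : Subset n) → ∣ S ∣ ≡ k →
                      signExponent (suc k) (inside ∷ S) ≡ (suc k ℕ.+ suc k) ℕ.+ signExponent k S
signExponent-inside {k = k} S ≡.refl = ≡.trans (≡.cong₂ ℕ._+_ (triangular k) (elementSum-inside S))
  (solve 3 (λ t s e → (t :+ s) :+ (s :+ e) := (s :+ s) :+ (t :+ e)) ≡.refl (k ℕ.* suc k / 2) (suc k) (elementSum S))
  where open ℕSolver.+-*-Solver using (solve; _:=_; _:+_)

-- Complements of a subspace that are common kernels of linear forms.

module Transversality {a} (ℝ : CompleteOrderedField a) where

  open CompleteOrderedField ℝ hiding (zero)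
  open Arrangements ℝ hiding (w)
  open LinearAlgebra ℝ
  open Exterior ℝ
  open import Algebra.Properties.Ring ring
    using (-1*x≈-x; -‿involutive)
  open import Algebra.Properties.Semiring.Sum semiring
  open import Relation.Binary.Reasoning.Setoid setoid
  open VecEq setoid using (_≋_)
  open SemiringSolver commutativeSemiring using (solve; _:=_; _:+_; _:*_)

  independent⇒∉Span : ∀ {d n} {v : Vector (Vector Carrier n) (suc d)} →
                      LinearlyIndependent v → v zero ∉ Span (v ∘ suc)
  independent⇒∉Span {v = v} ind (c , v₀≋) = 1≉0 (begin
    1#           ≈⟨ trans (-1*x≈-x (- 1#)) (-‿involutive 1#) ⟨
    - 1# * - 1#  ≈⟨ *-congˡ (ind (- 1# Vector.∷ c)
                      (λ j → trans (+-cong (-1*x≈-x (v zero j)) (sym (v₀≋ j))) (-‿inverseˡ (v zero j))) zero) ⟩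
    - 1# * 0#    ≈⟨ zeroʳ _ ⟩
    0#           ∎)

  combination-linearʳ : ∀ {d n} p q (c : Vector Carrier d) (v w : Vector (Vector Carrier n) d) j →
    combination c (λ i j → p * v i j + q * w i j) j ≈ p * combination c v j + q * combination c w j
  combination-linearʳ p q c v w j = begin
    c · (λ i → p * v i j + q * w i j)      ≈⟨ ·-comm c (λ i → p * v i j + q * w i j) ⟩
    (λ i → p * v i j + q * w i j) · c      ≈⟨ ·-linearˡ p q (λ i → v i j) (λ i → w i j) c ⟩
    p * ((λ i → v i j) · c) + q * ((λ i → w i j) · c)
      ≈⟨ +-cong (*-congˡ (·-comm (λ i → v i j) c)) (*-congˡ (·-comm (λ i → w i j) c)) ⟩
    p * combination c v j + q * combination c w j ∎

  ⋀-top-length : ∀ {d n} (v : Vector (Vector Carrier n) d) → ⋀ v Subset.⊤ ≉ 0# → n ≡ d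
  ⋀-top-length {d} {n} v ≉0 = Dec.decidable-stable (n ℕ.≟ d) λ n≢d →
    ≉0 (⋀-degree v Subset.⊤ (n≢d ∘ ≡.trans (≡.sym (∣⊤∣≡n n))))

  ⋀-nonZero-top : ∀ {d n} (v : Vector (Vector Carrier n) d) → d ≡ n → NonZero (⋀ v) →
                  ⋀ v Subset.⊤ ≉ 0#
  ⋀-nonZero-top {n = n} v d≡n (S , ≉0) = ≡.subst (λ T → ⋀ v T ≉ 0#) (∣p∣≡n⇒p≡⊤ {p = S} ∣S∣≡n) ≉0
    where
    ∣S∣≡n : ∣ S ∣ ≡ n
    ∣S∣≡n = Dec.decidable-stable (∣ S ∣ ℕ.≟ n) λ ≢n → ≉0 (⋀-degree v S λ eq → ≢n (≡.trans eq d≡n))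

  -- By induction, vectors y complete the product of the tail vₜ to top degree, so y and vₜ together
  -- form a basis in which v₀ can be written. If `⋀ v` vanished, then so would the wedge of the
  -- y-part of v₀ with `⋀ vₜ`; as y is independent modulo vₜ, the y-part would be zero and v₀ would
  -- lie in the span of vₜ.
  ⋀-independent : ∀ {d n} (v : Vector (Vector Carrier n) d) → LinearlyIndependent v → NonZero (⋀ v)
  ⋀-independent {zero}  {n} v ind = Subset.⊥ , λ ≈0 → 1≉0 (trans (1Λ-⊥ (Subset.⊥ {n}) (∣⊥∣≡0 n)) ≈0)
  ⋀-independent {suc d} {n} v ind = Dec.decidable-stable (nonZero? (⋀ v)) dependent
    where
    v₀ = v zero
    vₜ = v ∘ suc
    dependent : ¬ ¬ NonZero (⋀ v)
    dependent none with ⋀-complete (⋀ vₜ) (⋀-independent vₜ (independent-tail {v = v} ind))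
    ... | l , y , ≉0 = independent⇒∉Span {v = v} ind (c₂ , λ j → begin
        v₀ j                                        ≈⟨ v₀≋ j ⟩
        combination c₁ y j + combination c₂ vₜ j    ≈⟨ +-congʳ (0· (λ i → y i j) c₁≋0) ⟩
        0# + combination c₂ vₜ j                    ≈⟨ +-identityˡ _ ⟩
        combination c₂ vₜ j                         ∎)
      where
      y++vₜ≉0 : ⋀ (y Vector.++ vₜ) Subset.⊤ ≉ 0#
      y++vₜ≉0 ≈0 = ≉0 (trans (sym (⋀-++ y vₜ Subset.⊤)) ≈0)
      spanned = basis-spans {v = y Vector.++ vₜ}
        (⋀-nonZero⇒independent (y Vector.++ vₜ) (Subset.⊤ , y++vₜ≉0))
        (ℕ.≤-reflexive (⋀-top-length (y Vector.++ vₜ) y++vₜ≉0)) v₀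
      c  = proj₁ spanned
      c₁ = c ∘ (_↑ˡ d)
      c₂ = c ∘ (l ↑ʳ_)
      v₀≋ : ∀ j → v₀ j ≈ combination c₁ y j + combination c₂ vₜ j
      v₀≋ j = trans (proj₂ spanned j) (combination-split c y vₜ j)
      c₁≋0 : c₁ ≋ 0ᵛ
      c₁≋0 = independent-modulo y (⋀ vₜ) (Subset.⊤ , ≉0) c₁ λ S → begin
        (vec (combination c₁ y) ∧ ⋀ vₜ) S
          ≈⟨ trans (+-congˡ (span-∧-⋀ vₜ (c₂ , λ _ → refl) S)) (+-identityʳ _) ⟨
        (vec (combination c₁ y) ∧ ⋀ vₜ) S + (vec (combination c₂ vₜ) ∧ ⋀ vₜ) S
          ≈⟨ ∧-distribʳ (vec (combination c₁ y)) (vec (combination c₂ vₜ)) (⋀ vₜ) S ⟨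
        ((λ T → vec (combination c₁ y) T + vec (combination c₂ vₜ) T) ∧ ⋀ vₜ) S
          ≈⟨ ∧-congˡ (⋀ vₜ) (λ T → trans (+-cong (sym (*-identityˡ _)) (sym (*-identityˡ _)))
               (sym (vec-linear 1# 1# (combination c₁ y) (combination c₂ vₜ) T))) S ⟩
        (vec (λ j → 1# * combination c₁ y j + 1# * combination c₂ vₜ j) ∧ ⋀ vₜ) S
          ≈⟨ ∧-congˡ (⋀ vₜ) (vec-cong λ j → sym (trans (v₀≋ j) (+-cong (sym (*-identityˡ _)) (sym (*-identityˡ _))))) S ⟩
        ⋀ v S
          ≈⟨ ¬nonZero⇒≈0 (⋀ v) none S ⟩
        0# ∎

  -- The number of added vectors is forced by the degree: a family with a nonzero top coefficient
  -- has n members.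
  completion : ∀ {d n} (u : Vector (Vector Carrier n) d) → LinearlyIndependent u →
               Σ[ y ∈ Vector (Vector Carrier n) (n ∸ d) ] (⋀ y ∧ ⋀ u) Subset.⊤ ≉ 0#
  completion {d} {n} u ind with ⋀-complete (⋀ u) (⋀-independent u ind)
  ... | l , y , ≉0 = ≡.subst (λ l → Σ[ y ∈ Vector (Vector Carrier n) l ] (⋀ y ∧ ⋀ u) Subset.⊤ ≉ 0#) l≡n∸d (y , ≉0)
    where
    n≡l+d : n ≡ l ℕ.+ d
    n≡l+d = ⋀-top-length (y Vector.++ u) λ ≈0 → ≉0 (trans (sym (⋀-++ y u Subset.⊤)) ≈0)
    l≡n∸d : l ≡ n ∸ d
    l≡n∸d = ≡.sym (≡.trans (≡.cong (_∸ d) n≡l+d) (ℕ.m+n∸n≡m l d))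

  independent-++ : ∀ {d e n} {u : Vector (Vector Carrier n) d} {x : Vector (Vector Carrier n) e} →
    LinearlyIndependent u →
    (∀ a b → (∀ m → combination a u m + combination b x m ≈ 0#) → b ≋ 0ᵛ) →
    LinearlyIndependent (u Vector.++ x)
  independent-++ {d} {e} {u = u} {x} ind modulo c c≋0 i with splitAt d i in eq
  ... | inj₁ j = trans (reflexive (≡.cong c (≡.sym (Fin.splitAt⁻¹-↑ˡ eq)))) (ind c₁ (λ m → begin
      combination c₁ u m                       ≈⟨ trans (+-congˡ (0· (λ i → x i m) (modulo c₁ c₂ split))) (+-identityʳ _) ⟨
      combination c₁ u m + combination c₂ x m   ≈⟨ split m ⟩
      0#                                      ∎) j)
    where
    c₁ = c ∘ (_↑ˡ e)
    c₂ = c ∘ (d ↑ʳ_)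
    split = λ m → trans (sym (combination-split c u x m)) (c≋0 m)
  ... | inj₂ j = trans (reflexive (≡.cong c (≡.sym (Fin.splitAt⁻¹-↑ʳ eq))))
    (modulo (c ∘ (_↑ˡ e)) (c ∘ (d ↑ʳ_)) (λ m → trans (sym (combination-split c u x m)) (c≋0 m)) j)

  module _ {k n} (U : Subspace k n) (N : Vector (Vector Carrier n) k) where

    private
      u = basis U

    -- The last component is the determinant of a basis of U followed by one of X: its nonvanishing
    -- says that X is a complement of U.
    IsComplementaryKernel : Subspace (n ∸ k) n → Set a
    IsComplementaryKernel X =
      (∀ {x} → x ∈ ⟦ X ⟧ → ∀ i → x ∈ kernel (N i)) ×
      (∀ {x} → (∀ i → x ∈ kernel (N i)) → x ∈ ⟦ X ⟧) ×
      (⋀ u ∧ ⋀ (basis X)) Subset.⊤ ≉ 0#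

    module _ (ind : LinearlyIndependent (coordinates U ∘ N)) (x : Vector (Vector Carrier n) (n ∸ k))
             (modulo : ∀ a b → (∀ m → combination a u m + combination b x m ≈ 0#) → b ≋ 0ᵛ)
             (N·x≈0 : ∀ i j → N i · x j ≈ 0#) where

      private
        X : Subspace (n ∸ k) n
        X .basis             = x
        X .independent b b≋0 = modulo 0ᵛ b λ m →
          trans (+-congʳ (0· (λ i → u i m) λ _ → refl)) (trans (+-identityˡ _) (b≋0 m))

        X⊆kernels : ∀ {w} → w ∈ ⟦ X ⟧ → ∀ i → w ∈ kernel (N i)
        X⊆kernels (b , w≋) i = trans (evaluate X (N i) b w≋) (0· b (N·x≈0 i))

        u++x-independent : LinearlyIndependent (u Vector.++ x)
        u++x-independent = independent-++ (independent U) modulo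

        -- Decompose w along U and X. The forms N vanish on w and on its X-part, hence on its
        -- U-part; their restrictions to U span all forms on U, so the U-part is zero.
        kernels⊆X : ∀ {w} → (∀ i → w ∈ kernel (N i)) → w ∈ ⟦ X ⟧
        kernels⊆X {w} Nw≈0
          with basis-spans u++x-independent
                 (ℕ.≤-reflexive (≡.sym (ℕ.m+[n∸m]≡n (independent⇒≤ (independent U))))) w
        ... | e , w≋ = b , λ m → trans (w≋a+b m) (trans (+-congʳ (0· (λ i → u i m) a≋0)) (+-identityˡ _))
          where
          a′ = e ∘ (_↑ˡ (n ∸ k))
          b = e ∘ (k ↑ʳ_)
          w≋a+b : ∀ m → w m ≈ combination a′ u m + combination b x m
          w≋a+b m = trans (w≋ m) (combination-split e u x m)
          a≋0 : a′ ≋ 0ᵛ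
          a≋0 = orthogonal-spanning (basis-spans {v = coordinates U ∘ N} ind ℕ.≤-refl) a′ λ i → begin
            coordinates U (N i) · a′
              ≈⟨ evaluate U (N i) a′ (λ _ → refl) ⟨
            N i · combination a′ u
              ≈⟨ trans (+-cong (*-identityˡ _) (trans (*-congˡ (X⊆kernels (b , λ _ → refl) i)) (zeroʳ _))) (+-identityʳ _) ⟨
            1# * (N i · combination a′ u) + 1# * (N i · combination b x)
              ≈⟨ +-cong (*-congˡ (·-comm (N i) _)) (*-congˡ (·-comm (N i) _)) ⟩
            1# * (combination a′ u · N i) + 1# * (combination b x · N i)
              ≈⟨ ·-linearˡ 1# 1# (combination a′ u) (combination b x) (N i) ⟨
            (λ m → 1# * combination a′ u m + 1# * combination b x m) · N i
              ≈⟨ ·-congˡ (N i) (λ m → trans (w≋a+b m) (+-cong (sym (*-identityˡ _)) (sym (*-identityˡ _)))) ⟨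
            w · N i
              ≈⟨ ·-comm w (N i) ⟩
            N i · w
              ≈⟨ Nw≈0 i ⟩
            0# ∎

      complement-isComplementaryKernel : Σ[ X ∈ Subspace (n ∸ k) n ] IsComplementaryKernel X
      complement-isComplementaryKernel = X , X⊆kernels , kernels⊆X ,
        λ ≈0 → ⋀-nonZero-top (u Vector.++ x) (ℕ.m+[n∸m]≡n (independent⇒≤ (independent U)))
                 (⋀-independent (u Vector.++ x) u++x-independent) (trans (⋀-++ u x Subset.⊤) ≈0)

    -- The common kernel of N is spanned by the projections along U of vectors that complete
    -- a basis of U.
    complementaryKernel : LinearlyIndependent (coordinates U ∘ N) →
                          Σ[ X ∈ Subspace (n ∸ k) n ] IsComplementaryKernel X
    complementaryKernel ind = complement-isComplementaryKernel ind x modulo N·x≈0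
      where
      C = coordinates U ∘ N
      y = proj₁ (completion u (independent U))
      y∧u≉0 = proj₂ (completion u (independent U))
      -- The rows of the square matrix C are the forms N restricted to U. Its columns span as well,
      -- so some vector z j of U takes the same values under N as y j.
      project : ∀ j → (λ i → N i · y j) ∈ Span (transpose C)
      project j = basis-spans {v = transpose C} (independent-transpose {v = C} ind) ℕ.≤-refl _
      c = proj₁ ∘ project
      z x : Vector (Vector Carrier n) (n ∸ k)
      z j = combination (c j) u
      x j m = 1# * y j m + - 1# * z j m
      1*+-1* : ∀ {p q} → p ≈ q → 1# * p + - 1# * q ≈ 0#
      1*+-1* {p} {q} p≈q = trans (+-cong (trans (*-identityˡ p) p≈q) (-1*x≈-x q)) (-‿inverseʳ q)
      N·x≈0 : ∀ i j → N i · x j ≈ 0#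
      N·x≈0 i j = begin
        N i · x j                              ≈⟨ ·-comm (N i) (x j) ⟩
        x j · N i                              ≈⟨ ·-linearˡ 1# (- 1#) (y j) (z j) (N i) ⟩
        1# * (y j · N i) + - 1# * (z j · N i)  ≈⟨ 1*+-1* (begin
          y j · N i        ≈⟨ ·-comm (y j) (N i) ⟩
          N i · y j        ≈⟨ proj₂ (project j) i ⟩
          c j · C i        ≈⟨ ·-comm (c j) (C i) ⟩
          C i · c j        ≈⟨ evaluate U (N i) (c j) (λ _ → refl) ⟨
          N i · z j        ≈⟨ ·-comm (N i) (z j) ⟩
          z j · N i        ∎) ⟩
        0#                                     ∎
      modulo : ∀ a b → (∀ m → combination a u m + combination b x m ≈ 0#) → b ≋ 0ᵛ
      -- With A, Y and Z the combinations of u, y and z, the hypothesis reads A + (Y - Z) = 0. Thus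
      -- Y = Z - A lies in the span of u and has zero wedge with `⋀ u`, while y is independent
      -- modulo u.
      modulo a b sum≈0 = independent-modulo y (⋀ u) (Subset.⊤ , y∧u≉0) b
        (span-∧-⋀ u ((λ i → - 1# * a i + 1# * combination b c i) , λ m →
          let A = combination a u m ; Y = combination b y m ; Z = combination b z m in begin
          Y                                    ≈⟨ +-identityʳ Y ⟨
          Y + 0#                               ≈⟨ +-congˡ (trans (*-congˡ
                                                    (trans (+-congˡ (sym (combination-linearʳ 1# (- 1#) b y z m))) (sum≈0 m))) (zeroʳ _)) ⟨
          Y + - 1# * (A + (1# * Y + - 1# * Z)) ≈⟨ solve 5
                                                    (λ Y m A e Z → Y :+ m :* (A :+ (e :* Y :+ m :* Z))
                                                         := (Y :+ m :* (e :* Y)) :+ (m :* A :+ m :* m :* Z)) refl Y (- 1#) A 1# Z ⟩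
          (Y + - 1# * (1# * Y)) + (- 1# * A + - 1# * - 1# * Z)
            ≈⟨ +-cong (trans (+-congʳ (sym (*-identityˡ Y))) (1*+-1* (sym (*-identityˡ Y))))
                      (+-congˡ (*-congʳ (trans (-1*x≈-x (- 1#)) (-‿involutive 1#)))) ⟩
          0# + (- 1# * A + 1# * Z)             ≈⟨ +-identityˡ _ ⟩
          - 1# * A + 1# * Z                    ≈⟨ +-congˡ (*-congˡ (combination-assoc b c u m)) ⟩
          - 1# * A + 1# * combination (combination b c) u m
                                               ≈⟨ combination-linear (- 1#) 1# a (combination b c) u m ⟨
          combination (λ i → - 1# * a i + 1# * combination b c i) u m ∎))

    -- If the forms N were dependent on U, they would have a common nonzero zero in U. It would lie
    -- in X and have zero wedge with the product of the basis of X, although the basis of U is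
    -- independent modulo X.
    transversal⇒independent : ∀ (X : Subspace (n ∸ k) n) →
      (∀ {x} → (∀ i → x ∈ kernel (N i)) → x ∈ ⟦ X ⟧) →
      NonZero (⋀ u ∧ ⋀ (basis X)) → LinearlyIndependent (coordinates U ∘ N)
    transversal⇒independent X kernels⊆X u∧x≉0
      with kernelAlternative (coordinates U ∘ N)
    ... | inj₁ (_ , trivial) = independent-transpose {v = transpose (coordinates U ∘ N)} λ c cCᵗ≋0 →
          trivial c λ i → trans (·-comm _ c) (cCᵗ≋0 i)
    ... | inj₂ (c , (j , cⱼ≉0) , Cc≈0) = contradiction
          (independent-modulo u (⋀ (basis X)) u∧x≉0 c (span-∧-⋀ (basis X)
            (kernels⊆X λ i → trans (evaluate U (N i) c λ _ → refl) (Cc≈0 i))) j)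
          cⱼ≉0

-- The hyperplanes of the adjoint through Laplace expansion.

module Adjoint {a} (ℝ : CompleteOrderedField a) where

  open CompleteOrderedField ℝ hiding (zero)
  open Arrangements ℝ hiding (w)
  open LinearAlgebra ℝ
  open Exterior ℝ
  open Transversality ℝ
  open import Algebra.Properties.Semiring.Exp semiring using (_^_; ^-homo-*)
  open import Algebra.Properties.Semiring.Sum semiring
  open import Relation.Binary.Reasoning.Setoid setoid
  open VecEq setoid using (_≋_)
  open SemiringSolver commutativeSemiring using (solve; _:=_; _:*_)

  -- Written with `lookup` so that over `kSubsets n k` it is definitionally the sum in `adjoint`.
  sumOver : ∀ {b} {A : Set b} → (A → Carrier) → List A → Carrier
  sumOver f xs = ∑[ i < List.length xs ] f (List.lookup xs i)

  sumOver-++ : ∀ {b} {A : Set b} (f : A → Carrier) xs ys →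
               sumOver f (xs List.++ ys) ≈ sumOver f xs + sumOver f ys
  sumOver-++ f []       ys = sym (+-identityˡ _)
  sumOver-++ f (x ∷ xs) ys = trans (+-congˡ (sumOver-++ f xs ys)) (sym (+-assoc _ _ _))

  sumOver-map : ∀ {b c} {A : Set b} {B : Set c} (f : B → Carrier) (g : A → B) xs →
                sumOver f (List.map g xs) ≈ sumOver (f ∘ g) xs
  sumOver-map f g []       = refl
  sumOver-map f g (x ∷ xs) = +-congˡ (sumOver-map f g xs)

  sumOver-cong : ∀ {b} {A : Set b} {f g : A → Carrier} → (∀ x → f x ≈ g x) → ∀ xs →
                 sumOver f xs ≈ sumOver g xs
  sumOver-cong f≈g xs = sum-cong-≋ λ i → f≈g (List.lookup xs i)

  Homogeneous : ∀ {n} → ℕ → Λ n → Set a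
  Homogeneous d ω = ∀ S → ∣ S ∣ ≢ d → ω S ≈ 0#

  laplaceTerm : ∀ {n} k → Λ n → Λ n → KSubset n k → Carrier
  laplaceTerm k ω η (S , _) = (- 1#) ^ signExponent k S * ω S * η (∁ S)

  private
    ι : ∀ {n k} → KSubset n k → KSubset (suc n) (suc k)
    ι (S , eq) = inside ∷ S , ≡.cong suc eq

    o : ∀ {n k} → KSubset n k → KSubset (suc n) k
    o (S , eq) = outside ∷ S , eq

  laplaceTerm-outside : ∀ {n} k (ω η : Λ (suc n)) J →
    laplaceTerm k ω η (o J) ≈ laplaceTerm k (grade (ω ∘ (outside ∷_))) (η ∘ (inside ∷_)) J
  laplaceTerm-outside k ω η (S , _) = *-congʳ (begin
    (- 1#) ^ signExponent k (outside ∷ S) * x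
      ≈⟨ *-congʳ (trans (reflexive (≡.cong ((- 1#) ^_) (signExponent-outside k S))) (^-homo-* (- 1#) ∣ S ∣ (signExponent k S))) ⟩
    (- 1#) ^ ∣ S ∣ * (- 1#) ^ signExponent k S * x
      ≈⟨ solve 3 (λ s e x → s :* e :* x := e :* (s :* x)) refl ((- 1#) ^ ∣ S ∣) ((- 1#) ^ signExponent k S) x ⟩
    (- 1#) ^ signExponent k S * ((- 1#) ^ ∣ S ∣ * x) ∎)
    where x = ω (outside ∷ S)

  laplaceTerm-inside : ∀ {n} k (ω η : Λ (suc n)) J →
    laplaceTerm (suc k) ω η (ι J) ≈ laplaceTerm k (ω ∘ (inside ∷_)) (η ∘ (outside ∷_)) J
  laplaceTerm-inside k ω η (S , eq) = *-congʳ (*-congʳ (begin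
    (- 1#) ^ signExponent (suc k) (inside ∷ S)
      ≈⟨ reflexive (≡.cong ((- 1#) ^_) (signExponent-inside S eq)) ⟩
    (- 1#) ^ ((suc k ℕ.+ suc k) ℕ.+ signExponent k S)
      ≈⟨ ^-homo-* (- 1#) (suc k ℕ.+ suc k) (signExponent k S) ⟩
    (- 1#) ^ (suc k ℕ.+ suc k) * (- 1#) ^ signExponent k S
      ≈⟨ *-congʳ (trans (^-homo-* (- 1#) (suc k) (suc k)) (sign²≈1 (suc k))) ⟩
    1# * (- 1#) ^ signExponent k S
      ≈⟨ *-identityˡ _ ⟩
    (- 1#) ^ signExponent k S ∎))

  homogeneous-grade : ∀ {n k} {ω : Λ n} → Homogeneous k ω → Homogeneous k (grade ω)
  homogeneous-grade hom S ∣S∣≢k = trans (*-congˡ (hom S ∣S∣≢k)) (zeroʳ _)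

  -- At the top subset the product rule distinguishes whether the first basis vector comes from ω or
  -- from η, just as `kSubsets` distinguishes whether S contains the first element. Homogeneity of ω
  -- confines the sum to k-subsets.
  laplaceExpansion : ∀ {n} k (ω η : Λ n) → Homogeneous k ω →
                     (ω ∧ η) Subset.⊤ ≈ sumOver (laplaceTerm k ω η) (kSubsets n k)
  laplaceExpansion {zero} zero ω η hom =
    trans (*-congʳ (sym (*-identityˡ _))) (sym (+-identityʳ _))
  laplaceExpansion {zero} (suc k) ω η hom = trans (*-congʳ (hom [] λ ())) (zeroˡ _)
  laplaceExpansion {suc n} zero ω η hom = begin
    (ω ∧ η) Subset.⊤
      ≈⟨ trans (+-congʳ (∧-zeroˡ (η ∘ (outside ∷_)) (λ S → hom (inside ∷ S) λ ()) Subset.⊤)) (+-identityˡ _) ⟩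
    (grade (ω ∘ (outside ∷_)) ∧ (η ∘ (inside ∷_))) Subset.⊤
      ≈⟨ laplaceExpansion zero (grade (ω ∘ (outside ∷_))) _ (homogeneous-grade {ω = ω ∘ (outside ∷_)} (hom ∘ (outside ∷_))) ⟩
    sumOver (laplaceTerm zero (grade (ω ∘ (outside ∷_))) (η ∘ (inside ∷_))) (kSubsets n zero)
      ≈⟨ sumOver-cong (laplaceTerm-outside zero ω η) (kSubsets n zero) ⟨
    sumOver (laplaceTerm zero ω η ∘ o) (kSubsets n zero)
      ≈⟨ sumOver-map (laplaceTerm zero ω η) o (kSubsets n zero) ⟨
    sumOver (laplaceTerm zero ω η) (kSubsets (suc n) zero) ∎
  laplaceExpansion {suc n} (suc k) ω η hom = begin
    (ω ∧ η) Subset.⊤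
      ≈⟨ +-cong (laplaceExpansion k (ω ∘ (inside ∷_)) (η ∘ (outside ∷_)) (λ S ≢k → hom (inside ∷ S) (≢k ∘ ℕ.suc-injective)))
                (laplaceExpansion (suc k) (grade (ω ∘ (outside ∷_))) _ (homogeneous-grade {ω = ω ∘ (outside ∷_)} (hom ∘ (outside ∷_)))) ⟩
    sumOver (laplaceTerm k (ω ∘ (inside ∷_)) (η ∘ (outside ∷_))) (kSubsets n k) +
    sumOver (laplaceTerm (suc k) (grade (ω ∘ (outside ∷_))) (η ∘ (inside ∷_))) (kSubsets n (suc k))
      ≈⟨ +-cong (trans (sumOver-map (laplaceTerm (suc k) ω η) ι (kSubsets n k))
           (sumOver-cong (laplaceTerm-inside k ω η) (kSubsets n k)))
                (trans (sumOver-map (laplaceTerm (suc k) ω η) o (kSubsets n (suc k)))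
                     (sumOver-cong (laplaceTerm-outside (suc k) ω η) (kSubsets n (suc k)))) ⟨
    sumOver (laplaceTerm (suc k) ω η) (List.map ι (kSubsets n k)) +
    sumOver (laplaceTerm (suc k) ω η) (List.map o (kSubsets n (suc k)))
      ≈⟨ sumOver-++ (laplaceTerm (suc k) ω η) (List.map ι (kSubsets n k)) _ ⟨
    sumOver (laplaceTerm (suc k) ω η) (kSubsets (suc n) (suc k)) ∎

  module _ {n} (𝒜 : Arrangement (full n)) (k : ℕ) where

    adjoint-form : ∀ (X : L[rank-k] 𝒜 k) (U : Subspace k n) →
      sumOver (λ J → coefficient 𝒜 k X J * Δ U J) (kSubsets n k) ≈
      (⋀ (basis U) ∧ ⋀ (basis (proj₁ X))) Subset.⊤
    adjoint-form X U = trans (sumOver-cong term (kSubsets n k))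
      (sym (laplaceExpansion k ω η (⋀-degree (basis U))))
      where
      ω η : Λ n
      ω = ⋀ (basis U)
      η = ⋀ (basis (proj₁ X))
      term : ∀ J → coefficient 𝒜 k X J * Δ U J ≈ laplaceTerm k ω η J
      term J@(S , eq) = begin
        s * Δ (proj₁ X) (complement J) * Δ U J   ≈⟨ *-cong (*-congˡ (⋀-Δ (proj₁ X) (complement J))) (⋀-Δ U J) ⟩
        s * η (∁ S) * ω S                        ≈⟨ *-assoc s (η (∁ S)) (ω S) ⟩
        s * (η (∁ S) * ω S)                      ≈⟨ *-congˡ (*-comm (η (∁ S)) (ω S)) ⟩
        s * (ω S * η (∁ S))                      ≈⟨ *-assoc s (ω S) (η (∁ S)) ⟨
        s * ω S * η (∁ S)                        ∎
        where s = (- 1#) ^ signExponent k S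

    ∈adjoint⇒degenerate : ∀ X (U : Subspace k n) → Δ U ∈ adjoint 𝒜 k X →
                          (⋀ (basis U) ∧ ⋀ (basis (proj₁ X))) Subset.⊤ ≈ 0#
    ∈adjoint⇒degenerate X U ∈H = trans (sym (adjoint-form X U)) ∈H

    degenerate⇒∈adjoint : ∀ X (U : Subspace k n) →
                          (⋀ (basis U) ∧ ⋀ (basis (proj₁ X))) Subset.⊤ ≈ 0# → Δ U ∈ adjoint 𝒜 k X
    degenerate⇒∈adjoint X U ≈0 = trans (adjoint-form X U) ≈0

    -- A point of the stratum of P lies only on those hyperplanes of the adjoint that contain P.
    stratum⊆ : ∀ {P₁ P₂} → P₁ ∈ L (adjoint 𝒜 k) → P₁ ≤ᴸ P₂ →
               ∀ {p q} → p ∈ stratum (adjoint 𝒜 k) P₁ → q ∈ P₂ →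
               ∀ X → p ∈ adjoint 𝒜 k X → q ∈ adjoint 𝒜 k X
    stratum⊆ {P₁} {P₂} (B , P₁⊆ , ⊆P₁) P₂⊆P₁ {p} {q} (p∈P₁ , avoids) q∈P₂ X p∈H =
      -- If q were not on H(X), then Y, the intersection of P₁ and H(X), would be strictly smaller
      -- than P₁, since q lies in P₂ and hence in P₁. But p lies in Y, which the stratum of P₁
      -- forbids.
      Dec.decidable-stable (_ ≟ 0#) λ q∉H → avoids Y
        (X ∷ B , (λ (y∈P₁ , y∈H) → y∈H All.∷ P₁⊆ y∈P₁) , λ { (y∈H All.∷ y∈B) → ⊆P₁ y∈B , y∈H })
        (proj₁ , λ P₁⊆Y → q∉H (proj₂ (P₁⊆Y (P₂⊆P₁ q∈P₂))))
        (p∈P₁ , p∈H)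
      where
      Y : Pred (KSubset n k → Carrier) a
      Y y = y ∈ P₁ × y ∈ adjoint 𝒜 k X

  -- Transfer of independence from U₂ to U₁.

  module WeakMap {n} (𝒜 : Arrangement (full n)) (essential : Essential 𝒜) {k} (U₁ U₂ : Subspace k n)
                 (specializes : ∀ X → Δ U₁ ∈ adjoint 𝒜 k X → Δ U₂ ∈ adjoint 𝒜 k X) where

    forms : Subspace k n → Vector (Vector Carrier k) (size 𝒜)
    forms U = coordinates U ∘ normal 𝒜

    degenerate-specializes : ∀ X → (⋀ (basis U₁) ∧ ⋀ (basis (proj₁ X))) Subset.⊤ ≈ 0# →
                             (⋀ (basis U₂) ∧ ⋀ (basis (proj₁ X))) Subset.⊤ ≈ 0#
    degenerate-specializes X ≈0 =
      ∈adjoint⇒degenerate 𝒜 k X U₂ (specializes X (degenerate⇒∈adjoint 𝒜 k X U₁ ≈0))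

    commonKernel∈L : ∀ {d m} (f : Fin m → Fin (size 𝒜)) (X : Subspace d n) →
                     (∀ {x} → x ∈ ⟦ X ⟧ → ∀ i → x ∈ kernel (normal 𝒜 (f i))) →
                     (∀ {x} → (∀ i → x ∈ kernel (normal 𝒜 (f i))) → x ∈ ⟦ X ⟧) →
                     ⟦ X ⟧ ∈ L (hyperplane 𝒜)
    commonKernel∈L f X X⊆kernels kernels⊆X = List.tabulate f ,
      (λ {x} x∈X → All.tabulate⁺ λ i → (x , λ j → sym (·-unit x j)) , X⊆kernels x∈X i) ,
      (λ x∈B → kernels⊆X λ i → proj₂ (All.tabulate⁻ x∈B i))

    basis-weak : ∀ (f : Fin k → Fin (size 𝒜)) → LinearlyIndependent (forms U₂ ∘ f) →
                 LinearlyIndependent (forms U₁ ∘ f)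
    basis-weak f ind = transfer (complementaryKernel U₂ (normal 𝒜 ∘ f) ind)
      where
      transfer : Σ[ X ∈ Subspace (n ∸ k) n ] IsComplementaryKernel U₂ (normal 𝒜 ∘ f) X →
                 LinearlyIndependent (forms U₁ ∘ f)
      transfer (X , X⊆kernels , kernels⊆X , transversal) =
        transversal⇒independent U₁ (normal 𝒜 ∘ f) X kernels⊆X (Subset.⊤ , λ ≈0 →
          transversal (degenerate-specializes (X , commonKernel∈L f X X⊆kernels kernels⊆X) ≈0))

    -- Fewer than k forms on U₂ have a common nonzero zero. If they spanned the forms of all
    -- hyperplanes, it would lie on every hyperplane of 𝒜, which is essential.
    spanning-length : ∀ {d} (f : Fin d → Fin (size 𝒜)) → (∀ e → forms U₂ e ∈ Span (forms U₂ ∘ f)) → ¬ (d ℕ.< k)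
    spanning-length f spans d<k with nontrivialKernel d<k (forms U₂ ∘ f)
    ... | c , (j , cⱼ≉0) , f·c≈0 = cⱼ≉0 (independent U₂ c
      (essential (combination c (basis U₂)) λ e →
        (combination c (basis U₂) , λ j → sym (·-unit _ j)) , (begin
        normal 𝒜 e · combination c (basis U₂)          ≈⟨ evaluate U₂ (normal 𝒜 e) c (λ _ → refl) ⟩
        forms U₂ e · c                                 ≈⟨ ·-congˡ c (proj₂ (spans e)) ⟩
        combination (proj₁ (spans e)) (forms U₂ ∘ f) · c ≈⟨ ·-comm _ c ⟩
        c · combination (proj₁ (spans e)) (forms U₂ ∘ f) ≈⟨ ·-combination c (proj₁ (spans e)) (forms U₂ ∘ f) ⟩
        (λ i → c · forms U₂ (f i)) · proj₁ (spans e)   ≈⟨ 0· (proj₁ (spans e)) (λ i → trans (·-comm c (forms U₂ (f i))) (f·c≈0 i)) ⟩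
        0#                                             ∎)) j)

    extension : ∀ {d} (f : Fin d → Fin (size 𝒜)) → LinearlyIndependent (forms U₂ ∘ f) → d ℕ.< k →
                ∃ λ e → LinearlyIndependent (forms U₂ e Vector.∷ (forms U₂ ∘ f))
    extension f ind d<k with any? (λ e → linearlyIndependent? (forms U₂ e Vector.∷ (forms U₂ ∘ f)))
    ... | yes e,ind = e,ind
    ... | no none   = contradiction d<k (spanning-length f spans)
      where
      spans : ∀ e → forms U₂ e ∈ Span (forms U₂ ∘ f)
      spans e with span⊎independent {v = forms U₂ ∘ f} ind (forms U₂ e)
      ... | inj₁ e∈   = e∈
      ... | inj₂ ind′ = contradiction (e , ind′) none

    weak : ∀ {d} (f : Fin d → Fin (size 𝒜)) → LinearlyIndependent (forms U₂ ∘ f) →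
           LinearlyIndependent (forms U₁ ∘ f)
    weak {d} f ind = go (k ∸ d) f ind (ℕ.m+[n∸m]≡n (independent⇒≤ {v = forms U₂ ∘ f} ind))
      where
      ∷-∘ : ∀ {d} e (f : Fin d → Fin (size 𝒜)) U i → (forms U e Vector.∷ (forms U ∘ f)) i ≋ (forms U ∘ (e Vector.∷ f)) i
      ∷-∘ e f U zero    j = refl
      ∷-∘ e f U (suc i) j = refl
      -- Here m counts the members that are missing. A new member goes to the front, so that
      -- `independent-tail` can drop it once the enlarged family has been transferred.
      go : ∀ m {d} (f : Fin d → Fin (size 𝒜)) → LinearlyIndependent (forms U₂ ∘ f) → d ℕ.+ m ≡ k →
           LinearlyIndependent (forms U₁ ∘ f)
      go zero    {d} f ind eq with ≡.trans (≡.sym (ℕ.+-identityʳ d)) eq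
      ... | ≡.refl = basis-weak f ind
      go (suc m) {d} f ind eq with extension f ind (ℕ.≤-trans (ℕ.m≤m+n (suc d) m) (ℕ.≤-reflexive (≡.trans (≡.sym (ℕ.+-suc d m)) eq)))
      ... | e , ind′ = independent-tail {v = forms U₁ ∘ (e Vector.∷ f)} (go m (e Vector.∷ f)
        (independent-cong {v = forms U₂ e Vector.∷ (forms U₂ ∘ f)} (∷-∘ e f U₂) ind′)
        (≡.trans (≡.sym (ℕ.+-suc d m)) eq))

-- The matroid of the forms induced on a subspace.

module LinearMatroid {a} (ℝ : CompleteOrderedField a) where

  open CompleteOrderedField ℝ hiding (zero; _≤_)
  open Arrangements ℝ
  open LinearAlgebra ℝ
  open import Algebra.Properties.Ring ring using (-1*x≈-x)
  open import Algebra.Properties.Semiring.Sum semiring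
  open import Relation.Binary.Reasoning.Setoid setoid
  open VecEq setoid using (_≋_)

  module _ {d m} (p : Vector (Vector Carrier d) m) where

    Independent : Pred (Subset m) a
    Independent S = LinearlyIndependent (p ∘ elements S)

    -- An injective h that factors through g is a subfamily of g up to order. This absorbs all
    -- differences between enumerations of subsets, unions and images.
    reindex : ∀ {e f} (g : Fin e → Fin m) (h : Fin f → Fin m) → Injective _≡_ _≡_ h → (∀ r → ∃ λ t → g t ≡ h r) →
              LinearlyIndependent (p ∘ g) → LinearlyIndependent (p ∘ h)
    reindex g h h-injective factor ind = independent-cong {v = p ∘ g ∘ t}
      (λ r j → reflexive (≡.cong (λ i → p i j) (proj₂ (factor r))))
      (subfamily {v = p ∘ g} ind t λ {r} {s} eq → h-injective
        (≡.trans (≡.sym (proj₂ (factor r))) (≡.trans (≡.cong g eq) (proj₂ (factor s)))))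
      where
      t = proj₁ ∘ factor

    ∷-elements : ∀ {e} (f : Fin e → Fin m) i r → (p i Vector.∷ (p ∘ f)) r ≋ (p ∘ (i Vector.∷ f)) r
    ∷-elements f i zero    j = refl
    ∷-elements f i (suc r) j = refl

    adjoin : ∀ {S i} → LinearlyIndependent (p i Vector.∷ (p ∘ elements S)) → Independent (S ∪ ⁅ i ⁆)
    adjoin {S} {i} ind = reindex (i Vector.∷ elements S) (elements (S ∪ ⁅ i ⁆)) (elements-injective (S ∪ ⁅ i ⁆)) factor
      (independent-cong {v = p i Vector.∷ (p ∘ elements S)} (∷-elements (elements S) i) ind)
      where
      factor : ∀ r → ∃ λ t → (i Vector.∷ elements S) t ≡ elements (S ∪ ⁅ i ⁆) r
      factor r with x∈p∪q⁻ S ⁅ i ⁆ (elements∈ (S ∪ ⁅ i ⁆) r)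
      ... | inj₁ ∈S   = suc (proj₁ (position ∈S)) , proj₂ (position ∈S)
      ... | inj₂ ∈⁅i⁆ = zero , ≡.sym (x∈⁅y⁆⇒x≡y i ∈⁅i⁆)

    hereditary : ∀ {S T} → S Subset.⊆ T → Independent T → Independent S
    hereditary {S} {T} S⊆T = reindex (elements T) (elements S) (elements-injective S) λ r →
      position (S⊆T (elements∈ S r))

    -- If w had more members than v, the matrix of their coefficients would leave a nonzero relation
    -- among the w.
    span-bound : ∀ {e f} (v : Vector (Vector Carrier d) e) (w : Vector (Vector Carrier d) f) →
                 (∀ t → w t ∈ Span v) → LinearlyIndependent w → f ℕ.≤ e
    span-bound {e} {f} v w spans w-ind = ℕ.≮⇒≥ λ e<f → absurd (nontrivialKernel e<f (transpose C))
      where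
      C : Vector (Vector Carrier e) f
      C t = proj₁ (spans t)
      absurd : ¬ ∃ λ c → (∃ λ t → c t ≉ 0#) × (∀ s → c ∈ kernel (transpose C s))
      absurd (c , (t , cₜ≉0) , Cc≈0) = cₜ≉0 (w-ind c (λ j → begin
        combination c w j                      ≈⟨ combination-congʳ c (λ t → proj₂ (spans t)) j ⟩
        combination c (λ t → combination (C t) v) j ≈⟨ combination-assoc c C v j ⟩
        combination (combination c C) v j      ≈⟨ 0· (λ s → v s j) (λ s → trans (combination-transpose c C s) (Cc≈0 s)) ⟩
        0#                                     ∎) t)

    -- If no element of T enlarged S, then S would span T, against the sizes.
    augment : ∀ {S T} → Independent S → Independent T → ∣ S ∣ ℕ.< ∣ T ∣ →
              ∃ λ i → i Subset.∈ T × ¬ i Subset.∈ S × Independent (S ∪ ⁅ i ⁆)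
    augment {S} {T} S-ind T-ind ∣S∣<∣T∣
      with any? (λ i → (i ∈? T) ×-dec (¬? (i ∈? S) ×-dec linearlyIndependent? (p ∘ elements (S ∪ ⁅ i ⁆))))
    ... | yes found = found
    ... | no none   = contradiction ∣S∣<∣T∣ (ℕ.≤⇒≯ (span-bound (p ∘ elements S) (p ∘ elements T) spans T-ind))
      where
      spans : ∀ t → p (elements T t) ∈ Span (p ∘ elements S)
      spans t with elements T t ∈? S
      ... | yes ∈S = unit r , λ j → sym (trans (combination-unit r (p ∘ elements S) j) (reflexive (≡.cong (λ i → p i j) eq)))
        where
        r = proj₁ (position ∈S)
        eq = proj₂ (position ∈S)
      ... | no ∉S with span⊎independent {v = p ∘ elements S} S-ind (p (elements T t))
      ...   | inj₁ spanned = spanned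
      ...   | inj₂ ind     = contradiction (elements T t , elements∈ T t , ∉S , adjoin {S} ind) none

    ⊥-independent : Independent Subset.⊥
    ⊥-independent c _ r = contradiction (elements∈ (Subset.⊥ {m}) r) ∉⊥

  singleton-independent : ∀ {d} {x : Vector Carrier d} → ¬ (x ≋ 0ᵛ) → LinearlyIndependent {1} (const x)
  singleton-independent {x = x} x≉0 c cx≋0 zero = Dec.decidable-stable (c zero ≟ 0#) λ c₀≉0 →
    x≉0 λ j → cancel c₀≉0 (trans (sym (+-identityʳ _)) (cx≋0 j))

  independent-injective : ∀ {d m} {v : Vector (Vector Carrier d) m} → LinearlyIndependent v →
                          ∀ {i j} → v i ≋ v j → i ≡ j
  independent-injective {v = v} ind {i} {j} vᵢ≋vⱼ = Dec.decidable-stable (i Fin.≟ j) λ i≢j →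
    1≉0 (trans (sym (unit-diagonal i)) (trans (sym (value i≢j)) (ind _ (λ l → begin
      combination (λ r → 1# * unit i r + - 1# * unit j r) v l
        ≈⟨ combination-linear 1# (- 1#) (unit i) (unit j) v l ⟩
      1# * combination (unit i) v l + - 1# * combination (unit j) v l
        ≈⟨ +-cong (trans (*-identityˡ _) (trans (combination-unit i v l) (vᵢ≋vⱼ l)))
                  (trans (-1*x≈-x _) (-‿cong (combination-unit j v l))) ⟩
      v j l + - v j l
        ≈⟨ -‿inverseʳ _ ⟩
      0# ∎) i)))
    where
    value : i ≢ j → 1# * unit i i + - 1# * unit j i ≈ unit i i
    value i≢j = trans (+-cong (*-identityˡ _) (trans (*-congˡ (unit-off i≢j)) (zeroʳ _))) (+-identityʳ _)

  independent-scale : ∀ {d m} {v w : Vector (Vector Carrier d) m} (γ : Vector Carrier m) → (∀ i → γ i ≉ 0#) →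
                      (∀ i → w i ≋ λ j → γ i * v i j) → LinearlyIndependent v → LinearlyIndependent w
  independent-scale {v = v} {w} γ γ≉0 w≋γv ind c cw≋0 i = cancel (γ≉0 i) (trans (*-comm (γ i) (c i))
    (ind (λ r → c r * γ r) (λ j → trans (sum-cong-≋ λ r → trans (*-assoc (c r) (γ r) (v r j)) (*-congˡ (sym (w≋γv r j))))
      (cw≋0 j)) i))

  module _ {d n} (U : Subspace d n) where

    coordinates-combination : ∀ {m} c (v : Vector (Vector Carrier n) m) →
                              coordinates U (combination c v) ≋ combination c (coordinates U ∘ v)
    coordinates-combination c v i = begin
      combination c v · basis U i           ≈⟨ ·-comm _ (basis U i) ⟩
      basis U i · combination c v           ≈⟨ ·-combination (basis U i) c v ⟩
      (λ r → basis U i · v r) · c           ≈⟨ ·-comm _ c ⟩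
      c · (λ r → basis U i · v r)           ≈⟨ ·-congʳ c (λ r → ·-comm (basis U i) (v r)) ⟩
      combination c (coordinates U ∘ v) i   ∎

    vanishing⇒coordinates≋0 : ∀ {v} → ⟦ U ⟧ ⊆ kernel v → coordinates U v ≋ 0ᵛ
    vanishing⇒coordinates≋0 U⊆ i = U⊆ (unit i , λ j → sym (combination-unit i (basis U) j))

    coordinates≋0⇒vanishing : ∀ {v} → coordinates U v ≋ 0ᵛ → ⟦ U ⟧ ⊆ kernel v
    coordinates≋0⇒vanishing {v} ≋0 (c , x≋) = trans (evaluate U v c x≋) (0· c ≋0)

    independentOn⇒independent : ∀ {m} {v : Vector (Vector Carrier n) m} → IndependentOn U v →
                                LinearlyIndependent (coordinates U ∘ v)
    independentOn⇒independent {v = v} ind c c≋0 = ind c (coordinates≋0⇒vanishing {combination c v} λ i →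
      trans (coordinates-combination c v i) (c≋0 i))

    independent⇒independentOn : ∀ {m} {v : Vector (Vector Carrier n) m} →
                                LinearlyIndependent (coordinates U ∘ v) → IndependentOn U v
    independent⇒independentOn {v = v} ind c U⊆ = ind c λ i →
      trans (sym (coordinates-combination c v i)) (vanishing⇒coordinates≋0 {combination c v} U⊆ i)

    -- Testing p on the vectors pⱼ eᵢ - pᵢ eⱼ of its kernel.
    proportional : ∀ {v w} → ¬ (⟦ U ⟧ ⊆ kernel v) → ¬ (⟦ U ⟧ ⊆ kernel w) →
                   ⟦ U ⟧ ∩ kernel v ⊆ ⟦ U ⟧ ∩ kernel w →
                   ∃ λ γ → γ ≉ 0# × coordinates U w ≋ λ j → γ * coordinates U v j
    proportional {v} {w} v-proper w-proper v⊆w with any? (λ j → ¬? (coordinates U v j ≟ 0#))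
    ... | no none = ⊥-elim (v-proper (coordinates≋0⇒vanishing λ j →
          Dec.decidable-stable (coordinates U v j ≟ 0#) λ ≉0 → none (j , ≉0)))
    ... | yes (j , pⱼ≉0) with inverse (coordinates U v j) pⱼ≉0
    ...   | ι , pⱼι≈1 = γ , γ≉0 , w≋γv
      where
      p = coordinates U v
      q = coordinates U w
      γ = ι * q j
      c : Fin d → Vector Carrier d
      c i r = p j * unit i r + - p i * unit j r
      form : ∀ (z : Vector Carrier d) i → z · c i ≈ p j * z i + - p i * z j
      form z i = begin
        z · c i                                    ≈⟨ ·-comm z (c i) ⟩
        c i · z                                    ≈⟨ ·-linearˡ (p j) (- p i) (unit i) (unit j) z ⟩
        p j * (unit i · z) + - p i * (unit j · z)  ≈⟨ +-cong (*-congˡ (unit-· i z)) (*-congˡ (unit-· j z)) ⟩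
        p j * z i + - p i * z j                    ∎
      p·c≈0 : ∀ i → p · c i ≈ 0#
      p·c≈0 i = trans (form p i) (trans (+-congʳ (*-comm (p j) (p i))) (*-cancel-+ (p i) (p j)))
      q·c≈0 : ∀ i → q · c i ≈ 0#
      q·c≈0 i = trans (sym (evaluate U w (c i) λ _ → refl))
        (proj₂ (v⊆w (point U (c i) , trans (evaluate U v (c i) λ _ → refl) (p·c≈0 i))))
      pⱼq≈pqⱼ : ∀ i → p j * q i ≈ p i * q j
      pⱼq≈pqⱼ i = begin
        p j * q i                                        ≈⟨ +-identityʳ _ ⟨
        p j * q i + 0#                                   ≈⟨ +-congˡ (trans (+-comm _ _) (*-cancel-+ (p i) (q j))) ⟨
        p j * q i + (- p i * q j + p i * q j)            ≈⟨ +-assoc _ _ _ ⟨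
        (p j * q i + - p i * q j) + p i * q j            ≈⟨ +-congʳ (trans (sym (form q i)) (q·c≈0 i)) ⟩
        0# + p i * q j                                   ≈⟨ +-identityˡ _ ⟩
        p i * q j                                        ∎
      w≋γv : q ≋ λ i → γ * p i
      w≋γv i = begin
        q i                ≈⟨ *-identityˡ _ ⟨
        1# * q i           ≈⟨ *-congʳ (trans (*-comm ι (p j)) pⱼι≈1) ⟨
        ι * p j * q i      ≈⟨ *-assoc ι (p j) (q i) ⟩
        ι * (p j * q i)    ≈⟨ *-congˡ (trans (pⱼq≈pqⱼ i) (*-comm (p i) (q j))) ⟩
        ι * (q j * p i)    ≈⟨ *-assoc ι (q j) (p i) ⟨
        γ * p i            ∎
      γ≉0 : γ ≉ 0#
      γ≉0 γ≈0 = w-proper (coordinates≋0⇒vanishing λ i → trans (w≋γv i) (trans (*-congʳ γ≈0) (zeroˡ _)))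

    -- Since v does not vanish on U, the factor c is nonzero and can be cancelled.
    parallel : ∀ {v w c} → ¬ (⟦ U ⟧ ⊆ kernel v) → coordinates U v ≋ (λ j → c * coordinates U w j) →
               (⟦ U ⟧ ∩ kernel v) ≐ (⟦ U ⟧ ∩ kernel w)
    parallel {v} {w} {c} v-proper v≋cw = (λ (x∈U , vx≈0) → x∈U , cancel c≉0 (trans (sym (scaled x∈U)) vx≈0)) ,
      (λ (x∈U , wx≈0) → x∈U , trans (scaled x∈U) (trans (*-congˡ wx≈0) (zeroʳ _)))
      where
      c≉0 : c ≉ 0#
      c≉0 c≈0 = v-proper (coordinates≋0⇒vanishing λ j → trans (v≋cw j) (trans (*-congʳ c≈0) (zeroˡ _)))
      scaled : ∀ {x} → x ∈ ⟦ U ⟧ → v · x ≈ c * (w · x)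
      scaled {x} (e , x≋) = begin
        v · x                                ≈⟨ evaluate U v e x≋ ⟩
        coordinates U v · e                  ≈⟨ ·-congˡ e v≋cw ⟩
        (λ j → c * coordinates U w j) · e    ≈⟨ ·-comm _ e ⟩
        e · (λ j → c * coordinates U w j)    ≈⟨ ·-scaleʳ c e (coordinates U w) ⟩
        c * (e · coordinates U w)            ≈⟨ *-congˡ (trans (·-comm e _) (sym (evaluate U w e x≋))) ⟩
        c * (w · x)                          ∎

    module _ (ℬ : Arrangement U) where

      private
        q : Vector (Vector Carrier d) (size ℬ)
        q = coordinates U ∘ normal ℬ

      Indep : Pred (Subset (size ℬ)) a
      Indep S = IndependentOn U (normal ℬ ∘ elements S)

      isMatroid : IsMatroid Indep
      isMatroid = record
        { ⊥-indep    = independent⇒independentOn (⊥-independent q)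
        ; hereditary = λ S⊆T → independent⇒independentOn ∘ hereditary q S⊆T ∘ independentOn⇒independent
        ; augment    = λ {S} {T} S-ind T-ind ∣S∣<∣T∣ →
            let i , i∈T , i∉S , ind = augment q {S} {T} (independentOn⇒independent S-ind) (independentOn⇒independent T-ind) ∣S∣<∣T∣
            in i , i∈T , i∉S , independent⇒independentOn ind
        }

      nonzero-coordinates : ∀ i → ¬ (q i ≋ 0ᵛ)
      nonzero-coordinates i qᵢ≋0 = nonzero ℬ i (coordinates≋0⇒vanishing qᵢ≋0)

      loopless : ∀ i → Indep ⁅ i ⁆
      loopless i = independent⇒independentOn (reindex q (const i) (elements ⁅ i ⁆) (elements-injective ⁅ i ⁆)
        (λ r → zero , ≡.sym (x∈⁅y⁆⇒x≡y i (elements∈ ⁅ i ⁆ r))) (singleton-independent (nonzero-coordinates i)))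

  I-w-mono : ∀ {d₁ d₂ n} {U₁ : Subspace d₁ n} {U₂ : Subspace d₂ n} (ℬ₁ : Arrangement U₁) (ℬ₂ : Arrangement U₂)
             (φ : Fin (size ℬ₂) → Fin (size ℬ₁)) → Injective _≡_ _≡_ φ →
             (∀ {S} → Indep U₂ ℬ₂ S → Indep U₁ ℬ₁ (image φ S)) →
             ∀ i → (I ℬ₂ i ≤ I ℬ₁ i) × (abs (w ℬ₂ i) ≤ abs (w ℬ₁ i))
  I-w-mono {U₁ = U₁} {U₂} ℬ₁ ℬ₂ φ φ-injective image-indep i = independentCount-≤ i , whitney-≤ i
    where
    open Comparison (independent? ℬ₁) (independent? ℬ₂) (isMatroid U₁ ℬ₁) (isMatroid U₂ ℬ₂)
      (loopless U₁ ℬ₁) (loopless U₂ ℬ₂) φ φ-injective image-indep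

-- The injection between the two restrictions.

module Specialization {a} (ℝ : CompleteOrderedField a) where

  open CompleteOrderedField ℝ hiding (zero; _≤_)
  open Arrangements ℝ
  open LinearAlgebra ℝ
  open Adjoint ℝ
  open LinearMatroid ℝ
  open VecEq setoid using (_≋_)

  represented : ∀ {k n} (𝒜 : Arrangement (full n)) (U : Subspace k n) e → ¬ (⟦ U ⟧ ⊆ kernel (normal 𝒜 e)) →
                ∃ λ i → (⟦ U ⟧ ∩ kernel (normal 𝒜 e)) ≐ (⟦ U ⟧ ∩ kernel (normal (𝒜 ∣ U) i))
  represented 𝒜 U e proper = Any.index found , Any.lookup-index found
    where
    open Restriction 𝒜 U
    Same : Pred (Fin (size 𝒜)) a
    Same f = (⟦ U ⟧ ∩ kernel (normal 𝒜 e)) ≐ (⟦ U ⟧ ∩ kernel (normal 𝒜 f))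
    found : Any Same indices
    found = Any.deduplicate⁺ _ (λ (y⊆x , x⊆y) (e⊆x , x⊆e) → x⊆y ∘ e⊆x , x⊆e ∘ y⊆x)
      (List.lose (∈-filter⁺ notContaining? (∈-allFin e) proper) (id , id))

  module _ {n} (𝒜 : Arrangement (full n)) (essential : Essential 𝒜) {k} (U₁ U₂ : Subspace k n)
           (specializes : ∀ X → Δ U₁ ∈ adjoint 𝒜 k X → Δ U₂ ∈ adjoint 𝒜 k X) where

    open WeakMap 𝒜 essential U₁ U₂ specializes

    private
      ℬ₁ = 𝒜 ∣ U₁
      ℬ₂ = 𝒜 ∣ U₂

      p₁ : Vector (Vector Carrier k) (size ℬ₁)
      p₁ = coordinates U₁ ∘ normal ℬ₁

      p₂ : Vector (Vector Carrier k) (size ℬ₂)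
      p₂ = coordinates U₂ ∘ normal ℬ₂

      original : Fin (size ℬ₂) → Fin (size 𝒜)
      original = List.lookup (Restriction.indices 𝒜 U₂)

    -- The case of `weak` for a single form: a form that is nonzero on U₂ is nonzero on U₁. Hence φ
    -- is defined on all of 𝒜 ∣ U₂.
    original-proper : ∀ i → ¬ (⟦ U₁ ⟧ ⊆ kernel (normal ℬ₂ i))
    original-proper i U₁⊆ = 1≉0 (weak (const (original i)) (singleton-independent (nonzero-coordinates U₂ ℬ₂ i))
      (const 1#) (λ j → trans (+-identityʳ _) (trans (*-congˡ (vanishing⇒coordinates≋0 U₁ {normal ℬ₂ i} U₁⊆ j)) (zeroʳ _))) zero)

    φ : Fin (size ℬ₂) → Fin (size ℬ₁)
    φ i = proj₁ (represented 𝒜 U₁ (original i) (original-proper i))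

    φ-proportional : ∀ i → ∃ λ γ → γ ≉ 0# × p₁ (φ i) ≋ λ j → γ * forms U₁ (original i) j
    φ-proportional i = proportional U₁ (original-proper i) (nonzero ℬ₁ (φ i))
      (proj₁ (proj₂ (represented 𝒜 U₁ (original i) (original-proper i))))

    φ-independent : ∀ {d} (f : Fin d → Fin (size ℬ₂)) → LinearlyIndependent (p₂ ∘ f) →
                    LinearlyIndependent (p₁ ∘ φ ∘ f)
    φ-independent f ind = independent-scale (proj₁ ∘ φ-proportional ∘ f) (λ r → proj₁ (proj₂ (φ-proportional (f r))))
      (λ r → proj₂ (proj₂ (φ-proportional (f r)))) (weak (original ∘ f) ind)

    -- If one form were a multiple of the other, both would cut out the same hyperplane of U₂, but 𝒜
    -- ∣ U₂ lists each one only once.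
    pair-independent : ∀ {i j} → i ≢ j → LinearlyIndependent (p₂ i Vector.∷ const {B = Fin 1} (p₂ j))
    pair-independent {i} {j} i≢j = [ spanned , id ]′
      (span⊎independent {v = const {B = Fin 1} (p₂ j)} (singleton-independent (nonzero-coordinates U₂ ℬ₂ j)) (p₂ i))
      where
      spanned : p₂ i ∈ Span (const {B = Fin 1} (p₂ j)) → LinearlyIndependent (p₂ i Vector.∷ const {B = Fin 1} (p₂ j))
      spanned (c , pᵢ≋) = contradiction
        (distinct ℬ₂ (parallel U₂ (nonzero ℬ₂ i) λ l → trans (pᵢ≋ l) (+-identityʳ _))) i≢j

    -- Two different hyperplanes have independent forms on U₂, so the forms of their images are
    -- independent on U₁, and an independent family repeats no member.
    φ-injective : Injective _≡_ _≡_ φ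
    φ-injective {i} {j} φi≡φj = Dec.decidable-stable (i Fin.≟ j) λ i≢j → 0≢1
      (independent-injective {v = p₁ ∘ φ ∘ (i Vector.∷ const {B = Fin 1} j)} (φ-independent (i Vector.∷ const {B = Fin 1} j)
        (independent-cong {v = p₂ i Vector.∷ const {B = Fin 1} (p₂ j)} (∷-elements p₂ (const j) i) (pair-independent i≢j)))
        {zero} {suc zero} λ l → reflexive (≡.cong (λ e → p₁ e l) φi≡φj))
      where
      0≢1 : ¬ (_≡_ {A = Fin 2} zero (suc zero))
      0≢1 ()

    image-indep : ∀ {S} → Indep U₂ ℬ₂ S → Indep U₁ ℬ₁ (image φ S)
    image-indep {S} S-ind = independent⇒independentOn U₁ (reindex p₁ (φ ∘ elements S) (elements (image φ S))
      (elements-injective (image φ S)) (image-elements φ S)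
      (φ-independent (elements S) (independentOn⇒independent U₂ S-ind)))

    I-w-≤ : ∀ i → (I ℬ₂ i ≤ I ℬ₁ i) × (abs (w ℬ₂ i) ≤ abs (w ℬ₁ i))
    I-w-≤ = I-w-mono ℬ₁ ℬ₂ φ φ-injective image-indep

theorem1p3 :
    ∀ {a} (ℝ : CompleteOrderedField a) →
    let open CompleteOrderedField ℝ using (Carrier)
        open Arrangements ℝ
    in
    (n : ℕ) (𝒜 : Arrangement (full n)) → Essential 𝒜 →
    (k : ℕ) → k < n →
    (P₁ P₂ : Pred (KSubset n k → Carrier) a) →
    P₁ ∈ L (adjoint 𝒜 k) → P₂ ∈ L (adjoint 𝒜 k) → P₁ ≤ᴸ P₂ →
    (U₁ U₂ : Subspace k n) → U₁ ∈ 𝒮 𝒜 k P₁ → U₂ ∈ 𝒮 𝒜 k P₂ →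
    (i : ℕ) → i ≤ k →
    (I (𝒜 ∣ U₁) i ≥ I (𝒜 ∣ U₂) i) × (abs (w (𝒜 ∣ U₁) i) ≥ abs (w (𝒜 ∣ U₂) i))
theorem1p3 ℝ n 𝒜 essential k k<n P₁ P₂ P₁∈L P₂∈L P₁≤P₂ U₁ U₂ U₁∈𝒮 U₂∈𝒮 i i≤k =
  I-w-≤ 𝒜 essential U₁ U₂ specializes i
  where
  open Arrangements ℝ
  open Specialization ℝ
  open Adjoint ℝ using (stratum⊆)
  specializes : ∀ X → Δ U₁ ∈ adjoint 𝒜 k X → Δ U₂ ∈ adjoint 𝒜 k X
  specializes = stratum⊆ 𝒜 k {P₁} {P₂} P₁∈L P₁≤P₂ {Δ U₁} {Δ U₂} U₁∈𝒮 (proj₁ U₂∈𝒮)
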